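{- For every odd positive integer $k$ and every $n\ge1$, the set $\{w\in B_n:w^k=e\}$, endowed with the map $w\mapsto\mathrm{sDes}(w)$, is a fine set for the character $r^B_{n,k}$ of $B_n$. Equivalently, $$\mathrm{ch}(r^B_{n,k})=\sum_{w\in B_n:\,w^k=e}F_{\mathrm{sDes}(w)}(x,y).$$
   Context: $B_n$: signed permutations $w=(w(1),\dots,w(n))$, $e$ the identity; $\{1,\dots,n,\bar1,\dots,\bar n\}$ ordered by $\bar1<_r\cdots<_r\bar n<_r1<_r\cdots<_rn$. $r^B_{n,k}(w)=|\{u\in B_n:u^k=w\}|$; this class function is known to be a (non-virtual) character of $B_n$. $\mathrm{sDes}(w)=(S,\varepsilon)$: $S$ consists of $n$ and all $s\in[n-1]$ with $w(s)>_rw(s+1)$ or with $w(s)$ barred and $w(s+1)$ unbarred; $\varepsilon(s)=-$ iff $w(s)$ barred. For $\sigma=(S,\varepsilon)$ ($n\in S\subseteq[n]$) with $S=\{s_1<\dots<s_m=n\}$, $s_0=0$: sign vector $\tilde\varepsilon(j)=\varepsilon(s_i)$ for $s_{i-1}<j\le s_i$; ${\rm wDes}(\sigma)$ the set of $s_i$, $i<m$, with $\varepsilon(s_i)=\varepsilon(s_{i+1})$ or ($\varepsilon(s_i)=+$, $\varepsilon(s_{i+1})=-$); $F_\sigma(x,y)=\sum z_{i_1}\cdots z_{i_n}$ over $i_1\le\dots\le i_n$ with $i_j<i_{j+1}$ for $j\in{\rm wDes}(\sigma)$, where $z_{i_j}=x_{i_j}$ if $\tilde\varepsilon(j)=+$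 and $y_{i_j}$ otherwise. $\mathrm{ch}(\chi)=\frac{1}{2^nn!}\sum_{w}\chi(w)p^+_\alpha(x,y)p^-_\beta(x,y)$, $(\alpha,\beta)$ the signed cycle type of $w$ (lengths of positive cycles — pairs of disjoint cycles $c,\bar c$ of $w$ on $\{1,\dots,n,\bar1,\dots,\bar n\}$ — and of negative cycles $c=\bar c$, counted with half their length), $p^\pm_j=\sum_i(x_i^j\pm y_i^j)$, $p^\pm_\lambda=\prod p^\pm_{\lambda_i}$. Fine sets: for a signed composition $\gamma=(\gamma_1,\dots,\gamma_m)$ of $n$ (some parts barred), partial sums $r_i$, $r_0=0$, $S(\gamma)=\{r_1,\dots,r_m\}$, blocks $I_i=\{r_{i-1}+1,\dots,r_i\}$: $\mathrm{wt}_\gamma(\sigma)=0$ if for some $i$, $S\cap\{r_{i-1}+1,\dots,r_i-1\}$ is not an initial segment of $\{r_{i-1}+1,\dots,r_i-1\}$ or $\tilde\varepsilon$ is not constant on $I_i$; else $(-1)^{|S\setminus S(\gamma)|+n_\gamma(\sigma)}$ with $n_\gamma(\sigma)$ the number of $i$ with $\tilde\varepsilon=-$ on $I_i$ and $\gamma_i$ barred. A finite set $\mathcal B$ with a map $\mathrm{sDes}$ is fine for a class function $\chi$ if $\chi(\gamma)=\sum_{b\in\mathcal B}\mathrm{wt}_\gamma(\mathrm{sDes}(b))$ for all $\gamma$, where $\chi(\gamma)$ is the value at elements of signed cycle type (sorted unbarred parts of $\gamma$; sorted barred parts of $\gamma$). -}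

module Defs where

open import Data.Bool using (Bool; true; false; _∧_; _∨_; not; if_then_else_; _xor_)
open import Data.Nat using (ℕ; zero; suc; _+_; _∸_; _≡ᵇ_; _<ᵇ_; _≤ᵇ_)
open import Data.Fin using (Fin; toℕ)
open import Data.Product using (_×_; _,_; proj₁; proj₂)
open import Data.List using (List; []; _∷_; _++_; map; filter; length; foldr; applyUpTo; allFin; concatMap)
open import Data.Bool.ListAction using (and; any; all)
open import Data.List.Relation.Unary.All using (All)
open import Relation.Binary.PropositionalEquality using (_≡_)
open import Data.Vec using (Vec; lookup; tabulate; toList)
import Data.Vec as V
open import Data.Integer using (ℤ; +_; -_; _^_)
import Data.Integer as ℤ
open import Data.Bool using (T)
open import Data.Bool.Properties using (T?)

-- Signed permutations of [n].
-- A candidate element is a vector w with  lookup w i = (j , b)  meaning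
-- w(i+1) = j+1 (Fin is 0-indexed), with a bar iff b = true.

SVec : ℕ → Set
SVec n = Vec (Fin n × Bool) n

allVecs : {A : Set} → List A → (n : ℕ) → List (Vec A n)
allVecs xs zero    = V.[] ∷ []
allVecs xs (suc n) = concatMap (λ x → map (λ v → x V.∷ v) (allVecs xs n)) xs

letters : (n : ℕ) → List (Fin n × Bool)
letters n = concatMap (λ j → (j , false) ∷ (j , true) ∷ []) (allFin n)

finEqᵇ : {n : ℕ} → Fin n → Fin n → Bool
finEqᵇ i j = toℕ i ≡ᵇ toℕ j

boolEqᵇ : Bool → Bool → Bool
boolEqᵇ a b = not (a xor b)

-- the map i ↦ |w(i)| is onto Fin n (hence a bijection of [n])
isSignedPermᵇ : {n : ℕ} → SVec n → Bool
isSignedPermᵇ {n} w =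
  all (λ j → any (λ x → finEqᵇ (proj₁ x) j) (toList w)) (allFin n)

B : (n : ℕ) → List (SVec n)
B n = filter (λ w → T? (isSignedPermᵇ w)) (allVecs (letters n) n)

e : (n : ℕ) → SVec n
e n = tabulate (λ i → (i , false))

-- product (u · v)(i) = u(v(i)), using u(ī) = overline(u(i))
_·_ : {n : ℕ} → SVec n → SVec n → SVec n
u · v = tabulate (λ i → let jb = lookup v i ; kc = lookup u (proj₁ jb)
                        in (proj₁ kc , proj₂ jb xor proj₂ kc))

_^ˢ_ : {n : ℕ} → SVec n → ℕ → SVec n
_^ˢ_ {n} u zero    = e n
u ^ˢ suc k = u · (u ^ˢ k)

sEqᵇ : {n : ℕ} → SVec n → SVec n → Bool
sEqᵇ u v = and (V.toList (V.zipWith (λ a b → finEqᵇ (proj₁ a) (proj₁ b) ∧ boolEqᵇ (proj₂ a) (proj₂ b)) u v))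

rB : (n k : ℕ) → SVec n → ℕ
rB n k w = length (filter (λ u → T? (sEqᵇ (u ^ˢ k) w)) (B n))

rootsOfUnity : (n k : ℕ) → List (SVec n)
rootsOfUnity n k = filter (λ w → T? (sEqᵇ (w ^ˢ k) (e n))) (B n)

-- ℕ-level, 1-indexed view: the list (w(1), …, w(n)) with entries
-- (|w(i)| , barred?) and |w(i)| ∈ {1,…,n}.

vals : {n : ℕ} → SVec n → List (ℕ × Bool)
vals w = map (λ x → (suc (toℕ (proj₁ x)) , proj₂ x)) (toList w)

-- 1-indexed lookup, default (0 , false) out of range
get : List (ℕ × Bool) → ℕ → ℕ × Bool
get []       _             = (0 , false)
get (x ∷ xs) zero          = (0 , false)
get (x ∷ xs) (suc zero)    = x
get (x ∷ xs) (suc (suc i)) = get xs (suc i)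

-- a >_r b for the order  1̄ <_r ⋯ <_r n̄ <_r 1 <_r ⋯ <_r n
_>r_ : ℕ × Bool → ℕ × Bool → Bool
(a , true)  >r (b , true)  = b <ᵇ a
(a , true)  >r (b , false) = false
(a , false) >r (b , true)  = true
(a , false) >r (b , false) = b <ᵇ a

range : ℕ → ℕ → List ℕ
range a b = applyUpTo (λ j → a + j) (suc b ∸ a)

-- Signed descent data σ = (S , ε) on [n]: S given by its indicator on
-- 1..n, ε(s) = true meaning ε(s) = −.

record SDesc : Set where
  constructor mkSDesc
  field
    size : ℕ
    inS  : ℕ → Bool
    eps  : ℕ → Bool
open SDesc public

sDes : {n : ℕ} → SVec n → SDesc
sDes {n} w = mkSDesc n inS' eps'
  where
    L = vals w
    inS' : ℕ → Bool
    inS' s = (s ≡ᵇ n) ∨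
             ((1 ≤ᵇ s) ∧ (s <ᵇ n) ∧
              ((get L s >r get L (suc s)) ∨ (proj₂ (get L s) ∧ not (proj₂ (get L (suc s))))))
    eps' : ℕ → Bool
    eps' s = proj₂ (get L s)

-- least s ∈ S with s ≥ j (n ∈ S, so this is ≤ n)
nextS : SDesc → ℕ → ℕ
nextS σ j = go (size σ ∸ j) j
  where
    go : ℕ → ℕ → ℕ
    go zero    j = j
    go (suc f) j = if inS σ j then j else go f (suc j)

-- the sign vector ε̃(j) = ε(s_i) for s_{i-1} < j ≤ s_i  (true = −)
epsT : SDesc → ℕ → Bool
epsT σ j = eps σ (nextS σ j)

-- Signed compositions: lists of parts (γᵢ , barred?) with γᵢ ≥ 1.

partsSum : List (ℕ × Bool) → ℕ
partsSum = foldr (λ p s → proj₁ p + s) 0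

IsSignedComposition : ℕ → List (ℕ × Bool) → Set
IsSignedComposition n γ = All (λ p → 1 Data.Nat.≤ proj₁ p) γ × (partsSum γ ≡ n)

partialSums : ℕ → List (ℕ × Bool) → List ℕ
partialSums a []            = []
partialSums a ((l , b) ∷ γ) = (a + l) ∷ partialSums (a + l) γ

-- block I = {a+1,…,a+l}: S ∩ {a+1,…,a+l−1} is an initial segment of
-- {a+1,…,a+l−1} (i.e. closed downwards) and ε̃ is constant on I
blockOK : SDesc → ℕ → ℕ → Bool
blockOK σ a l =
  all (λ j → not (inS σ j) ∨ inS σ (j ∸ 1)) (range (a + 2) (a + l ∸ 1)) ∧
  all (λ j → boolEqᵇ (epsT σ j) (epsT σ (suc a))) (range (suc a) (a + l))

allBlocksOK : SDesc → ℕ → List (ℕ × Bool) → Bool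
allBlocksOK σ a []            = true
allBlocksOK σ a ((l , b) ∷ γ) = blockOK σ a l ∧ allBlocksOK σ (a + l) γ

nGamma : SDesc → ℕ → List (ℕ × Bool) → ℕ
nGamma σ a []            = 0
nGamma σ a ((l , b) ∷ γ) =
  (if epsT σ (suc a) ∧ b then 1 else 0) + nGamma σ (a + l) γ

sMinusSγ : SDesc → List (ℕ × Bool) → ℕ
sMinusSγ σ γ = length (filter (λ s → T? (inS σ s ∧ not (any (λ r → r ≡ᵇ s) (partialSums 0 γ))))
                              (range 1 (size σ)))

wt : List (ℕ × Bool) → SDesc → ℤ
wt γ σ = if allBlocksOK σ 0 γ
         then (- (+ 1)) ^ (sMinusSγ σ γ + nGamma σ 0 γ)
         else + 0

sumℤ : List ℤ → ℤ
sumℤ = foldr ℤ._+_ (+ 0)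

-- Canonical element of signed cycle type γ: on each block
-- {a+1,…,a+l} it is the cycle a+1 ↦ a+2 ↦ ⋯ ↦ a+l ↦ a+1, with the last
-- value barred iff γᵢ is barred (a positive l-cycle, resp. a negative
-- cycle counted with length l).  Given as the ℕ-level list vals.

canonBlocks : ℕ → List (ℕ × Bool) → List (ℕ × Bool)
canonBlocks a []            = []
canonBlocks a ((l , b) ∷ γ) =
  applyUpTo (λ j → (a + j + 2 , false)) (l ∸ 1) ++ ((a + 1 , b) ∷ [])
  ++ canonBlocks (a + l) γ

canon : List (ℕ × Bool) → List (ℕ × Bool)
canon γ = canonBlocks 0 γ

{-# OPTIONS --safe #-}
-- Write a signed permutation as (v , s), v a permutation and s a vector of signs in F₂ⁿ.
-- Then (v , s)^k = (v^k , T_v s), where (T_v s)(x) is the sum of s(v^t x) over t < k.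
-- Only vectors s that are constant on the blocks of γ contribute to the right-hand side,
-- and for such s the claim reduces to an identity about permutations: the v with v^k the
-- product of the block cycles and T_v s = 0 are counted by the v with v^k = 1 and
-- T_v s = 0, weighted on each block by ±1 if its descents precede its ascents and by 0
-- otherwise.  With complete homogeneous blocks (where v has to increase) in place of
-- these power sum blocks, the identity is a Gessel–Reutenauer bijection: a labelling f
-- with f ∘ u^k = f is encoded by the itineraries of the points, which are sorted stably.
-- Newton's recursion ℓ h_ℓ = Σ h_p p_{ℓ-p}, valid on both sides, then introduces the
-- power sums one block at a time.  Finally, by Fourier inversion over F₂, the number of
-- solutions of T_v s = b is the sum of the characters (-1)^(s·b) over the kernel of T_v.
module Submission where

open import Defs
open import Data.Bool using (Bool; true; false; not; if_then_else_; _∧_; _∨_; _xor_; T)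
import Data.Bool.Properties as Boolₚ
open import Data.Nat using (ℕ; zero; suc; _≤_; _<_; z≤n; s≤s; _*_; _+_; _∸_)
import Data.Nat as ℕ
import Data.Nat.Properties as ℕₚ
open import Data.Nat.ListAction using (sum)
open import Data.Nat.DivMod using (_%_; _/_; m≡m%n+[m/n]*n; m%n<n)
open import Data.Product using (_×_; Σ; ∃; _,_; proj₁; proj₂)
open import Data.Sum using (_⊎_; inj₁; inj₂; [_,_]′)
open import Data.Empty using (⊥; ⊥-elim)
open import Data.Unit using (⊤; tt)
open import Data.List using (List; []; _∷_; _++_; map; filter; length; concatMap; cartesianProduct; cartesianProductWith; allFin; upTo; take; drop; applyUpTo; replicate)
import Data.List as List
import Data.List.Properties as Listₚ
open import Data.List.Membership.Propositional using (_∈_)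
import Data.List.Membership.Propositional.Properties as ∈ₚ
open import Data.List.Membership.Propositional.Properties.WithK using (unique∧set⇒bag)
open import Data.List.Relation.Binary.BagAndSetEquality using (∼bag⇒↭)
open import Data.List.Relation.Unary.Any using (here; there)
open import Data.List.Relation.Unary.All using (All; []; _∷_)
import Data.List.Relation.Unary.All as All
import Data.List.Relation.Unary.All.Properties as Allₚ
open import Data.List.Relation.Unary.AllPairs using (AllPairs; []; _∷_; allPairs?)
open import Data.List.Relation.Unary.Unique.Propositional using (Unique)
import Data.List.Relation.Unary.Unique.Propositional.Properties as Uniqueₚ
open import Data.List.Relation.Binary.Permutation.Propositional using (_↭_; prep; swap) renaming (refl to ↭refl; trans to ↭trans)
open import Data.Fin using (Fin; zero; suc; toℕ; fromℕ<; punchOut)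
import Data.Fin as Fin
import Data.Fin.Properties as Finₚ
open import Data.Vec using (Vec; []; _∷_; tabulate; _∷ʳ_; toList) renaming (lookup to infixl 10 _!_)
import Data.Vec as Vec
import Data.Vec.Properties as Vecₚ
open import Data.Integer using (ℤ; +_)
import Data.Integer as ℤ
import Data.Integer.Properties as ℤₚ
open import Data.Integer.Tactic.RingSolver using (solve-∀)
open import Data.Bool.ListAction using (and; any; all)
open import Function using (_∘_; id; mk⇔; Equivalence)
open import Relation.Nullary using (Dec; yes; no; ¬_; does; contradiction)
open import Relation.Nullary.Decidable using (_×-dec_; _⊎-dec_; _→-dec_; map′)
open import Relation.Unary using (Pred; Decidable)
open import Relation.Binary using (DecidableEquality; tri<; tri≈; tri>)
open import Relation.Binary.PropositionalEquality using (_≡_; _≢_; refl; sym; trans; cong; cong₂; subst; module ≡-Reasoning)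

-- The bars are what separates the sign vectors of the two sides: T_v s = b on the left, T_v s = 0
-- on the right. Fourier inversion turns b into a character, after which both sides run over kernels
-- of the operators T_v and can be compared for one fixed s. Being constant on the blocks, s has the
-- form ε ∘ f for a labelling f by blocks; T_v s is then the parity of an itinerary and is respected
-- by every bijection that preserves itineraries. The labelled side ranges over all labellings with
-- given class sizes, not only the sorted one, because splitting off a cycle does not keep a
-- labelling sorted. This costs a factor n!, which appears on both sides and cancels. Newton's
-- recursion is read as p_ℓ = ℓ h_ℓ - Σ h_p p_{ℓ-p} over 0 < p < ℓ, so no division occurs. Each step
-- creates a further block h_p. To keep the alphabet of labels and the sign function ε fixed during
-- the recursion, the labels of these blocks are reserved in advance, all with the sign of the block
-- they come from.

private variable
  A C R Q : Set
  n N : ℕ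

-- Finite sums, Iverson brackets and summation along bijections.

∑ : List A → (A → ℤ) → ℤ
∑ xs f = sumℤ (map f xs)

∑-cong∈ : (xs : List A) {f g : A → ℤ} → (∀ {x} → x ∈ xs → f x ≡ g x) → ∑ xs f ≡ ∑ xs g
∑-cong∈ []       eq = refl
∑-cong∈ (x ∷ xs) eq = cong₂ ℤ._+_ (eq (here refl)) (∑-cong∈ xs (eq ∘ there))

∑-cong : (xs : List A) {f g : A → ℤ} → (∀ x → f x ≡ g x) → ∑ xs f ≡ ∑ xs g
∑-cong xs eq = ∑-cong∈ xs (λ {x} _ → eq x)

∑-const0 : (xs : List A) → ∑ xs (λ _ → + 0) ≡ + 0
∑-const0 []       = refl
∑-const0 (x ∷ xs) = trans (ℤₚ.+-identityˡ _) (∑-const0 xs)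

∑-+ : (xs : List A) (f g : A → ℤ) → ∑ xs (λ x → f x ℤ.+ g x) ≡ ∑ xs f ℤ.+ ∑ xs g
∑-+ []       f g = refl
∑-+ (x ∷ xs) f g rewrite ∑-+ xs f g = lemma (f x) (g x) (∑ xs f) (∑ xs g)
  where
  lemma : ∀ a b c d → (a ℤ.+ b) ℤ.+ (c ℤ.+ d) ≡ (a ℤ.+ c) ℤ.+ (b ℤ.+ d)
  lemma = solve-∀

∑-*ˡ : (xs : List A) (c : ℤ) (f : A → ℤ) → ∑ xs (λ x → c ℤ.* f x) ≡ c ℤ.* ∑ xs f
∑-*ˡ []       c f = sym (ℤₚ.*-zeroʳ c)
∑-*ˡ (x ∷ xs) c f rewrite ∑-*ˡ xs c f = sym (ℤₚ.*-distribˡ-+ c (f x) (∑ xs f))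

∑-*ʳ : (xs : List A) (c : ℤ) (f : A → ℤ) → ∑ xs (λ x → f x ℤ.* c) ≡ ∑ xs f ℤ.* c
∑-*ʳ xs c f = trans (∑-cong xs (λ x → ℤₚ.*-comm (f x) c)) (trans (∑-*ˡ xs c f) (ℤₚ.*-comm c _))

∑-++ : (xs ys : List A) (f : A → ℤ) → ∑ (xs ++ ys) f ≡ ∑ xs f ℤ.+ ∑ ys f
∑-++ []       ys f = sym (ℤₚ.+-identityˡ _)
∑-++ (x ∷ xs) ys f rewrite ∑-++ xs ys f = sym (ℤₚ.+-assoc (f x) _ _)

∑-map : (h : A → C) (xs : List A) (f : C → ℤ) → ∑ (map h xs) f ≡ ∑ xs (f ∘ h)
∑-map h xs f = cong sumℤ (sym (Listₚ.map-∘ xs))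

∑-swap : (xs : List A) (ys : List C) (f : A → C → ℤ) →
  ∑ xs (λ x → ∑ ys (f x)) ≡ ∑ ys (λ y → ∑ xs (λ x → f x y))
∑-swap []       ys f = sym (∑-const0 ys)
∑-swap (x ∷ xs) ys f rewrite ∑-swap xs ys f = sym (∑-+ ys (f x) (λ y → ∑ xs (λ x → f x y)))

∑-product : (xs : List A) (ys : List C) (f : A × C → ℤ) →
  ∑ (cartesianProduct xs ys) f ≡ ∑ xs (λ x → ∑ ys (λ y → f (x , y)))
∑-product []       ys f = refl
∑-product (x ∷ xs) ys f = trans (∑-++ (map (x ,_) ys) _ f)
  (cong₂ ℤ._+_ (∑-map (x ,_) ys f) (∑-product xs ys f))

∑-↭ : {xs ys : List A} (f : A → ℤ) → xs ↭ ys → ∑ xs f ≡ ∑ ys f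
∑-↭ f ↭refl         = refl
∑-↭ f (prep x p)    = cong (λ s → f x ℤ.+ s) (∑-↭ f p)
∑-↭ f (swap x y p)  rewrite ∑-↭ f p = lemma (f x) (f y) _
  where
  lemma : ∀ a b c → a ℤ.+ (b ℤ.+ c) ≡ b ℤ.+ (a ℤ.+ c)
  lemma = solve-∀
∑-↭ f (↭trans p q)  = trans (∑-↭ f p) (∑-↭ f q)

-- Iverson bracket
abstract
  𝟙 : Dec R → ℤ
  𝟙 d = if does d then + 1 else + 0

  𝟙-yes : (d : Dec R) → R → 𝟙 d ≡ + 1
  𝟙-yes (yes _) r = refl
  𝟙-yes (no ¬r) r = contradiction r ¬r

  𝟙-no : (d : Dec R) → ¬ R → 𝟙 d ≡ + 0
  𝟙-no (yes r) ¬r = contradiction r ¬r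
  𝟙-no (no _)  ¬r = refl

𝟙-cong : (d : Dec R) (d′ : Dec Q) → (R → Q) → (Q → R) → 𝟙 d ≡ 𝟙 d′
𝟙-cong d@(yes r) d′ to from = trans (𝟙-yes d r) (sym (𝟙-yes d′ (to r)))
𝟙-cong d@(no ¬r) d′ to from = trans (𝟙-no d ¬r) (sym (𝟙-no d′ (¬r ∘ from)))

𝟙-× : (d : Dec R) (d′ : Dec Q) → 𝟙 (d ×-dec d′) ≡ 𝟙 d ℤ.* 𝟙 d′
𝟙-× d@(yes r) d′ = trans (𝟙-cong (d ×-dec d′) d′ proj₂ (r ,_))
  (trans (sym (ℤₚ.*-identityˡ _)) (cong (ℤ._* 𝟙 d′) (sym (𝟙-yes d r))))
𝟙-× d@(no ¬r) d′ = trans (𝟙-no (d ×-dec d′) (¬r ∘ proj₁))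
  (sym (cong (ℤ._* 𝟙 d′) (𝟙-no d ¬r)))

𝟙-guard : (d : Dec R) {x y : ℤ} → (R → x ≡ y) → 𝟙 d ℤ.* x ≡ 𝟙 d ℤ.* y
𝟙-guard d@(yes r) eq = cong (𝟙 d ℤ.*_) (eq r)
𝟙-guard d@(no ¬r) {x} {y} eq =
  trans (cong (ℤ._* x) (𝟙-no d ¬r)) (sym (cong (ℤ._* y) (𝟙-no d ¬r)))

∑-filter : {P : Pred A _} (P? : Decidable P) (xs : List A) (f : A → ℤ) →
  ∑ (filter P? xs) f ≡ ∑ xs (λ x → 𝟙 (P? x) ℤ.* f x)
∑-filter P? []       f = refl
∑-filter P? (x ∷ xs) f with P? x
... | yes p = cong₂ ℤ._+_ (sym (trans (cong (ℤ._* f x) (𝟙-yes (yes p) p)) (ℤₚ.*-identityˡ (f x)))) (∑-filter P? xs f)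
... | no ¬p = trans (∑-filter P? xs f) (sym (trans (cong (λ c → c ℤ.* f x ℤ.+ _) (𝟙-no (no ¬p) ¬p)) (ℤₚ.+-identityˡ _)))

length-∑ : (xs : List A) → + length xs ≡ ∑ xs (λ _ → + 1)
length-∑ []       = refl
length-∑ (x ∷ xs) = trans (ℤₚ.pos-+ 1 (length xs)) (cong (λ s → + 1 ℤ.+ s) (length-∑ xs))

Unique-map∈ : (φ : A → C) (xs : List A) → Unique xs →
  (∀ {a b} → a ∈ xs → b ∈ xs → φ a ≡ φ b → a ≡ b) → Unique (map φ xs)
Unique-map∈ φ []       []          inj = []
Unique-map∈ φ (x ∷ xs) (x∉ ∷ uniq) inj =
  Allₚ.map⁺ (All.tabulate (λ y∈ eq → All.lookup x∉ y∈ (inj (here refl) (there y∈) eq)))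
  ∷ Unique-map∈ φ xs uniq (λ a∈ b∈ → inj (there a∈) (there b∈))

-- The maps have to be mutually inverse only on the supports of `P` and `Q`, so `φ` and `ψ` may take
-- arbitrary values elsewhere. Uniqueness of entries upgrades equality of the filtered lists as sets
-- to equality up to permutation.
∑-bij : {xs : List A} {ys : List C} → Unique xs → Unique ys →
  {P : Pred A _} {Q : Pred C _} (P? : Decidable P) (Q? : Decidable Q)
  (f : A → ℤ) (g : C → ℤ) (φ : A → C) (ψ : C → A) →
  (∀ {a} → a ∈ xs → P a → (φ a ∈ ys) × Q (φ a) × (ψ (φ a) ≡ a) × (f a ≡ g (φ a))) →
  (∀ {b} → b ∈ ys → Q b → (ψ b ∈ xs) × P (ψ b) × (φ (ψ b) ≡ b)) →
  ∑ xs (λ a → 𝟙 (P? a) ℤ.* f a) ≡ ∑ ys (λ b → 𝟙 (Q? b) ℤ.* g b)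
∑-bij {xs = xs} {ys} ux uy P? Q? f g φ ψ to from = begin
  ∑ xs (λ a → 𝟙 (P? a) ℤ.* f a) ≡⟨ ∑-filter P? xs f ⟨
  ∑ xs′ f ≡⟨ ∑-cong∈ xs′ (λ a∈ → let (m , p) = split a∈ in proj₂ (proj₂ (proj₂ (to m p)))) ⟩
  ∑ xs′ (g ∘ φ) ≡⟨ ∑-map φ xs′ g ⟨
  ∑ (map φ xs′) g ≡⟨ ∑-↭ g perm ⟩
  ∑ ys′ g ≡⟨ ∑-filter Q? ys g ⟩
  ∑ ys (λ b → 𝟙 (Q? b) ℤ.* g b) ∎
  where
  open ≡-Reasoning
  xs′ = filter P? xs
  ys′ = filter Q? ys
  split : ∀ {a} → a ∈ xs′ → (a ∈ xs) × _
  split = ∈ₚ.∈-filter⁻ P?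
  ψφ : ∀ {a} → a ∈ xs′ → ψ (φ a) ≡ a
  ψφ a∈ = let (m , p) = split a∈ in proj₁ (proj₂ (proj₂ (to m p)))
  image⊆ : ∀ {b} → b ∈ map φ xs′ → b ∈ ys′
  image⊆ b∈ with ∈ₚ.∈-map⁻ φ b∈
  ... | a , a∈ , refl = let (m , p) = split a∈ ; (m′ , q , _) = to m p in ∈ₚ.∈-filter⁺ Q? m′ q
  ⊆image : ∀ {b} → b ∈ ys′ → b ∈ map φ xs′
  ⊆image b∈ = let (m , q) = ∈ₚ.∈-filter⁻ Q? b∈ ; (m′ , p , eq) = from m q in
    subst (_∈ map φ xs′) eq (∈ₚ.∈-map⁺ φ (∈ₚ.∈-filter⁺ P? m′ p))
  perm : map φ xs′ ↭ ys′
  perm = ∼bag⇒↭ (unique∧set⇒bag (Unique-map∈ φ xs′ (Uniqueₚ.filter⁺ P? ux)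
      (λ a∈ b∈ eq → trans (sym (ψφ a∈)) (trans (cong ψ eq) (ψφ b∈))))
    (Uniqueₚ.filter⁺ Q? uy) (mk⇔ image⊆ ⊆image))

∑-reindex : {xs : List A} → Unique xs → (g : A → ℤ) (φ ψ : A → A) →
  (∀ {a} → a ∈ xs → φ a ∈ xs × ψ (φ a) ≡ a) → (∀ {a} → a ∈ xs → ψ a ∈ xs × φ (ψ a) ≡ a) →
  ∑ xs (g ∘ φ) ≡ ∑ xs g
∑-reindex {xs = xs} u g φ ψ to from = trans (sym (∑-map φ xs g)) (∑-↭ g perm)
  where
  perm : map φ xs ↭ xs
  perm = ∼bag⇒↭ (unique∧set⇒bag (Unique-map∈ φ xs u (λ a∈ b∈ eq → trans (sym (proj₂ (to a∈))) (trans (cong ψ eq) (proj₂ (to b∈)))))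
    u (mk⇔ (λ b∈ → let (a , a∈ , eq) = ∈ₚ.∈-map⁻ φ b∈ in subst (_∈ xs) (sym eq) (proj₁ (to a∈)))
           (λ b∈ → subst (_∈ map φ xs) (proj₂ (from b∈)) (∈ₚ.∈-map⁺ φ (proj₁ (from b∈))))))

-- Enumeration of vectors, and iteration of maps.

allVecs≡product : (xs : List A) (n : ℕ) → allVecs xs (suc n) ≡ cartesianProductWith _∷_ xs (allVecs xs n)
allVecs≡product xs n = go xs
  where
  go : ∀ ys → concatMap (λ x → map (λ v → x ∷ v) (allVecs xs n)) ys ≡ cartesianProductWith _∷_ ys (allVecs xs n)
  go []       = refl
  go (y ∷ ys) = cong (map (y ∷_) (allVecs xs n) ++_) (go ys)

∑-allVecs-suc : (xs : List A) (n : ℕ) (f : Vec A (suc n) → ℤ) →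
  ∑ (allVecs xs (suc n)) f ≡ ∑ xs (λ x → ∑ (allVecs xs n) (λ v → f (x ∷ v)))
∑-allVecs-suc xs n f = go xs
  where
  go : ∀ ys → ∑ (concatMap (λ x → map (λ v → x ∷ v) (allVecs xs n)) ys) f ≡ ∑ ys (λ x → ∑ (allVecs xs n) (λ v → f (x ∷ v)))
  go []       = refl
  go (y ∷ ys) = trans (∑-++ (map (y ∷_) (allVecs xs n)) _ f)
    (cong₂ ℤ._+_ (∑-map (y ∷_) (allVecs xs n) f) (go ys))

allVecs-unique : {xs : List A} (n : ℕ) → Unique xs → Unique (allVecs xs n)
allVecs-unique zero    u = [] ∷ []
allVecs-unique {xs = xs} (suc n) u = subst Unique (sym (allVecs≡product xs n))
  (Uniqueₚ.cartesianProductWith⁺ _∷_ (λ { refl → refl , refl }) u (allVecs-unique n u))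

∈-allVecs⁺ : {xs : List A} {n : ℕ} (v : Vec A n) → (∀ i → v ! i ∈ xs) → v ∈ allVecs xs n
∈-allVecs⁺ []      h = here refl
∈-allVecs⁺ {xs = xs} {suc n} (x ∷ v) h = subst (_ ∈_) (sym (allVecs≡product xs n))
  (∈ₚ.∈-cartesianProductWith⁺ _∷_ (h zero) (∈-allVecs⁺ v (h ∘ suc)))

∈-allVecs⁻ : {xs : List A} {n : ℕ} {v : Vec A n} → v ∈ allVecs xs n → ∀ i → v ! i ∈ xs
∈-allVecs⁻ {xs = xs} {suc n} v∈ i
  with ∈ₚ.∈-cartesianProductWith⁻ _∷_ xs (allVecs xs n) (subst (_ ∈_) (allVecs≡product xs n) v∈)
∈-allVecs⁻ v∈ zero    | x , v , x∈ , v∈′ , refl = x∈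
∈-allVecs⁻ v∈ (suc i) | x , v , x∈ , v∈′ , refl = ∈-allVecs⁻ v∈′ i

iter : (A → A) → ℕ → A → A
iter f zero    x = x
iter f (suc t) x = f (iter f t x)

iter-comm : (f : A → A) (t : ℕ) (x : A) → iter f t (f x) ≡ f (iter f t x)
iter-comm f zero    x = refl
iter-comm f (suc t) x = cong f (iter-comm f t x)

iter-+ : (f : A → A) (s t : ℕ) (x : A) → iter f (s + t) x ≡ iter f s (iter f t x)
iter-+ f zero    t x = refl
iter-+ f (suc s) t x = cong f (iter-+ f s t x)

iter-natural : (f : A → A) (g : C → C) (h : A → C) → (∀ x → h (f x) ≡ g (h x)) →
  ∀ t x → h (iter f t x) ≡ iter g t (h x)
iter-natural f g h eq zero    x = refl
iter-natural f g h eq (suc t) x = trans (eq _) (cong g (iter-natural f g h eq t x))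

iter-cong : {f g : A → A} → (∀ x → f x ≡ g x) → ∀ t x → iter f t x ≡ iter g t x
iter-cong {f = f} {g} eq t x = iter-natural f g id eq t x

vec-ext : {u v : Vec A n} → (∀ x → u ! x ≡ v ! x) → u ≡ v
vec-ext {u = u} {v} eq =
  trans (sym (Vecₚ.tabulate∘lookup u)) (trans (Vecₚ.tabulate-cong eq) (Vecₚ.tabulate∘lookup v))

-- Permutations as injective vectors.

infixl 9 _⊙_
abstract
  _⊙_ : Vec A n → Vec (Fin n) n → Vec A n
  f ⊙ g = tabulate (λ x → f ! (g ! x))

  ⊙! : (f : Vec A n) (g : Vec (Fin n) n) (x : Fin n) → (f ⊙ g) ! x ≡ f ! (g ! x)
  ⊙! f g = Vecₚ.lookup∘tabulate (λ x → f ! (g ! x))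

record Perm {n : ℕ} (u : Vec (Fin n) n) : Set where
  constructor injective
  field inj : ∀ x y → u ! x ≡ u ! y → x ≡ y
open Perm public

perm? : (u : Vec (Fin n) n) → Dec (Perm u)
perm? u = map′ injective inj
  (Finₚ.all? λ x → Finₚ.all? λ y → (u ! x Finₚ.≟ u ! y) →-dec (x Finₚ.≟ y))

perms : ∀ n → List (Vec (Fin n) n)
perms n = filter perm? (allVecs (allFin n) n)

perms-unique : Unique (perms n)
perms-unique {n} = Uniqueₚ.filter⁺ perm? (allVecs-unique n (Uniqueₚ.allFin⁺ n))

∈-perms⁺ : {u : Vec (Fin n) n} → Perm u → u ∈ perms n
∈-perms⁺ {u = u} p = ∈ₚ.∈-filter⁺ perm? (∈-allVecs⁺ u (λ i → ∈ₚ.∈-allFin (u ! i))) p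

∈-perms⁻ : {u : Vec (Fin n) n} → u ∈ perms n → Perm u
∈-perms⁻ {n} u∈ = proj₂ (∈ₚ.∈-filter⁻ perm? {xs = allVecs (allFin n) n} u∈)

-- A missed value `y` could be punched out of the codomain, which would leave an injection of
-- `Fin (suc n)` into `Fin n`.
surjective : (u : Vec (Fin n) n) → Perm u → ∀ y → ∃ λ x → u ! x ≡ y
surjective {suc n} u p y with Finₚ.any? (λ x → u ! x Finₚ.≟ y)
... | yes found = found
... | no  miss  = ⊥-elim (ℕₚ.1+n≰n (Finₚ.injective⇒≤ {f = squeeze} (λ {a} {b} → squeeze-inj {a} {b})))
  where
  y≢ : ∀ x → y ≢ u ! x
  y≢ x eq = miss (x , sym eq)
  squeeze : Fin (suc n) → Fin n
  squeeze x = punchOut (y≢ x)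
  squeeze-inj : ∀ {a b} → squeeze a ≡ squeeze b → a ≡ b
  squeeze-inj {a} {b} eq = inj p a b (Finₚ.punchOut-injective (y≢ a) (y≢ b) eq)

preimage : Vec (Fin n) n → Fin n → Fin n
preimage u y with Finₚ.any? (λ x → u ! x Finₚ.≟ y)
... | yes (x , _) = x
... | no  _       = y

abstract
  -- junk value y where y has no preimage
  inv : Vec (Fin n) n → Vec (Fin n) n
  inv u = tabulate (preimage u)

  inv-r : (u : Vec (Fin n) n) → Perm u → ∀ y → u ! (inv u ! y) ≡ y
  inv-r u p y = trans (cong (u !_) (Vecₚ.lookup∘tabulate (preimage u) y)) go
    where
    go : u ! preimage u y ≡ y
    go with Finₚ.any? (λ x → u ! x Finₚ.≟ y)
    ... | yes (_ , eq) = eq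
    ... | no  miss     = contradiction (surjective u p y) miss

inv-l : (u : Vec (Fin n) n) → Perm u → ∀ x → inv u ! (u ! x) ≡ x
inv-l u p x = inj p _ _ (inv-r u p (u ! x))

Perm-inv : {u : Vec (Fin n) n} → Perm u → Perm (inv u)
Perm-inv {u = u} p = injective λ x y eq → trans (sym (inv-r u p x)) (trans (cong (u !_) eq) (inv-r u p y))

Perm-⊙ : {u v : Vec (Fin n) n} → Perm u → Perm v → Perm (u ⊙ v)
Perm-⊙ {u = u} {v} p q = injective λ x y eq → inj q x y (inj p _ _ (trans (sym (⊙! u v x)) (trans eq (⊙! u v y))))

Perm-iter : {u : Vec (Fin n) n} → Perm u → ∀ t {x y} → iter (u !_) t x ≡ iter (u !_) t y → x ≡ y
Perm-iter p zero    eq = eq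
Perm-iter p (suc t) eq = Perm-iter p t (inj p _ _ eq)

-- Counting points of a finite set.

# : {n : ℕ} {P : Fin n → Set} → (∀ x → Dec (P x)) → ℕ
# {zero}  P? = 0
# {suc n} P? = (if does (P? zero) then 1 else 0) + # (λ x → P? (suc x))

∑-allFin-suc : (f : Fin (suc n) → ℤ) → ∑ (allFin (suc n)) f ≡ f zero ℤ.+ ∑ (allFin n) (f ∘ suc)
∑-allFin-suc {n} f = cong (λ s → f zero ℤ.+ s)
  (trans (cong (λ l → ∑ l f) (sym (Listₚ.map-tabulate id suc))) (∑-map suc (allFin n) f))

#-∑ : {P : Fin n → Set} (P? : ∀ x → Dec (P x)) → + # P? ≡ ∑ (allFin n) (λ x → 𝟙 (P? x))
#-∑ {zero}  P? = refl
#-∑ {suc n} P? = trans (ℤₚ.pos-+ (if does (P? zero) then 1 else 0) _)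
  (trans (cong₂ ℤ._+_ (pos-if (P? zero)) (#-∑ (P? ∘ suc))) (sym (∑-allFin-suc (λ x → 𝟙 (P? x)))))
  where
  pos-if : (d : Dec R) → + (if does d then 1 else 0) ≡ 𝟙 d
  pos-if d@(yes r) = sym (𝟙-yes d r)
  pos-if d@(no ¬r) = sym (𝟙-no d ¬r)

#-cong : {P Q : Fin n → Set} (P? : ∀ x → Dec (P x)) (Q? : ∀ x → Dec (Q x)) →
  (∀ x → P x → Q x) → (∀ x → Q x → P x) → # P? ≡ # Q?
#-cong P? Q? to from = ℤₚ.+-injective (trans (#-∑ P?)
  (trans (∑-cong (allFin _) (λ x → 𝟙-cong (P? x) (Q? x) (to x) (from x))) (sym (#-∑ Q?))))

#-perm : {P : Fin n → Set} (P? : ∀ x → Dec (P x)) {g : Vec (Fin n) n} → Perm g →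
  # (λ x → P? (g ! x)) ≡ # P?
#-perm {n} P? {g} p = ℤₚ.+-injective (trans (#-∑ (λ x → P? (g ! x))) (trans
  (∑-reindex (Uniqueₚ.allFin⁺ n) (λ x → 𝟙 (P? x)) (g !_) (inv g !_)
    (λ _ → ∈ₚ.∈-allFin _ , inv-l g p _) (λ _ → ∈ₚ.∈-allFin _ , inv-r g p _)) (sym (#-∑ P?))))

bit-mono : (d : Dec R) (d′ : Dec Q) → (R → Q) → (if does d then 1 else 0) ≤ (if does d′ then 1 else 0)
bit-mono (yes r) (yes q) sub = ℕₚ.≤-refl
bit-mono (yes r) (no ¬q) sub = contradiction (sub r) ¬q
bit-mono (no _)  _       sub = z≤n

#-mono : {P Q : Fin n → Set} (P? : ∀ x → Dec (P x)) (Q? : ∀ x → Dec (Q x)) →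
  (∀ x → P x → Q x) → # P? ≤ # Q?
#-mono {zero}  P? Q? sub = z≤n
#-mono {suc n} P? Q? sub = ℕₚ.+-mono-≤ (bit-mono (P? zero) (Q? zero) (sub zero)) (#-mono (P? ∘ suc) (Q? ∘ suc) (λ x → sub (suc x)))

#-< : {P Q : Fin n → Set} (P? : ∀ x → Dec (P x)) (Q? : ∀ x → Dec (Q x)) →
  (∀ x → P x → Q x) → ∀ a → Q a → ¬ P a → # P? < # Q?
#-< P? Q? sub zero q ¬p with P? zero | Q? zero
... | yes p | _     = contradiction p ¬p
... | no  _ | yes _ = s≤s (#-mono (P? ∘ suc) (Q? ∘ suc) (λ x → sub (suc x)))
... | no  _ | no ¬q = contradiction q ¬q
#-< P? Q? sub (suc a) q ¬p =
  ℕₚ.+-mono-≤-< (bit-mono (P? zero) (Q? zero) (sub zero)) (#-< (P? ∘ suc) (Q? ∘ suc) (λ x → sub (suc x)) a q ¬p)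

#-all : # {n} {λ _ → ⊤} (λ _ → yes tt) ≡ n
#-all {zero}  = refl
#-all {suc n} = cong suc (#-all {n})

#-<n : {P : Fin n → Set} (P? : ∀ x → Dec (P x)) → ∀ a → ¬ P a → # P? < n
#-<n P? a ¬p = subst (# P? <_) #-all (#-< P? (λ _ → yes tt) (λ _ _ → tt) a tt ¬p)

#-none : {P : Fin n → Set} (P? : ∀ x → Dec (P x)) → (∀ x → ¬ P x) → # P? ≡ 0
#-none {zero}  P? none = refl
#-none {suc n} P? none with P? zero
... | yes p = contradiction p (none zero)
... | no  _ = #-none (P? ∘ suc) (λ x → none (suc x))

#≡0⇒none : {P : Fin n → Set} (P? : ∀ x → Dec (P x)) → # P? ≡ 0 → ∀ x → ¬ P x
#≡0⇒none P? eq x p = ℕₚ.n≮0 (subst (0 <_) eq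
  (ℕₚ.≤-<-trans z≤n (#-< {P = λ _ → ⊥} (λ _ → no id) P? (λ _ ()) x p id)))

#-⊎ : {P Q : Fin n → Set} (P? : ∀ x → Dec (P x)) (Q? : ∀ x → Dec (Q x)) →
  (∀ x → P x → ¬ Q x) → # (λ x → P? x ⊎-dec Q? x) ≡ # P? + # Q?
#-⊎ P? Q? disj = ℤₚ.+-injective (trans (#-∑ (λ x → P? x ⊎-dec Q? x)) (trans
  (∑-cong (allFin _) (λ x → step (P? x) (Q? x) (disj x)))
  (trans (∑-+ (allFin _) (λ x → 𝟙 (P? x)) (λ x → 𝟙 (Q? x)))
    (trans (cong₂ ℤ._+_ (sym (#-∑ P?)) (sym (#-∑ Q?))) (sym (ℤₚ.pos-+ (# P?) (# Q?)))))))
  where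
  step : (d : Dec R) (d′ : Dec Q) → (R → ¬ Q) → 𝟙 (d ⊎-dec d′) ≡ 𝟙 d ℤ.+ 𝟙 d′
  step d@(yes r) d′ ¬both = trans (𝟙-yes (d ⊎-dec d′) (inj₁ r))
    (sym (cong₂ ℤ._+_ (𝟙-yes d r) (𝟙-no d′ (¬both r))))
  step d@(no ¬r) d′ ¬both = trans (𝟙-cong (d ⊎-dec d′) d′ [ (λ r → contradiction r ¬r) , id ]′ inj₂)
    (sym (trans (cong (ℤ._+ 𝟙 d′) (𝟙-no d ¬r)) (ℤₚ.+-identityˡ _)))

#-image : {d : ℕ} {P : Fin n → Set} (P? : ∀ x → Dec (P x)) (h : Fin d → Fin n) →
  (∀ {i j} → h i ≡ h j → i ≡ j) → (∀ i → P (h i)) → (∀ x → P x → ∃ λ i → h i ≡ x) → # P? ≡ d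
#-image {n} {d} {P} P? h h-inj into onto = ℤₚ.+-injective (begin
  + # P? ≡⟨ #-∑ P? ⟩
  ∑ (allFin n) (λ x → 𝟙 (P? x)) ≡⟨ ∑-cong (allFin n) (λ x → sym (ℤₚ.*-identityʳ _)) ⟩
  ∑ (allFin n) (λ x → 𝟙 (P? x) ℤ.* + 1) ≡⟨ ∑-filter P? (allFin n) (λ _ → + 1) ⟨
  ∑ (filter P? (allFin n)) (λ _ → + 1) ≡⟨ ∑-↭ (λ _ → + 1) same ⟨
  ∑ (map h (allFin d)) (λ _ → + 1) ≡⟨ length-∑ (map h (allFin d)) ⟨
  + length (map h (allFin d)) ≡⟨ cong +_ (trans (Listₚ.length-map h (allFin d)) (Listₚ.length-tabulate id)) ⟩
  + d ∎)
  where
  open ≡-Reasoning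
  same : map h (allFin d) ↭ filter P? (allFin n)
  same = ∼bag⇒↭ (unique∧set⇒bag (Uniqueₚ.map⁺ h-inj (Uniqueₚ.allFin⁺ d)) (Uniqueₚ.filter⁺ P? (Uniqueₚ.allFin⁺ n))
    (mk⇔ (λ x∈ → let (i , _ , eq) = ∈ₚ.∈-map⁻ h x∈ in
             ∈ₚ.∈-filter⁺ P? (∈ₚ.∈-allFin _) (subst P (sym eq) (into i)))
         (λ x∈ → let (i , eq) = onto _ (proj₂ (∈ₚ.∈-filter⁻ P? {xs = allFin n} x∈)) in
             subst (_∈ map h (allFin d)) eq (∈ₚ.∈-map⁺ h (∈ₚ.∈-allFin i)))))

-- Both main bijections end in an unconstrained permutation `g` paired with a permutation `v`
-- subject to `Q`; the free component contributes the factor n!.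
∑-bij-perms : {xs : List A} → Unique xs → {P : A → Set} {Q : Vec (Fin n) n → Set} (P? : ∀ a → Dec (P a)) (Q? : ∀ v → Dec (Q v))
  (φ : A → Vec (Fin n) n × Vec (Fin n) n) (ψ : Vec (Fin n) n × Vec (Fin n) n → A) →
  (∀ {a} → a ∈ xs → P a → Perm (proj₁ (φ a)) × Perm (proj₂ (φ a)) × Q (proj₂ (φ a)) × ψ (φ a) ≡ a) →
  (∀ {g v} → Perm g → Perm v → Q v → ψ (g , v) ∈ xs × P (ψ (g , v)) × φ (ψ (g , v)) ≡ (g , v)) →
  ∑ xs (λ a → 𝟙 (P? a)) ≡ ∑ (perms n) (λ _ → + 1) ℤ.* ∑ (perms n) (λ v → 𝟙 (Q? v))
∑-bij-perms {n = n} {xs} uniq P? Q? φ ψ to from = begin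
  ∑ xs (λ a → 𝟙 (P? a))
    ≡⟨ ∑-cong xs (λ a → sym (ℤₚ.*-identityʳ (𝟙 (P? a)))) ⟩
  ∑ xs (λ a → 𝟙 (P? a) ℤ.* + 1)
    ≡⟨ ∑-bij uniq (Uniqueₚ.cartesianProduct⁺ perms-unique perms-unique) P? (λ gv → Q? (proj₂ gv)) (λ _ → + 1) (λ _ → + 1) φ ψ
         (λ a∈ p → let (g , v , q , eq) = to a∈ p in ∈ₚ.∈-cartesianProduct⁺ (∈-perms⁺ g) (∈-perms⁺ v) , q , eq , refl)
         (λ b∈ q → let (g , v) = ∈ₚ.∈-cartesianProduct⁻ (perms n) (perms n) b∈ in from (∈-perms⁻ g) (∈-perms⁻ v) q) ⟩
  ∑ (cartesianProduct (perms n) (perms n)) (λ gv → 𝟙 (Q? (proj₂ gv)) ℤ.* + 1)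
    ≡⟨ ∑-product (perms n) (perms n) (λ gv → 𝟙 (Q? (proj₂ gv)) ℤ.* + 1) ⟩
  ∑ (perms n) (λ _ → ∑ (perms n) (λ v → 𝟙 (Q? v) ℤ.* + 1))
    ≡⟨ ∑-cong (perms n) (λ _ → trans (∑-cong (perms n) (λ v → ℤₚ.*-identityʳ (𝟙 (Q? v)))) (sym (ℤₚ.*-identityˡ _))) ⟩
  ∑ (perms n) (λ _ → + 1 ℤ.* ∑ (perms n) (λ v → 𝟙 (Q? v)))
    ≡⟨ ∑-*ʳ (perms n) _ (λ _ → + 1) ⟩
  ∑ (perms n) (λ _ → + 1) ℤ.* ∑ (perms n) (λ v → 𝟙 (Q? v)) ∎
  where open ≡-Reasoning

-- Lexicographic order on words, and stable sorting.

infix 4 _<ₗ_ _≤ₗ_ _<ₗ?_ _≟ᵥ_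

data _<ₗ_ : Vec ℕ N → Vec ℕ N → Set where
  this : ∀ {a b} {v w : Vec ℕ N} → a < b → a ∷ v <ₗ b ∷ w
  next : ∀ {a} {v w : Vec ℕ N} → v <ₗ w → a ∷ v <ₗ a ∷ w

<ₗ-irrefl : {v : Vec ℕ N} → ¬ v <ₗ v
<ₗ-irrefl (this a<a) = ℕₚ.<-irrefl refl a<a
<ₗ-irrefl (next v<v) = <ₗ-irrefl v<v

<ₗ-trans : {u v w : Vec ℕ N} → u <ₗ v → v <ₗ w → u <ₗ w
<ₗ-trans (this p) (this q) = this (ℕₚ.<-trans p q)
<ₗ-trans (this p) (next q) = this p
<ₗ-trans (next p) (this q) = this q
<ₗ-trans (next p) (next q) = next (<ₗ-trans p q)

<ₗ-cmp : (v w : Vec ℕ N) → v <ₗ w ⊎ v ≡ w ⊎ w <ₗ v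
<ₗ-cmp []      []      = inj₂ (inj₁ refl)
<ₗ-cmp (a ∷ v) (b ∷ w) with ℕₚ.<-cmp a b
... | tri< a<b _ _  = inj₁ (this a<b)
... | tri> _ _ b<a  = inj₂ (inj₂ (this b<a))
... | tri≈ _ refl _ with <ₗ-cmp v w
...   | inj₁ v<w         = inj₁ (next v<w)
...   | inj₂ (inj₁ refl) = inj₂ (inj₁ refl)
...   | inj₂ (inj₂ w<v)  = inj₂ (inj₂ (next w<v))

_<ₗ?_ : (v w : Vec ℕ N) → Dec (v <ₗ w)
v <ₗ? w with <ₗ-cmp v w
... | inj₁ v<w         = yes v<w
... | inj₂ (inj₁ refl) = no <ₗ-irrefl
... | inj₂ (inj₂ w<v)  = no (λ v<w → <ₗ-irrefl (<ₗ-trans v<w w<v))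

_≤ₗ_ : Vec ℕ N → Vec ℕ N → Set
v ≤ₗ w = v <ₗ w ⊎ v ≡ w

≤ₗ-antisym : {v w : Vec ℕ N} → v ≤ₗ w → w ≤ₗ v → v ≡ w
≤ₗ-antisym (inj₂ eq)  _          = eq
≤ₗ-antisym (inj₁ _)   (inj₂ eq)  = sym eq
≤ₗ-antisym (inj₁ v<w) (inj₁ w<v) = contradiction (<ₗ-trans v<w w<v) <ₗ-irrefl

_≟ᵥ_ : DecidableEquality (Vec ℕ N)
_≟ᵥ_ = Vecₚ.≡-dec ℕₚ._≟_

≤ₗ-head : {v w : Vec ℕ (suc N)} → v ≤ₗ w → Vec.head v ≤ Vec.head w
≤ₗ-head (inj₁ (this a<b)) = ℕₚ.<⇒≤ a<b
≤ₗ-head (inj₁ (next _))   = ℕₚ.≤-refl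
≤ₗ-head (inj₂ refl)       = ℕₚ.≤-refl

rot : Vec A (suc N) → Vec A (suc N)
rot (a ∷ w) = w ∷ʳ a

rot-injective : {v w : Vec A (suc N)} → rot v ≡ rot w → v ≡ w
rot-injective {v = a ∷ v} {b ∷ w} eq with refl , refl ← Vecₚ.∷ʳ-injective v w eq = refl

<ₗ-∷ʳ : ∀ {a} {v w : Vec ℕ N} → v <ₗ w → v ∷ʳ a <ₗ w ∷ʳ a
<ₗ-∷ʳ (this p) = this p
<ₗ-∷ʳ (next p) = next (<ₗ-∷ʳ p)

-- With equal heads the comparison is decided in the tails, and a common letter appended at the end
-- cannot affect it.
rot-mono : {v w : Vec ℕ (suc N)} → Vec.head v ≡ Vec.head w → v ≤ₗ w → rot v ≤ₗ rot w
rot-mono refl (inj₁ (this a<a)) = contradiction a<a (ℕₚ.<-irrefl refl)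
rot-mono refl (inj₁ (next p))   = inj₁ (<ₗ-∷ʳ p)
rot-mono _    (inj₂ refl)       = inj₂ refl

-- Ties between equal words are broken by position. This makes the order total and the sort stable,
-- and stability is what makes `step` increasing on cells of equal words.
Before : Vec (Vec ℕ N) n → Fin n → Fin n → Set
Before I x y = I ! x <ₗ I ! y ⊎ (I ! x ≡ I ! y × x Fin.< y)

before? : (I : Vec (Vec ℕ N) n) (x y : Fin n) → Dec (Before I x y)
before? I x y = (I ! x <ₗ? I ! y) ⊎-dec ((I ! x ≟ᵥ I ! y) ×-dec (x Finₚ.<? y))

before-irrefl : (I : Vec (Vec ℕ N) n) {x : Fin n} → ¬ Before I x x
before-irrefl I (inj₁ p)       = <ₗ-irrefl p
before-irrefl I (inj₂ (_ , p)) = ℕₚ.<-irrefl refl p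

before-trans : (I : Vec (Vec ℕ N) n) {x y z : Fin n} → Before I x y → Before I y z → Before I x z
before-trans I (inj₁ p)       (inj₁ q)         = inj₁ (<ₗ-trans p q)
before-trans I (inj₁ p)       (inj₂ (eq , _))  = inj₁ (subst (_ <ₗ_) eq p)
before-trans I (inj₂ (eq , _)) (inj₁ q)        = inj₁ (subst (_<ₗ _) (sym eq) q)
before-trans I (inj₂ (eq , p)) (inj₂ (eq′ , q)) = inj₂ (trans eq eq′ , ℕₚ.<-trans p q)

before-cmp : (I : Vec (Vec ℕ N) n) (x y : Fin n) → Before I x y ⊎ x ≡ y ⊎ Before I y x
before-cmp I x y with <ₗ-cmp (I ! x) (I ! y)
... | inj₁ p        = inj₁ (inj₁ p)
... | inj₂ (inj₂ p) = inj₂ (inj₂ (inj₁ p))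
... | inj₂ (inj₁ eq) with Finₚ.<-cmp x y
...   | tri< p _ _ = inj₁ (inj₂ (eq , p))
...   | tri≈ _ p _ = inj₂ (inj₁ p)
...   | tri> _ _ p = inj₂ (inj₂ (inj₂ (sym eq , p)))

rank-bound : (I : Vec (Vec ℕ N) n) (x : Fin n) → # (λ y → before? I y x) < n
rank-bound I x = #-<n (λ y → before? I y x) x (before-irrefl I)

abstract
  rank : Vec (Vec ℕ N) n → Vec (Fin n) n
  rank I = tabulate (λ x → fromℕ< (rank-bound I x))

  toℕ-rank : (I : Vec (Vec ℕ N) n) (x : Fin n) → toℕ (rank I ! x) ≡ # (λ y → before? I y x)
  toℕ-rank I x = trans (cong toℕ (Vecₚ.lookup∘tabulate (λ x → fromℕ< (rank-bound I x)) x)) (Finₚ.toℕ-fromℕ< (rank-bound I x))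

rank-mono : (I : Vec (Vec ℕ N) n) {x y : Fin n} → Before I x y → rank I ! x Fin.< rank I ! y
rank-mono I {x} {y} p rewrite toℕ-rank I x | toℕ-rank I y =
  #-< (λ z → before? I z x) (λ z → before? I z y) (λ z q → before-trans I q p) x p (before-irrefl I)

rank-perm : (I : Vec (Vec ℕ N) n) → Perm (rank I)
rank-perm I = injective λ x y eq → go x y eq (before-cmp I x y)
  where
  go : ∀ x y → rank I ! x ≡ rank I ! y → _ → x ≡ y
  go x y eq (inj₁ p)        = contradiction (rank-mono I p) (ℕₚ.<-irrefl (cong toℕ eq))
  go x y eq (inj₂ (inj₁ q)) = q
  go x y eq (inj₂ (inj₂ p)) = contradiction (rank-mono I p) (ℕₚ.<-irrefl (cong toℕ (sym eq)))

Sorted : (A → A → Set) → Vec A n → Set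
Sorted _≼_ f = ∀ x y → x Fin.< y → (f ! x) ≼ (f ! y)

sort-sorted : (I : Vec (Vec ℕ N) n) → Sorted _≤ₗ_ (I ⊙ inv (rank I))
sort-sorted I x y x<y rewrite ⊙! I (inv (rank I)) x | ⊙! I (inv (rank I)) y
  with <ₗ-cmp (I ! (inv (rank I) ! x)) (I ! (inv (rank I) ! y))
... | inj₁ p         = inj₁ p
... | inj₂ (inj₁ eq) = inj₂ eq
... | inj₂ (inj₂ p)  = contradiction x<y (ℕₚ.<-asym (subst (λ (a , b) → a Fin.< b)
        (cong₂ _,_ (inv-r (rank I) (rank-perm I) y) (inv-r (rank I) (rank-perm I) x)) (rank-mono I (inj₁ p))))

-- Each head occurs in the other vector and is therefore bounded below by the other head.
-- Antisymmetry identifies the heads, and cancelling them leaves equal counts for the tails.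
sorted-unique : (_≟_ : DecidableEquality A) (_≼_ : A → A → Set) →
  (∀ {a b} → a ≡ b → a ≼ b) → (∀ {a b} → a ≼ b → b ≼ a → a ≡ b) →
  (f h : Vec A n) → Sorted _≼_ f → Sorted _≼_ h →
  (∀ a → # (λ x → (f ! x) ≟ a) ≡ # (λ x → (h ! x) ≟ a)) → f ≡ h
sorted-unique _≟_ _≼_ reflx antisym [] [] sf sh cnt = refl
sorted-unique {A = A} _≟_ _≼_ reflx antisym (a ∷ f) (b ∷ h) sf sh cnt = cong₂ _∷_ a≡b
  (sorted-unique _≟_ _≼_ reflx antisym f h (λ x y p → sf (suc x) (suc y) (s≤s p)) (λ x y p → sh (suc x) (suc y) (s≤s p))
    (λ c → ℕₚ.+-cancelˡ-≡ _ _ _ (trans (cnt c) (cong (λ z → (if does (z ≟ c) then 1 else 0) + # (λ x → (h ! x) ≟ c)) (sym a≡b)))))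
  where
  occurs : ∀ {n} (p q : Vec A n) → (∀ c → # (λ x → (p ! x) ≟ c) ≡ # (λ x → (q ! x) ≟ c)) → ∀ x → ∃ λ y → q ! y ≡ p ! x
  occurs p q eq x with Finₚ.any? (λ y → (q ! y) ≟ (p ! x))
  ... | yes found = found
  ... | no  miss  = contradiction refl (#≡0⇒none (λ y → (p ! y) ≟ (p ! x))
          (trans (eq (p ! x)) (#-none (λ y → (q ! y) ≟ (p ! x)) (λ y e → miss (y , e)))) x)
  least : ∀ {n} {c d} {p q : Vec A n} → Sorted _≼_ (d ∷ q) → (∃ λ y → (d ∷ q) ! y ≡ c) → d ≼ c
  least s (zero  , eq) = reflx eq
  least s (suc y , eq) = subst (_ ≼_) eq (s zero (suc y) (s≤s z≤n))
  a≡b : a ≡ b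
  a≡b = antisym (least {p = h} sf (occurs (b ∷ h) (a ∷ f) (λ c → sym (cnt c)) zero))
                (least {p = f} sh (occurs (a ∷ f) (b ∷ h) cnt zero))

count-⊙ : (_≟_ : DecidableEquality A) (f : Vec A n) {g : Vec (Fin n) n} → Perm g →
  ∀ a → # (λ x → ((f ⊙ g) ! x) ≟ a) ≡ # (λ x → (f ! x) ≟ a)
count-⊙ _≟_ f {g} p a = trans
  (#-cong (λ x → ((f ⊙ g) ! x) ≟ a) (λ x → (f ! (g ! x)) ≟ a) (λ x e → trans (sym (⊙! f g x)) e) (λ x e → trans (⊙! f g x) e))
  (#-perm (λ x → (f ! x) ≟ a) p)

-- A point moved by `z` would start a strictly monotone sequence of iterates. The sequence stays in
-- one fibre of `J`, so monotonicity keeps applying, and it leaves `Fin n` after finitely many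
-- steps.
monotone-id : (J : Fin n → A) (z : Fin n → Fin n) → (∀ x → J (z x) ≡ J x) →
  (∀ x y → x Fin.< y → J x ≡ J y → z x Fin.< z y) → ∀ x → z x ≡ x
monotone-id {n} J z inv-J mono x with Finₚ.<-cmp (z x) x
... | tri≈ _ eq _ = eq
... | tri> _ _ x<zx = ⊥-elim (ℕₚ.<⇒≱ (Finₚ.toℕ<n (iter z n x)) (proj₁ (up n)))
  where
  up : ∀ t → t ≤ toℕ (iter z t x) × iter z t x Fin.< iter z (suc t) x
  up zero    = z≤n , x<zx
  up (suc t) = let (a , b) = up t in ℕₚ.≤-<-trans a b , mono _ _ b (sym (inv-J _))
... | tri< zx<x _ _ = ⊥-elim (ℕₚ.m+n≮m (toℕ x) (toℕ (iter z (suc (toℕ x)) x)) (proj₁ (down (suc (toℕ x)))))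
  where
  down : ∀ t → t + toℕ (iter z t x) ≤ toℕ x × iter z (suc t) x Fin.< iter z t x
  down zero    = ℕₚ.≤-refl , zx<x
  down (suc t) = let (a , b) = down t in
    ℕₚ.≤-trans (ℕₚ.≤-reflexive (sym (ℕₚ.+-suc t _))) (ℕₚ.≤-trans (ℕₚ.+-monoʳ-≤ t b) a) , mono _ _ b (inv-J _)

-- Itineraries, and the Gessel-Reutenauer bijection.

itin : (Fin n → Fin n) → (Fin n → ℕ) → (N : ℕ) → Fin n → Vec ℕ N
itin u f zero    x = []
itin u f (suc t) x = f x ∷ itin u f t (u x)

itin-∷ʳ : (u : Fin n → Fin n) (f : Fin n → ℕ) (t : ℕ) (x : Fin n) →
  itin u f (suc t) x ≡ itin u f t x ∷ʳ f (iter u t x)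
itin-∷ʳ u f zero    x = refl
itin-∷ʳ u f (suc t) x = cong (f x ∷_) (trans (itin-∷ʳ u f t (u x)) (cong (λ y → itin u f t (u x) ∷ʳ f y) (iter-comm u t x)))

-- When the window moves by one step, the letter that enters at its end belongs to u^(t+1) x, and
-- invariance of `f` identifies it with the letter that leaves.
itin-rot : (u : Fin n → Fin n) (f : Fin n → ℕ) (t : ℕ) → (∀ x → f (iter u (suc t) x) ≡ f x) →
  ∀ x → itin u f (suc t) (u x) ≡ rot (itin u f (suc t) x)
itin-rot u f t closed x = trans (itin-∷ʳ u f t (u x))
  (cong (itin u f t (u x) ∷ʳ_) (trans (cong f (iter-comm u t x)) (closed x)))

-- The rotation law determines the words from their heads: letter t of `J x` is the head of `J` at
-- the t-th iterate of `x`. Comparing the last letters of `J (u x)` and `rot (J x)` then yields the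
-- invariance of `f` after a full turn.
itin-unique : (u : Fin n → Fin n) (f : Fin n → ℕ) (t : ℕ) (J : Fin n → Vec ℕ (suc t)) →
  (∀ x → J (u x) ≡ rot (J x)) → (∀ x → Vec.head (J x) ≡ f x) →
  (∀ x → itin u f (suc t) x ≡ J x) × (∀ x → f (iter u (suc t) x) ≡ f x)
itin-unique u f κ J J-rot J-head = same , closed
  where
  toList-inj : ∀ {m} {v w : Vec ℕ m} → toList v ≡ toList w → v ≡ w
  toList-inj {v = v} {w} eq = trans (sym (Vecₚ.cast-is-id refl v)) (Vecₚ.toList-injective refl v w eq)
  take-++ˡ : ∀ t (xs ys : List ℕ) → t ≤ length xs → take t (xs ++ ys) ≡ take t xs
  take-++ˡ zero    xs       ys le = refl
  take-++ˡ (suc t) (x ∷ xs) ys (s≤s le) = cong (x ∷_) (take-++ˡ t xs ys le)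
  prefix : ∀ t → t ≤ suc κ → ∀ x → toList (itin u f t x) ≡ take t (toList (J x))
  prefix zero    le x = refl
  prefix (suc t) (s≤s le) x with J x | J-rot x | J-head x
  ... | a ∷ w | rotated | refl = cong (f x ∷_) (begin
    toList (itin u f t (u x)) ≡⟨ prefix t (ℕₚ.m≤n⇒m≤1+n le) (u x) ⟩
    take t (toList (J (u x))) ≡⟨ cong (λ v → take t (toList v)) rotated ⟩
    take t (toList (w ∷ʳ f x)) ≡⟨ cong (take t) (Vecₚ.toList-∷ʳ (f x) w) ⟩
    take t (toList w ++ f x ∷ []) ≡⟨ take-++ˡ t (toList w) _ (subst (t ≤_) (sym (Vecₚ.length-toList w)) le) ⟩
    take t (toList w) ∎)
    where open ≡-Reasoning
  same : ∀ x → itin u f (suc κ) x ≡ J x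
  same x = toList-inj (trans (prefix (suc κ) ℕₚ.≤-refl x)
    (Listₚ.take-all (suc κ) (toList (J x)) (ℕₚ.≤-reflexive (Vecₚ.length-toList (J x)))))
  closed : ∀ x → f (iter u (suc κ) x) ≡ f x
  closed x = trans (cong f (sym (iter-comm u κ x))) (Vecₚ.∷ʳ-injectiveʳ (itin u f κ (u x)) (itin u f κ (u x))
    (trans (sym (itin-∷ʳ u f κ (u x))) (trans (same (u x)) (trans (J-rot x) (cong rot (sym (same x)))))))

-- For `t` equal to k this is the operator T_u applied to the sign vector `s`.
parity : (Fin n → Fin n) → (Fin n → Bool) → ℕ → Fin n → Bool
parity u s zero    x = false
parity u s (suc t) x = s x xor parity u s t (u x)

word-parity : (ℕ → Bool) → Vec ℕ N → Bool
word-parity ε []      = false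
word-parity ε (a ∷ w) = ε a xor word-parity ε w

-- When signs depend on labels only, T_u s at a point is a function of the itinerary of that point.
-- The kernel condition therefore passes through every bijection that preserves itineraries.
parity-itin : (ε : ℕ → Bool) (u : Fin n → Fin n) (f : Fin n → ℕ) (t : ℕ) (x : Fin n) →
  parity u (ε ∘ f) t x ≡ word-parity ε (itin u f t x)
parity-itin ε u f zero    x = refl
parity-itin ε u f (suc t) x = cong (ε (f x) xor_) (parity-itin ε u f t (u x))

-- `Content` is a parameter because equality of all class sizes quantifies over every natural
-- number. A decidable substitute is supplied from outside; it has to imply that equality only for
-- labellings bounded by `M`.
module GesselReutenauer {n : ℕ} (κ M : ℕ) (ε : ℕ → Bool) (f₀ : Vec ℕ n)
  (f₀-sorted : Sorted _≤_ f₀) (f₀<M : ∀ x → f₀ ! x < M)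
  (Content : Vec ℕ n → Set) (content? : ∀ f → Dec (Content f))
  (content⇒ : ∀ f → (∀ x → f ! x < M) → Content f → ∀ a → # (λ x → f ! x ℕₚ.≟ a) ≡ # (λ x → f₀ ! x ℕₚ.≟ a))
  (⇒content : ∀ f → (∀ a → # (λ x → f ! x ℕₚ.≟ a) ≡ # (λ x → f₀ ! x ℕₚ.≟ a)) → Content f)
  where

  k : ℕ
  k = suc κ

  labellings : List (Vec ℕ n)
  labellings = allVecs (upTo M) n

  Labelled : Vec (Fin n) n × Vec ℕ n → Set
  Labelled (u , f) =
    (∀ x → f ! iter (u !_) k x ≡ f ! x) × (∀ x → parity (u !_) (λ x → ε (f ! x)) k x ≡ false) × Content f

  labelled? : ∀ uf → Dec (Labelled uf)
  labelled? (u , f) = Finₚ.all? (λ x → f ! iter (u !_) k x ℕₚ.≟ f ! x) ×-dec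
    (Finₚ.all? (λ x → parity (u !_) (λ x → ε (f ! x)) k x Boolₚ.≟ false) ×-dec content? f)

  Increasing : Vec (Fin n) n → Set
  Increasing v = ∀ x y → x Fin.< y → f₀ ! x ≡ f₀ ! y → v ! x Fin.< v ! y

  increasing? : ∀ v → Dec (Increasing v)
  increasing? v = Finₚ.all? λ x → Finₚ.all? λ y → (x Finₚ.<? y) →-dec ((f₀ ! x ℕₚ.≟ f₀ ! y) →-dec (v ! x Finₚ.<? v ! y))

  Root : Vec (Fin n) n → Set
  Root v = ((∀ x → iter (v !_) k x ≡ x) × (∀ x → parity (v !_) (λ x → ε (f₀ ! x)) k x ≡ false)) × Increasing v

  root? : ∀ v → Dec (Root v)
  root? v = (Finₚ.all? (λ x → iter (v !_) k x Finₚ.≟ x) ×-dec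
    Finₚ.all? (λ x → parity (v !_) (λ x → ε (f₀ ! x)) k x Boolₚ.≟ false)) ×-dec increasing? v

  words : Vec (Fin n) n → Vec ℕ n → Vec (Vec ℕ k) n
  words u f = tabulate (itin (u !_) (f !_) k)

  words! : ∀ u f x → words u f ! x ≡ itin (u !_) (f !_) k x
  words! u f = Vecₚ.lookup∘tabulate (itin (u !_) (f !_) k)

  words-parity : ∀ u f x → parity (u !_) (λ x → ε (f ! x)) k x ≡ word-parity ε (words u f ! x)
  words-parity u f x = trans (parity-itin ε (u !_) (f !_) k x) (cong (word-parity ε) (sym (words! u f x)))

  -- For sorted words closed under rotation this is the row permutation of the Burrows-Wheeler
  -- transform: row x, rotated by one letter, becomes row `step J ! x`.
  step : Vec (Vec ℕ k) n → Vec (Fin n) n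
  step J = rank (Vec.map rot J)

  map! : ∀ (J : Vec (Vec ℕ k) n) x → Vec.map rot J ! x ≡ rot (J ! x)
  map! J x = Vecₚ.lookup-map x rot J

  -- The rotated words are the words of `J` in another order, as `u` witnesses, so sorting them
  -- gives `J` back; `step J` records where the sort puts each of them.
  step-rot : ∀ J → Sorted _≤ₗ_ J → ∀ u → Perm u → (∀ x → J ! (u ! x) ≡ rot (J ! x)) →
    ∀ x → J ! (step J ! x) ≡ rot (J ! x)
  step-rot J J-sorted u u-perm J-rot x = begin
    J ! (v ! x) ≡⟨ cong (_! (v ! x)) resorted ⟨
    (RJ ⊙ inv v) ! (v ! x) ≡⟨ ⊙! RJ (inv v) (v ! x) ⟩
    RJ ! (inv v ! (v ! x)) ≡⟨ cong (RJ !_) (inv-l v (rank-perm RJ) x) ⟩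
    RJ ! x ≡⟨ map! J x ⟩
    rot (J ! x) ∎
    where
    open ≡-Reasoning
    RJ = Vec.map rot J
    v = step J
    RJ≡ : RJ ≡ J ⊙ u
    RJ≡ = vec-ext (λ x → trans (map! J x) (trans (sym (J-rot x)) (sym (⊙! J u x))))
    resorted : RJ ⊙ inv v ≡ J
    resorted = sorted-unique _≟ᵥ_ _≤ₗ_ inj₂ ≤ₗ-antisym (RJ ⊙ inv v) J (sort-sorted RJ) J-sorted
      (λ a → trans (count-⊙ _≟ᵥ_ RJ (Perm-inv (rank-perm RJ)) a)
        (trans (cong (λ RJ → # (λ x → RJ ! x ≟ᵥ a)) RJ≡) (count-⊙ _≟ᵥ_ J u-perm a)))

  -- Rotation preserves the order of words with a common head, and the stable sort preserves the
  -- order of those that coincide.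
  step-mono : ∀ J → Sorted _≤ₗ_ J → ∀ x y → x Fin.< y → Vec.head (J ! x) ≡ Vec.head (J ! y) →
    step J ! x Fin.< step J ! y
  step-mono J J-sorted x y x<y heads = rank-mono (Vec.map rot J) before
    where
    before : Before (Vec.map rot J) x y
    before rewrite map! J x | map! J y with rot-mono heads (J-sorted x y x<y)
    ... | inj₁ lt = inj₁ lt
    ... | inj₂ eq = inj₂ (eq , x<y)

  -- For a fixed family of words `I` with sorted form J, the permutations u with I ∘ u = rot ∘ I and
  -- the permutations g with I ∘ g = J are cosets of the same group, the stabilizer of `I`. Right
  -- multiplication by g₀ v⁻¹ translates the first coset to the second; `ψ` translates back.
  φ : Vec (Fin n) n × Vec ℕ n → Vec (Fin n) n × Vec (Fin n) n
  φ (u , f) = let I = words u f ; g₀ = inv (rank I) ; v = step (I ⊙ g₀) in (u ⊙ g₀) ⊙ inv v , v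

  ψ : Vec (Fin n) n × Vec (Fin n) n → Vec (Fin n) n × Vec ℕ n
  ψ (g , v) = (g ⊙ v) ⊙ rank (words v f₀ ⊙ inv g) , f₀ ⊙ inv g

  module To (u : Vec (Fin n) n) (f : Vec ℕ n) (u-perm : Perm u) (f<M : ∀ x → f ! x < M)
    (closed : ∀ x → f ! iter (u !_) k x ≡ f ! x)
    (good : ∀ x → parity (u !_) (λ x → ε (f ! x)) k x ≡ false) (content : Content f) where

    I = words u f
    r = rank I
    g₀ = inv r
    J = I ⊙ g₀
    v = step J
    g = (u ⊙ g₀) ⊙ inv v

    r-perm : Perm r
    r-perm = rank-perm I
    g₀-perm : Perm g₀
    g₀-perm = Perm-inv r-perm
    v-perm : Perm v
    v-perm = rank-perm (Vec.map rot J)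
    g-perm : Perm g
    g-perm = Perm-⊙ (Perm-⊙ u-perm g₀-perm) (Perm-inv v-perm)

    J! : ∀ x → J ! x ≡ I ! (g₀ ! x)
    J! = ⊙! I g₀

    g! : ∀ y → g ! y ≡ u ! (g₀ ! (inv v ! y))
    g! y = trans (⊙! (u ⊙ g₀) (inv v) y) (⊙! u g₀ _)

    I-head : ∀ x → Vec.head (I ! x) ≡ f ! x
    I-head x = cong Vec.head (words! u f x)

    I-rot : ∀ x → I ! (u ! x) ≡ rot (I ! x)
    I-rot x = trans (words! u f (u ! x)) (trans (itin-rot (u !_) (f !_) κ closed x) (cong rot (sym (words! u f x))))

    J-sorted : Sorted _≤ₗ_ J
    J-sorted = sort-sorted I

    J-rot : ∀ x → J ! (v ! x) ≡ rot (J ! x)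
    -- Conjugated by the sort, `u` acts on the sorted positions and shows that the sorted words are
    -- closed under rotation.
    J-rot = step-rot J J-sorted ((r ⊙ u) ⊙ g₀) (Perm-⊙ (Perm-⊙ r-perm u-perm) g₀-perm) (λ x → begin
      J ! (((r ⊙ u) ⊙ g₀) ! x) ≡⟨ J! _ ⟩
      I ! (g₀ ! (((r ⊙ u) ⊙ g₀) ! x)) ≡⟨ cong (λ y → I ! (g₀ ! y)) (trans (⊙! (r ⊙ u) g₀ x) (⊙! r u _)) ⟩
      I ! (g₀ ! (r ! (u ! (g₀ ! x)))) ≡⟨ cong (I !_) (inv-l r r-perm _) ⟩
      I ! (u ! (g₀ ! x)) ≡⟨ I-rot (g₀ ! x) ⟩
      rot (I ! (g₀ ! x)) ≡⟨ cong rot (J! x) ⟨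
      rot (J ! x) ∎)
      where open ≡-Reasoning

    -- Sorting words lexicographically sorts their heads, and the heads are the labels.
    f⊙g₀≡f₀ : f ⊙ g₀ ≡ f₀
    f⊙g₀≡f₀ = sorted-unique ℕₚ._≟_ _≤_ ℕₚ.≤-reflexive ℕₚ.≤-antisym (f ⊙ g₀) f₀
      (λ x y x<y → subst (λ (a , b) → a ≤ b) (cong₂ _,_ (heads x) (heads y)) (≤ₗ-head (J-sorted x y x<y)))
      f₀-sorted (λ a → trans (count-⊙ ℕₚ._≟_ f g₀-perm a) (content⇒ f f<M content a))
      where
      heads : ∀ x → Vec.head (J ! x) ≡ (f ⊙ g₀) ! x
      heads x = trans (cong Vec.head (J! x)) (trans (I-head (g₀ ! x)) (sym (⊙! f g₀ x)))

    J-head : ∀ x → Vec.head (J ! x) ≡ f₀ ! x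
    J-head x = trans (cong Vec.head (J! x)) (trans (I-head (g₀ ! x)) (trans (sym (⊙! f g₀ x)) (cong (_! x) f⊙g₀≡f₀)))

    J-itin : ∀ x → itin (v !_) (f₀ !_) k x ≡ J ! x
    J-itin = proj₁ (itin-unique (v !_) (f₀ !_) κ (J !_) J-rot J-head)

    v-closed : ∀ x → f₀ ! iter (v !_) k x ≡ f₀ ! x
    v-closed = proj₂ (itin-unique (v !_) (f₀ !_) κ (J !_) J-rot J-head)

    v-increasing : Increasing v
    v-increasing x y x<y eq = step-mono J J-sorted x y x<y (trans (J-head x) (trans eq (sym (J-head y))))

    -- Points with the same word have equal heads at every later time, so `step-mono` applies again
    -- at each iterate.
    cells : ∀ t x y → x Fin.< y → J ! x ≡ J ! y →
      (iter (v !_) t x Fin.< iter (v !_) t y) × (J ! iter (v !_) t x ≡ J ! iter (v !_) t y)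
    cells zero    x y x<y eq = x<y , eq
    cells (suc t) x y x<y eq = let (lt , same) = cells t x y x<y eq in
      step-mono J J-sorted _ _ lt (cong Vec.head same) , trans (J-rot _) (trans (cong rot same) (sym (J-rot _)))

    itin-period : ∀ t x → itin (v !_) (f₀ !_) t (iter (v !_) k x) ≡ itin (v !_) (f₀ !_) t x
    itin-period zero    x = refl
    itin-period (suc t) x = cong₂ _∷_ (v-closed x)
      (trans (cong (itin (v !_) (f₀ !_) t) (sym (iter-comm (v !_) k x))) (itin-period t (v ! x)))

    -- Itineraries repeat after k steps, so v^k maps every cell of equal words to itself. It
    -- preserves the order there, and an order preserving self-map of a finite cell is the identity.
    v-root : ∀ x → iter (v !_) k x ≡ x
    v-root = monotone-id (J !_) (iter (v !_) k)
      (λ x → trans (sym (J-itin _)) (trans (itin-period k x) (J-itin x)))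
      (λ x y x<y eq → proj₁ (cells k x y x<y eq))

    v-good : ∀ x → parity (v !_) (λ x → ε (f₀ ! x)) k x ≡ false
    v-good x = begin
      parity (v !_) (λ x → ε (f₀ ! x)) k x ≡⟨ parity-itin ε (v !_) (f₀ !_) k x ⟩
      word-parity ε (itin (v !_) (f₀ !_) k x) ≡⟨ cong (word-parity ε) (trans (J-itin x) (J! x)) ⟩
      word-parity ε (I ! (g₀ ! x)) ≡⟨ words-parity u f (g₀ ! x) ⟨
      parity (u !_) (λ x → ε (f ! x)) k (g₀ ! x) ≡⟨ good (g₀ ! x) ⟩
      false ∎
      where open ≡-Reasoning

    words≡J : words v f₀ ≡ J
    words≡J = vec-ext (λ x → trans (words! v f₀ x) (J-itin x))

    -- Going back along `v` undoes one rotation and going forward along `u` performs one, so `g`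
    -- matches sorted positions with original points that carry the same word. Hence `ψ` recomputes
    -- the original words.
    I′≡I : words v f₀ ⊙ inv g ≡ I
    I′≡I = vec-ext λ x → let y = inv g ! x in begin
      (words v f₀ ⊙ inv g) ! x ≡⟨ ⊙! (words v f₀) (inv g) x ⟩
      words v f₀ ! y ≡⟨ cong (_! y) words≡J ⟩
      J ! y ≡⟨ cong (J !_) (inv-r v v-perm y) ⟨
      J ! (v ! (inv v ! y)) ≡⟨ J-rot _ ⟩
      rot (J ! (inv v ! y)) ≡⟨ cong rot (J! _) ⟩
      rot (I ! (g₀ ! (inv v ! y))) ≡⟨ I-rot _ ⟨
      I ! (u ! (g₀ ! (inv v ! y))) ≡⟨ cong (I !_) (g! y) ⟨
      I ! (g ! y) ≡⟨ cong (I !_) (inv-r g g-perm x) ⟩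
      I ! x ∎
      where open ≡-Reasoning

    u-recovered : (g ⊙ v) ⊙ rank (words v f₀ ⊙ inv g) ≡ u
    u-recovered = trans (cong (λ I → (g ⊙ v) ⊙ rank I) I′≡I) (vec-ext λ x → begin
      ((g ⊙ v) ⊙ r) ! x ≡⟨ trans (⊙! (g ⊙ v) r x) (⊙! g v _) ⟩
      g ! (v ! (r ! x)) ≡⟨ g! _ ⟩
      u ! (g₀ ! (inv v ! (v ! (r ! x)))) ≡⟨ cong (λ y → u ! (g₀ ! y)) (inv-l v v-perm _) ⟩
      u ! (g₀ ! (r ! x)) ≡⟨ cong (u !_) (inv-l r r-perm x) ⟩
      u ! x ∎)
      where open ≡-Reasoning

    f-recovered : f₀ ⊙ inv g ≡ f
    f-recovered = vec-ext λ x → begin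
      (f₀ ⊙ inv g) ! x ≡⟨ ⊙! f₀ (inv g) x ⟩
      f₀ ! (inv g ! x) ≡⟨ cong Vec.head (words! v f₀ (inv g ! x)) ⟨
      Vec.head (words v f₀ ! (inv g ! x)) ≡⟨ cong Vec.head (⊙! (words v f₀) (inv g) x) ⟨
      Vec.head ((words v f₀ ⊙ inv g) ! x) ≡⟨ cong (λ I → Vec.head (I ! x)) I′≡I ⟩
      Vec.head (I ! x) ≡⟨ I-head x ⟩
      f ! x ∎
      where open ≡-Reasoning

    ψφ : ψ (φ (u , f)) ≡ (u , f)
    ψφ = cong₂ _,_ u-recovered f-recovered

  module From (g v : Vec (Fin n) n) (g-perm : Perm g) (v-perm : Perm v)
    (root : ∀ x → iter (v !_) k x ≡ x)
    (good : ∀ x → parity (v !_) (λ x → ε (f₀ ! x)) k x ≡ false) (increasing : Increasing v) where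

    J = words v f₀
    I = J ⊙ inv g
    r = rank I
    g₀ = inv r
    u = (g ⊙ v) ⊙ r
    f = f₀ ⊙ inv g

    r-perm : Perm r
    r-perm = rank-perm I
    u-perm : Perm u
    u-perm = Perm-⊙ (Perm-⊙ g-perm v-perm) r-perm

    f<M : ∀ x → f ! x < M
    f<M x = subst (_< M) (sym (⊙! f₀ (inv g) x)) (f₀<M _)

    content : Content f
    content = ⇒content f (count-⊙ ℕₚ._≟_ f₀ (Perm-inv g-perm))

    -- First letters are in order because `f₀` is sorted; on equal first letters `v` preserves the
    -- order of the points, so induction applies to their images.
    itin-sorted : ∀ t x y → x Fin.< y → itin (v !_) (f₀ !_) t x ≤ₗ itin (v !_) (f₀ !_) t y
    itin-sorted zero    x y x<y = inj₂ refl
    itin-sorted (suc t) x y x<y with ℕₚ.m≤n⇒m<n∨m≡n (f₀-sorted x y x<y)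
    ... | inj₁ lt = inj₁ (this lt)
    ... | inj₂ eq with itin-sorted t (v ! x) (v ! y) (increasing x y x<y eq)
    ...   | inj₁ lt = inj₁ (subst (λ a → f₀ ! x ∷ _ <ₗ a ∷ _) eq (next lt))
    ...   | inj₂ e  = inj₂ (cong₂ _∷_ eq e)

    J-sorted : Sorted _≤ₗ_ J
    J-sorted x y x<y rewrite words! v f₀ x | words! v f₀ y = itin-sorted k x y x<y

    J-rot : ∀ x → J ! (v ! x) ≡ rot (J ! x)
    J-rot x = trans (words! v f₀ (v ! x)) (trans (itin-rot (v !_) (f₀ !_) κ (λ x → cong (f₀ !_) (root x)) x)
      (cong rot (sym (words! v f₀ x))))

    I⊙g₀≡J : I ⊙ g₀ ≡ J
    I⊙g₀≡J = sorted-unique _≟ᵥ_ _≤ₗ_ inj₂ ≤ₗ-antisym (I ⊙ g₀) J (sort-sorted I) J-sorted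
      (λ a → trans (count-⊙ _≟ᵥ_ I (Perm-inv r-perm) a) (count-⊙ _≟ᵥ_ J (Perm-inv g-perm) a))

    u! : ∀ x → u ! x ≡ g ! (v ! (r ! x))
    u! x = trans (⊙! (g ⊙ v) r x) (⊙! g v _)

    I-rot : ∀ x → I ! (u ! x) ≡ rot (I ! x)
    I-rot x = begin
      I ! (u ! x) ≡⟨ ⊙! J (inv g) _ ⟩
      J ! (inv g ! (u ! x)) ≡⟨ cong (λ y → J ! (inv g ! y)) (u! x) ⟩
      J ! (inv g ! (g ! (v ! (r ! x)))) ≡⟨ cong (J !_) (inv-l g g-perm _) ⟩
      J ! (v ! (r ! x)) ≡⟨ J-rot _ ⟩
      rot (J ! (r ! x)) ≡⟨ cong (λ J → rot (J ! (r ! x))) I⊙g₀≡J ⟨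
      rot ((I ⊙ g₀) ! (r ! x)) ≡⟨ cong rot (⊙! I g₀ _) ⟩
      rot (I ! (g₀ ! (r ! x))) ≡⟨ cong (λ y → rot (I ! y)) (inv-l r r-perm x) ⟩
      rot (I ! x) ∎
      where open ≡-Reasoning

    I-head : ∀ x → Vec.head (I ! x) ≡ f ! x
    I-head x = trans (cong Vec.head (trans (⊙! J (inv g) x) (words! v f₀ _))) (sym (⊙! f₀ (inv g) x))

    words≡I : words u f ≡ I
    words≡I = vec-ext (λ x → trans (words! u f x) (proj₁ (itin-unique (u !_) (f !_) κ (I !_) I-rot I-head) x))

    closed : ∀ x → f ! iter (u !_) k x ≡ f ! x
    closed = proj₂ (itin-unique (u !_) (f !_) κ (I !_) I-rot I-head)

    u-good : ∀ x → parity (u !_) (λ x → ε (f ! x)) k x ≡ false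
    u-good x = trans (words-parity u f x) (trans (cong (word-parity ε)
      (trans (cong (_! x) words≡I) (⊙! J (inv g) x))) (trans (sym (words-parity v f₀ _)) (good _)))

    w = step J
    w-perm : Perm w
    w-perm = rank-perm (Vec.map rot J)
    w-rot : ∀ x → J ! (w ! x) ≡ rot (J ! x)
    w-rot = step-rot J J-sorted v v-perm J-rot

    -- Both permutations rotate the words of `J`, so w⁻¹ v maps each cell of equal words to itself.
    -- It is monotone there, since `v` increases on the classes of `f₀` and `w` on words with equal
    -- heads.
    w≡v : w ≡ v
    w≡v = vec-ext λ x → trans (cong (w !_) (sym (fixed x))) (inv-r w w-perm (v ! x))
      where
      z : Fin n → Fin n
      z x = inv w ! (v ! x)
      wz : ∀ x → w ! z x ≡ v ! x
      wz x = inv-r w w-perm (v ! x)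
      cell : ∀ x → J ! z x ≡ J ! x
      cell x = rot-injective (trans (sym (w-rot (z x))) (trans (cong (J !_) (wz x)) (J-rot x)))
      head≡ : ∀ {x y} → J ! x ≡ J ! y → f₀ ! x ≡ f₀ ! y
      head≡ {x} {y} eq = trans (sym (cong Vec.head (words! v f₀ x))) (trans (cong Vec.head eq) (cong Vec.head (words! v f₀ y)))
      mono : ∀ x y → x Fin.< y → J ! x ≡ J ! y → z x Fin.< z y
      mono x y x<y eq with Finₚ.<-cmp (z x) (z y) | increasing x y x<y (head≡ eq)
      ... | tri< lt _ _ | _  = lt
      ... | tri≈ _ e _  | vx<vy = contradiction vx<vy
              (ℕₚ.<-irrefl (cong toℕ (trans (sym (wz x)) (trans (cong (w !_) e) (wz y)))))
      ... | tri> _ _ gt | vx<vy = contradiction vx<vy (ℕₚ.<-asym (subst (λ (a , b) → a Fin.< b)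
              (cong₂ _,_ (wz y) (wz x)) (step-mono J J-sorted (z y) (z x) gt
                (cong Vec.head (trans (cell y) (trans (sym eq) (sym (cell x))))))))
      fixed : ∀ x → z x ≡ x
      fixed = monotone-id (J !_) z cell mono

    φψ : φ (u , f) ≡ (g , v)
    φψ = trans (cong finish words≡I) (trans (cong finish′ (trans (cong step I⊙g₀≡J) w≡v)) (cong (_, v) (vec-ext λ y → begin
      ((u ⊙ g₀) ⊙ inv v) ! y ≡⟨ trans (⊙! (u ⊙ g₀) (inv v) y) (⊙! u g₀ _) ⟩
      u ! (g₀ ! (inv v ! y)) ≡⟨ u! _ ⟩
      g ! (v ! (r ! (g₀ ! (inv v ! y)))) ≡⟨ cong (λ a → g ! (v ! a)) (inv-r r r-perm _) ⟩
      g ! (v ! (inv v ! y)) ≡⟨ cong (g !_) (inv-r v v-perm y) ⟩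
      g ! y ∎)))
      where
      open ≡-Reasoning
      finish : Vec (Vec ℕ k) n → Vec (Fin n) n × Vec (Fin n) n
      finish I = let g₀ = inv (rank I) ; v = step (I ⊙ g₀) in (u ⊙ g₀) ⊙ inv v , v
      finish′ : Vec (Fin n) n → Vec (Fin n) n × Vec (Fin n) n
      finish′ v = (u ⊙ g₀) ⊙ inv v , v

  theorem : ∑ (perms n) (λ u → ∑ labellings (λ f → 𝟙 (labelled? (u , f)))) ≡
    ∑ (perms n) (λ _ → + 1) ℤ.* ∑ (perms n) (λ v → 𝟙 (root? v))
  theorem = trans (sym (∑-product (perms n) labellings (λ uf → 𝟙 (labelled? uf))))
    (∑-bij-perms (Uniqueₚ.cartesianProduct⁺ perms-unique (allVecs-unique n (Uniqueₚ.upTo⁺ M))) labelled? root? φ ψ to from)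
    where
    to : ∀ {a} → a ∈ cartesianProduct (perms n) labellings → Labelled a →
      Perm (proj₁ (φ a)) × Perm (proj₂ (φ a)) × Root (proj₂ (φ a)) × (ψ (φ a) ≡ a)
    to {u , f} a∈ (closed , good , content) = T.g-perm , T.v-perm , ((T.v-root , T.v-good) , T.v-increasing) , T.ψφ
      where
      mem = ∈ₚ.∈-cartesianProduct⁻ (perms n) labellings a∈
      module T = To u f (∈-perms⁻ (proj₁ mem)) (λ x → ∈ₚ.∈-upTo⁻ (∈-allVecs⁻ (proj₂ mem) x)) closed good content
    from : ∀ {g v} → Perm g → Perm v → Root v →
      (ψ (g , v) ∈ cartesianProduct (perms n) labellings) × Labelled (ψ (g , v)) × (φ (ψ (g , v)) ≡ (g , v))
    from {g} {v} g-perm v-perm ((root , good) , increasing) =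
      ∈ₚ.∈-cartesianProduct⁺ (∈-perms⁺ F.u-perm) (∈-allVecs⁺ F.f (λ x → ∈ₚ.∈-upTo⁺ (F.f<M x))) ,
      (F.closed , F.u-good , F.content) , F.φψ
      where
      module F = From g v g-perm v-perm root good increasing

-- Two kinds of blocks: complete homogeneous and power sum.
data Kind : Set where
  hom pow : Kind

if-yes : (d : Dec R) → R → {a b : A} → (if does d then a else b) ≡ a
if-yes (yes _) r = refl
if-yes (no ¬r) r = contradiction r ¬r

if-no : (d : Dec R) → ¬ R → {a b : A} → (if does d then a else b) ≡ b
if-no (yes r) ¬r = contradiction r ¬r
if-no (no _)  ¬r = refl

∑-delta : (a ℓ : ℕ) (g : ℕ → ℤ) → ∑ (upTo ℓ) (λ p → 𝟙 (a ℕₚ.≟ p) ℤ.* g p) ≡ 𝟙 (a ℕₚ.<? ℓ) ℤ.* g a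
∑-delta a ℓ g = begin
  ∑ (upTo ℓ) (λ p → 𝟙 (a ℕₚ.≟ p) ℤ.* g p)
    ≡⟨ ∑-bij (Uniqueₚ.upTo⁺ ℓ) ([] ∷ []) (λ p → a ℕₚ.≟ p) (λ _ → a ℕₚ.<? ℓ) g (λ _ → g a) (λ _ → tt) (λ _ → a)
         (λ { p∈ refl → here refl , ∈ₚ.∈-upTo⁻ p∈ , refl , refl })
         (λ _ a<ℓ → ∈ₚ.∈-upTo⁺ a<ℓ , refl , refl) ⟩
  ∑ (tt ∷ []) (λ _ → 𝟙 (a ℕₚ.<? ℓ) ℤ.* g a)
    ≡⟨ ℤₚ.+-identityʳ _ ⟩
  𝟙 (a ℕₚ.<? ℓ) ℤ.* g a ∎
  where open ≡-Reasoning

-- Orbits, cyclic classes and the weight of a labelling.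

module Orbits {n : ℕ} (y : Fin n → Fin n) (y-inj : ∀ {a b} → y a ≡ y b → a ≡ b) where

  iter-inj : ∀ t {a b} → iter y t a ≡ iter y t b → a ≡ b
  iter-inj zero    eq = eq
  iter-inj (suc t) eq = iter-inj t (y-inj eq)

  period : ∀ z → ∃ λ d → suc d ≤ n × iter y (suc d) z ≡ z
  period z with Finₚ.pigeonhole (ℕₚ.n<1+n n) (λ (t : Fin (suc n)) → iter y (toℕ t) z)
  ... | i , j , i<j , eq with ℕₚ.m≤n⇒∃[o]m+o≡n i<j
  ...   | d , eq′ = d , bound , sym (iter-inj (toℕ i) (trans eq (trans (cong (λ t → iter y t z) split) (iter-+ y (toℕ i) (suc d) z))))
    where
    split : toℕ j ≡ toℕ i + suc d
    split = trans (sym eq′) (sym (ℕₚ.+-suc (toℕ i) d))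
    bound : suc d ≤ n
    bound = ℕₚ.≤-trans (subst (suc d ≤_) (sym split) (ℕₚ.m≤n+m (suc d) (toℕ i))) (ℕₚ.≤-pred (Finₚ.toℕ<n j))

  -- Bounded exponents make membership decidable; by pigeonhole, n of them reach the whole orbit.
  Orbit : Fin n → Fin n → Set
  Orbit z x = ∃ λ (t : Fin n) → iter y (toℕ t) z ≡ x

  orbit? : ∀ z x → Dec (Orbit z x)
  orbit? z x = Finₚ.any? (λ t → iter y (toℕ t) z Finₚ.≟ x)

  orbit-refl : ∀ z → Orbit z z
  orbit-refl z = fromℕ< 0<n , cong (λ t → iter y t z) (Finₚ.toℕ-fromℕ< 0<n)
    where
    0<n : 0 < n
    0<n = ℕₚ.≤-<-trans z≤n (Finₚ.toℕ<n z)

  orbit-step : ∀ {z x} → Orbit z x → Orbit z (y x)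
  orbit-step {z} (t , refl) with suc (toℕ t) ℕₚ.<? n
  ... | yes lt = fromℕ< lt , cong (λ t → iter y t z) (Finₚ.toℕ-fromℕ< lt)
  ... | no  ge = wrap (period z)
    where
    full : suc (toℕ t) ≡ n
    full = ℕₚ.≤-antisym (Finₚ.toℕ<n t) (ℕₚ.≮⇒≥ ge)
    -- iter n z = iter (n - period) z
    wrap : (∃ λ d → suc d ≤ n × iter y (suc d) z ≡ z) → Orbit z (y (iter y (toℕ t) z))
    wrap (d , d<n , eq) = fromℕ< lt , (begin
      iter y (toℕ (fromℕ< lt)) z ≡⟨ cong (λ t → iter y t z) (Finₚ.toℕ-fromℕ< lt) ⟩
      iter y (n ∸ suc d) z ≡⟨ cong (iter y (n ∸ suc d)) eq ⟨
      iter y (n ∸ suc d) (iter y (suc d) z) ≡⟨ iter-+ y (n ∸ suc d) (suc d) z ⟨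
      iter y (n ∸ suc d + suc d) z ≡⟨ cong (λ t → iter y t z) (trans (ℕₚ.m∸n+n≡m d<n) (sym full)) ⟩
      iter y (suc (toℕ t)) z ∎)
      where
      open ≡-Reasoning
      lt : n ∸ suc d < n
      lt = ℕₚ.∸-monoʳ-< {o = 0} (s≤s z≤n) d<n

  orbit-iter : ∀ {z x} → Orbit z x → ∀ t → Orbit z (iter y t x)
  orbit-iter o zero    = o
  orbit-iter o (suc t) = orbit-step (orbit-iter o t)

  -- The remaining steps of the cycle of `x` lead from `y x` back to `x`.
  orbit-back : ∀ {z x} → Orbit z (y x) → Orbit z x
  orbit-back {z} {x} o = let (d , _ , eq) = period x in
    subst (Orbit z) (trans (iter-comm y d x) eq) (orbit-iter o d)

  orbit-invariant : (f : Fin n → A) → (∀ x → f (y x) ≡ f x) → ∀ {z x} → Orbit z x → f x ≡ f z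
  orbit-invariant f inv-f {z} (t , refl) = go (toℕ t)
    where
    go : ∀ t → f (iter y t z) ≡ f z
    go zero    = refl
    go (suc t) = trans (inv-f _) (go t)

-- Only one inclusion is demanded. When `f` is invariant under `y`, the orbit of `z` lies in the
-- class anyway, and the class is then exactly that orbit.
Cyclic : (Fin n → Fin n) → Vec ℕ n → ℕ → Fin n → Set
Cyclic {n} y f j z = f ! z ≡ j × (∀ x → f ! x ≡ j → ∃ λ (t : Fin n) → iter y (toℕ t) z ≡ x)

cyclic? : (y : Fin n → Fin n) (f : Vec ℕ n) (j : ℕ) (z : Fin n) → Dec (Cyclic y f j z)
cyclic? y f j z = (f ! z ℕₚ.≟ j) ×-dec
  Finₚ.all? (λ x → (f ! x ℕₚ.≟ j) →-dec Finₚ.any? (λ t → iter y (toℕ t) z Finₚ.≟ x))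

class : Vec ℕ n → ℕ → ℕ
class f j = # (λ x → f ! x ℕₚ.≟ j)

-- A class that is a single cycle has as many generators as elements, so a power sum
-- block is counted with multiplicity; the choice of a generator linearises the cycle.
generators : (Fin n → Fin n) → Vec ℕ n → ℕ → Kind → ℕ → ℤ
generators     y f j hom ℓ       = + 1
generators     y f j pow zero    = + 1
generators {n} y f j pow (suc ℓ) = ∑ (allFin n) (λ z → 𝟙 (cyclic? y f j z))

partWeight : (Fin n → Fin n) → Vec ℕ n → ℕ → Kind × ℕ → ℤ
partWeight y f j (κ , ℓ) = 𝟙 (class f j ℕₚ.≟ ℓ) ℤ.* generators y f j κ ℓ

weight : (Fin n → Fin n) → Vec ℕ n → ℕ → List (Kind × ℕ) → ℤ
weight y f a []      = + 1
weight y f a (p ∷ Γ) = partWeight y f a p ℤ.* weight y f (suc a) Γ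

weight-++ : (y : Fin n → Fin n) (f : Vec ℕ n) (a : ℕ) (Γ Δ : List (Kind × ℕ)) →
  weight y f a (Γ ++ Δ) ≡ weight y f a Γ ℤ.* weight y f (a + length Γ) Δ
weight-++ y f a []      Δ = trans (cong (λ b → weight y f b Δ) (sym (ℕₚ.+-identityʳ a))) (sym (ℤₚ.*-identityˡ _))
weight-++ y f a (p ∷ Γ) Δ = trans (cong (λ s → partWeight y f a p ℤ.* s)
    (trans (weight-++ y f (suc a) Γ Δ) (cong (λ b → weight y f (suc a) Γ ℤ.* weight y f b Δ) (sym (ℕₚ.+-suc a (length Γ))))))
  (sym (ℤₚ.*-assoc (partWeight y f a p) _ _))

weight-cong : (y : Fin n → Fin n) (f h : Vec ℕ n) (a : ℕ) (Γ : List (Kind × ℕ)) →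
  (∀ b → a ≤ b → b < a + length Γ → ∀ x → (f ! x ≡ b → h ! x ≡ b) × (h ! x ≡ b → f ! x ≡ b)) →
  weight y f a Γ ≡ weight y h a Γ
weight-cong y f h a []      same = refl
weight-cong {n} y f h a ((κ , ℓ) ∷ Γ) same = cong₂ ℤ._*_
  (cong₂ ℤ._*_ (cong (λ m → 𝟙 (m ℕₚ.≟ ℓ)) (#-cong (λ x → f ! x ℕₚ.≟ a) (λ x → h ! x ℕₚ.≟ a) to from)) (gens κ ℓ))
  (weight-cong y f h (suc a) Γ (λ b a<b b< → same b (ℕₚ.<⇒≤ a<b) (subst (b <_) (sym (ℕₚ.+-suc a (length Γ))) b<)))
  where
  here! : ∀ x → (f ! x ≡ a → h ! x ≡ a) × (h ! x ≡ a → f ! x ≡ a)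
  here! = same a ℕₚ.≤-refl (ℕₚ.m<m+n a (s≤s z≤n))
  to : ∀ x → f ! x ≡ a → h ! x ≡ a
  to x = proj₁ (here! x)
  from : ∀ x → h ! x ≡ a → f ! x ≡ a
  from x = proj₂ (here! x)
  gens : ∀ κ ℓ → generators y f a κ ℓ ≡ generators y h a κ ℓ
  gens hom ℓ       = refl
  gens pow zero    = refl
  gens pow (suc ℓ) = ∑-cong (allFin n) (λ z → 𝟙-cong (cyclic? y f a z) (cyclic? y h a z)
    (λ (p , q) → to z p , λ x e → q x (from x e)) (λ (p , q) → from z p , λ x e → q x (to x e)))

parity-cong : (u : Fin n → Fin n) {s s′ : Fin n → Bool} → (∀ x → s x ≡ s′ x) →
  ∀ t x → parity u s t x ≡ parity u s′ t x
parity-cong u eq zero    x = refl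
parity-cong u eq (suc t) x = cong₂ _xor_ (eq x) (parity-cong u eq t (u x))

-- Newton's recursion on labelled permutations.

module Newton {n : ℕ} (κ M : ℕ) (ε : ℕ → Bool) where

  k : ℕ
  k = suc κ

  labellings : List (Vec ℕ n)
  labellings = allVecs (upTo M) n

  Admissible : Vec (Fin n) n → Vec ℕ n → Set
  Admissible u f = (∀ x → f ! iter (u !_) k x ≡ f ! x) × (∀ x → parity (u !_) (λ x → ε (f ! x)) k x ≡ false)

  admissible? : ∀ u f → Dec (Admissible u f)
  admissible? u f = Finₚ.all? (λ x → f ! iter (u !_) k x ℕₚ.≟ f ! x) ×-dec
    Finₚ.all? (λ x → parity (u !_) (λ x → ε (f ! x)) k x Boolₚ.≟ false)

  𝔸 : List (Kind × ℕ) → ℤ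
  𝔸 Γ = ∑ (perms n) (λ u → ∑ labellings (λ f → 𝟙 (admissible? u f) ℤ.* weight (iter (u !_) k) f 0 Γ))

  module Split (j j′ ℓ : ℕ) (j≢j′ : j ≢ j′) (j<M : j < M) (j′<M : j′ < M) (ε-same : ε j ≡ ε j′)
    (u : Vec (Fin n) n) (u-perm : Perm u) (z : Fin n) where

    y : Fin n → Fin n
    y = iter (u !_) k

    open Orbits y (Perm-iter u-perm k)

    Whole Cut : Vec ℕ n → Set
    Whole f = Admissible u f × class f j ≡ ℓ × class f j′ ≡ 0 × f ! z ≡ j
    Cut f = Admissible u f × class f j + class f j′ ≡ ℓ × Cyclic y f j′ z

    whole? : ∀ f → Dec (Whole f)
    whole? f = admissible? u f ×-dec ((class f j ℕₚ.≟ ℓ) ×-dec ((class f j′ ℕₚ.≟ 0) ×-dec (f ! z ℕₚ.≟ j)))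

    cut? : ∀ f → Dec (Cut f)
    cut? f = admissible? u f ×-dec ((class f j + class f j′ ℕₚ.≟ ℓ) ×-dec cyclic? y f j′ z)

    mark : Vec ℕ n → Fin n → ℕ
    mark f x = if does (orbit? z x) then j′ else f ! x
    unmark : Vec ℕ n → Fin n → ℕ
    unmark f x = if does (f ! x ℕₚ.≟ j′) then j else f ! x

    φ ψ : Vec ℕ n → Vec ℕ n
    φ f = tabulate (mark f)
    ψ f = tabulate (unmark f)

    φ-in : ∀ f {x} → Orbit z x → φ f ! x ≡ j′
    φ-in f {x} o = trans (Vecₚ.lookup∘tabulate (mark f) x) (if-yes (orbit? z x) o)
    φ-out : ∀ f {x} → ¬ Orbit z x → φ f ! x ≡ f ! x
    φ-out f {x} ¬o = trans (Vecₚ.lookup∘tabulate (mark f) x) (if-no (orbit? z x) ¬o)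
    ψ-in : ∀ f {x} → f ! x ≡ j′ → ψ f ! x ≡ j
    ψ-in f {x} e = trans (Vecₚ.lookup∘tabulate (unmark f) x) (if-yes (f ! x ℕₚ.≟ j′) e)
    ψ-out : ∀ f {x} → f ! x ≢ j′ → ψ f ! x ≡ f ! x
    ψ-out f {x} ¬e = trans (Vecₚ.lookup∘tabulate (unmark f) x) (if-no (f ! x ℕₚ.≟ j′) ¬e)

    module Marking (f : Vec ℕ n) (w : Whole f) where
      f-inv = proj₁ (proj₁ w)
      no-j′ : ∀ x → f ! x ≢ j′
      no-j′ = #≡0⇒none (λ x → f ! x ℕₚ.≟ j′) (proj₁ (proj₂ (proj₂ w)))
      fz≡j = proj₂ (proj₂ (proj₂ w))
      on-orbit : ∀ {x} → Orbit z x → f ! x ≡ j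
      on-orbit o = trans (orbit-invariant (f !_) f-inv o) fz≡j

      bound : (∀ x → f ! x < M) → ∀ x → φ f ! x < M
      bound f<M x with orbit? z x
      ... | yes o = subst (_< M) (sym (φ-in f o)) j′<M
      ... | no ¬o = subst (_< M) (sym (φ-out f ¬o)) (f<M x)

      φ-inv : ∀ x → φ f ! y x ≡ φ f ! x
      φ-inv x with orbit? z x
      ... | yes o = trans (φ-in f (orbit-step o)) (sym (φ-in f o))
      ... | no ¬o = trans (φ-out f (λ o → ¬o (orbit-back o))) (trans (f-inv x) (sym (φ-out f ¬o)))

      φ-ε : ∀ x → ε (φ f ! x) ≡ ε (f ! x)
      φ-ε x with orbit? z x
      ... | yes o = trans (cong ε (φ-in f o)) (trans (sym ε-same) (cong ε (sym (on-orbit o))))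
      ... | no ¬o = cong ε (φ-out f ¬o)

      φ-cut : Cut (φ f)
      φ-cut = (φ-inv , λ x → trans (parity-cong (u !_) φ-ε k x) (proj₂ (proj₁ w) x)) ,
        trans (sym (#-⊎ (λ x → φ f ! x ℕₚ.≟ j) (λ x → φ f ! x ℕₚ.≟ j′) (λ x p q → j≢j′ (trans (sym p) q))))
          (trans (#-cong (λ x → (φ f ! x ℕₚ.≟ j) ⊎-dec (φ f ! x ℕₚ.≟ j′)) (λ x → f ! x ℕₚ.≟ j) to from) (proj₁ (proj₂ w))) ,
        (φ-in f (orbit-refl z) , member)
        where
        to : ∀ x → φ f ! x ≡ j ⊎ φ f ! x ≡ j′ → f ! x ≡ j
        to x e with orbit? z x
        to x e | yes o = on-orbit o
        to x (inj₁ e) | no ¬o = trans (sym (φ-out f ¬o)) e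
        to x (inj₂ e) | no ¬o = contradiction (trans (sym (φ-out f ¬o)) e) (no-j′ x)
        from : ∀ x → f ! x ≡ j → φ f ! x ≡ j ⊎ φ f ! x ≡ j′
        from x e with orbit? z x
        ... | yes o = inj₂ (φ-in f o)
        ... | no ¬o = inj₁ (trans (φ-out f ¬o) e)
        member : ∀ x → φ f ! x ≡ j′ → Orbit z x
        member x e with orbit? z x
        ... | yes o = o
        ... | no ¬o = contradiction (trans (sym (φ-out f ¬o)) e) (no-j′ x)

      ψφ : ψ (φ f) ≡ f
      ψφ = vec-ext go
        where
        go : ∀ x → ψ (φ f) ! x ≡ f ! x
        go x with orbit? z x
        ... | yes o = trans (ψ-in (φ f) (φ-in f o)) (sym (on-orbit o))
        ... | no ¬o = trans (ψ-out (φ f) (λ e → no-j′ x (trans (sym (φ-out f ¬o)) e))) (φ-out f ¬o)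

      others : ∀ b → b ≢ j → b ≢ j′ → ∀ x → (f ! x ≡ b → φ f ! x ≡ b) × (φ f ! x ≡ b → f ! x ≡ b)
      others b b≢j b≢j′ x with orbit? z x
      ... | yes o = (λ e → contradiction (trans (sym e) (on-orbit o)) b≢j) , (λ e → contradiction (trans (sym e) (φ-in f o)) b≢j′)
      ... | no ¬o = trans (φ-out f ¬o) , trans (sym (φ-out f ¬o))

    module Unmarking (f : Vec ℕ n) (c : Cut f) where
      f-inv = proj₁ (proj₁ c)
      fz≡j′ = proj₁ (proj₂ (proj₂ c))
      member = proj₂ (proj₂ (proj₂ c))

      bound : (∀ x → f ! x < M) → ∀ x → ψ f ! x < M
      bound f<M x with f ! x ℕₚ.≟ j′
      ... | yes o = subst (_< M) (sym (ψ-in f o)) j<M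
      ... | no ¬o = subst (_< M) (sym (ψ-out f ¬o)) (f<M x)

      ψ-inv : ∀ x → ψ f ! y x ≡ ψ f ! x
      ψ-inv x with f ! x ℕₚ.≟ j′
      ... | yes o = trans (ψ-in f (trans (f-inv x) o)) (sym (ψ-in f o))
      ... | no ¬o = trans (ψ-out f (λ e → ¬o (trans (sym (f-inv x)) e))) (trans (f-inv x) (sym (ψ-out f ¬o)))

      ψ-ε : ∀ x → ε (ψ f ! x) ≡ ε (f ! x)
      ψ-ε x with f ! x ℕₚ.≟ j′
      ... | yes o = trans (cong ε (ψ-in f o)) (trans ε-same (cong ε (sym o)))
      ... | no ¬o = cong ε (ψ-out f ¬o)

      ψ-whole : Whole (ψ f)
      ψ-whole = (ψ-inv , λ x → trans (parity-cong (u !_) ψ-ε k x) (proj₂ (proj₁ c) x)) ,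
        trans (#-cong (λ x → ψ f ! x ℕₚ.≟ j) (λ x → (f ! x ℕₚ.≟ j) ⊎-dec (f ! x ℕₚ.≟ j′)) to from)
          (trans (#-⊎ (λ x → f ! x ℕₚ.≟ j) (λ x → f ! x ℕₚ.≟ j′) (λ x p q → j≢j′ (trans (sym p) q))) (proj₁ (proj₂ c))) ,
        #-none (λ x → ψ f ! x ℕₚ.≟ j′) none ,
        ψ-in f fz≡j′
        where
        to : ∀ x → ψ f ! x ≡ j → f ! x ≡ j ⊎ f ! x ≡ j′
        to x e with f ! x ℕₚ.≟ j′
        ... | yes o = inj₂ o
        ... | no ¬o = inj₁ (trans (sym (ψ-out f ¬o)) e)
        from : ∀ x → f ! x ≡ j ⊎ f ! x ≡ j′ → ψ f ! x ≡ j
        from x (inj₁ e) = trans (ψ-out f (λ e′ → j≢j′ (trans (sym e) e′))) e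
        from x (inj₂ e) = ψ-in f e
        none : ∀ x → ψ f ! x ≢ j′
        none x e with f ! x ℕₚ.≟ j′
        ... | yes o = j≢j′ (trans (sym (ψ-in f o)) e)
        ... | no ¬o = ¬o (trans (sym (ψ-out f ¬o)) e)

      φψ : φ (ψ f) ≡ f
      φψ = vec-ext go
        where
        go : ∀ x → φ (ψ f) ! x ≡ f ! x
        go x with orbit? z x
        ... | yes o = trans (φ-in (ψ f) o) (sym (trans (orbit-invariant (f !_) f-inv o) fz≡j′))
        ... | no ¬o = trans (φ-out (ψ f) ¬o) (ψ-out f (λ e → ¬o (member x e)))

    split-sum : (K : Vec ℕ n → ℤ) →
      (∀ f h → (∀ b → b ≢ j → b ≢ j′ → ∀ x → (f ! x ≡ b → h ! x ≡ b) × (h ! x ≡ b → f ! x ≡ b)) → K f ≡ K h) →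
      ∑ labellings (λ f → 𝟙 (whole? f) ℤ.* K f) ≡ ∑ labellings (λ f → 𝟙 (cut? f) ℤ.* K f)
    split-sum K K-cong = ∑-bij uniq uniq whole? cut? K K φ ψ
      (λ {f} f∈ w → let open Marking f w in
        ∈-allVecs⁺ (φ f) (λ x → ∈ₚ.∈-upTo⁺ (bound (λ x → ∈ₚ.∈-upTo⁻ (∈-allVecs⁻ f∈ x)) x)) , φ-cut , ψφ , K-cong f (φ f) others)
      (λ {f} f∈ c → let open Unmarking f c in
        ∈-allVecs⁺ (ψ f) (λ x → ∈ₚ.∈-upTo⁺ (bound (λ x → ∈ₚ.∈-upTo⁻ (∈-allVecs⁻ f∈ x)) x)) , ψ-whole , φψ)
      where
      uniq = allVecs-unique n (Uniqueₚ.upTo⁺ M)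

  module Recursion (pre mid post : List (Kind × ℕ)) (ℓ : ℕ) where

    j j′ : ℕ
    j  = length pre
    j′ = suc (j + length mid)

    parts : ℕ → ℕ → List (Kind × ℕ)
    parts p q = pre ++ (hom , p) ∷ mid ++ (pow , q) ∷ post

    rest : (Fin n → Fin n) → Vec ℕ n → ℤ
    rest y f = weight y f 0 pre ℤ.* (weight y f (suc j) mid ℤ.* weight y f (suc j′) post)

    weight-parts : ∀ y f p q → weight y f 0 (parts p q) ≡
      rest y f ℤ.* (𝟙 (class f j ℕₚ.≟ p) ℤ.* (𝟙 (class f j′ ℕₚ.≟ q) ℤ.* generators y f j′ pow q))
    weight-parts y f p q = begin
      weight y f 0 (parts p q)
        ≡⟨ weight-++ y f 0 pre _ ⟩
      a ℤ.* (c ℤ.* + 1 ℤ.* weight y f (suc j) (mid ++ (pow , q) ∷ post))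
        ≡⟨ cong (λ s → a ℤ.* (c ℤ.* + 1 ℤ.* s)) (weight-++ y f (suc j) mid _) ⟩
      a ℤ.* (c ℤ.* + 1 ℤ.* (b ℤ.* (d ℤ.* w)))
        ≡⟨ shuffle a b c d w ⟩
      rest y f ℤ.* (c ℤ.* d) ∎
      where
      open ≡-Reasoning
      a = weight y f 0 pre
      b = weight y f (suc j) mid
      c = 𝟙 (class f j ℕₚ.≟ p)
      d = 𝟙 (class f j′ ℕₚ.≟ q) ℤ.* generators y f j′ pow q
      w = weight y f (suc j′) post
      shuffle : ∀ a b c d w → a ℤ.* (c ℤ.* + 1 ℤ.* (b ℤ.* (d ℤ.* w))) ≡ a ℤ.* (b ℤ.* w) ℤ.* (c ℤ.* d)
      shuffle = solve-∀

    rest-cong : ∀ y f h → (∀ b → b ≢ j → b ≢ j′ → ∀ x → (f ! x ≡ b → h ! x ≡ b) × (h ! x ≡ b → f ! x ≡ b)) →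
      rest y f ≡ rest y h
    rest-cong y f h same = cong₂ ℤ._*_
      (weight-cong y f h 0 pre λ b _ b<j → same b (ℕₚ.<⇒≢ b<j) (ℕₚ.<⇒≢ (ℕₚ.<-trans b<j j<j′)))
      (cong₂ ℤ._*_
        (weight-cong y f h (suc j) mid λ b j<b b<j′ → same b (ℕₚ.<⇒≢ j<b ∘ sym) (ℕₚ.<⇒≢ b<j′))
        (weight-cong y f h (suc j′) post λ b j′<b _ → same b (ℕₚ.<⇒≢ (ℕₚ.<-trans j<j′ j′<b) ∘ sym) (ℕₚ.<⇒≢ j′<b ∘ sym)))
      where
      j<j′ : j < j′
      j<j′ = s≤s (ℕₚ.m≤m+n j (length mid))

    module _ (j′<M : j′ < M) (ε-same : ε j ≡ ε j′) where

      j<j′ : j < j′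
      j<j′ = s≤s (ℕₚ.m≤m+n j (length mid))

      module S (u : Vec (Fin n) n) (u-perm : Perm u) (z : Fin n) =
        Split j j′ ℓ (ℕₚ.<⇒≢ j<j′) (ℕₚ.<-trans j<j′ j′<M) j′<M ε-same u u-perm z

      -- The factor ℓ is the number of choices of a point `z` in the class `j`.
      whole-sum : ∀ u (u-perm : Perm u) f →
        + ℓ ℤ.* (𝟙 (admissible? u f) ℤ.* weight (iter (u !_) k) f 0 (parts ℓ 0)) ≡
        ∑ (allFin n) (λ z → 𝟙 (S.whole? u u-perm z f) ℤ.* rest (iter (u !_) k) f)
      whole-sum u u-perm f = begin
        + ℓ ℤ.* (ok ℤ.* weight y f 0 (parts ℓ 0))
          ≡⟨ cong (λ s → + ℓ ℤ.* (ok ℤ.* s)) (weight-parts y f ℓ 0) ⟩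
        + ℓ ℤ.* (ok ℤ.* (rest y f ℤ.* (c ℤ.* (d ℤ.* + 1))))
          ≡⟨ shuffle (+ ℓ) ok (rest y f) c d ⟩
        (c ℤ.* + ℓ) ℤ.* (ok ℤ.* d ℤ.* rest y f)
          ≡⟨ cong (ℤ._* (ok ℤ.* d ℤ.* rest y f)) (𝟙-guard (class f j ℕₚ.≟ ℓ) (λ eq → trans (cong +_ (sym eq)) (#-∑ (λ z → f ! z ℕₚ.≟ j)))) ⟩
        (c ℤ.* ∑ (allFin n) (λ z → 𝟙 (f ! z ℕₚ.≟ j))) ℤ.* (ok ℤ.* d ℤ.* rest y f)
          ≡⟨ shuffle′ c _ ok d (rest y f) ⟩
        ∑ (allFin n) (λ z → 𝟙 (f ! z ℕₚ.≟ j)) ℤ.* (ok ℤ.* (c ℤ.* d) ℤ.* rest y f)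
          ≡⟨ ∑-*ʳ (allFin n) _ (λ z → 𝟙 (f ! z ℕₚ.≟ j)) ⟨
        ∑ (allFin n) (λ z → 𝟙 (f ! z ℕₚ.≟ j) ℤ.* (ok ℤ.* (c ℤ.* d) ℤ.* rest y f))
          ≡⟨ ∑-cong (allFin n) (λ z → sym (trans (cong (ℤ._* rest y f) (brackets z)) (shuffle″ ok c d (𝟙 (f ! z ℕₚ.≟ j)) (rest y f)))) ⟩
        ∑ (allFin n) (λ z → 𝟙 (S.whole? u u-perm z f) ℤ.* rest y f) ∎
        where
        open ≡-Reasoning
        y  = iter (u !_) k
        ok = 𝟙 (admissible? u f)
        c  = 𝟙 (class f j ℕₚ.≟ ℓ)
        d  = 𝟙 (class f j′ ℕₚ.≟ 0)
        brackets : ∀ z → 𝟙 (S.whole? u u-perm z f) ≡ ok ℤ.* (c ℤ.* (d ℤ.* 𝟙 (f ! z ℕₚ.≟ j)))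
        brackets z = trans (𝟙-× (admissible? u f) ((class f j ℕₚ.≟ ℓ) ×-dec ((class f j′ ℕₚ.≟ 0) ×-dec (f ! z ℕₚ.≟ j)))) (cong (ok ℤ.*_) (trans (𝟙-× (class f j ℕₚ.≟ ℓ) ((class f j′ ℕₚ.≟ 0) ×-dec (f ! z ℕₚ.≟ j)))
          (cong (c ℤ.*_) (𝟙-× (class f j′ ℕₚ.≟ 0) (f ! z ℕₚ.≟ j)))))
        shuffle : ∀ l o r c d → l ℤ.* (o ℤ.* (r ℤ.* (c ℤ.* (d ℤ.* + 1)))) ≡ (c ℤ.* l) ℤ.* (o ℤ.* d ℤ.* r)
        shuffle = solve-∀
        shuffle′ : ∀ c s o d r → (c ℤ.* s) ℤ.* (o ℤ.* d ℤ.* r) ≡ s ℤ.* (o ℤ.* (c ℤ.* d) ℤ.* r)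
        shuffle′ = solve-∀
        shuffle″ : ∀ o c d b r → o ℤ.* (c ℤ.* (d ℤ.* b)) ℤ.* r ≡ b ℤ.* (o ℤ.* (c ℤ.* d) ℤ.* r)
        shuffle″ = solve-∀

      -- Summed over p, the conditions on the two sizes say only that the two classes have ℓ
      -- elements together. The bound p < ℓ is automatic, as the class of `z` is nonempty.
      cut-sum : ∀ u (u-perm : Perm u) f →
        ∑ (upTo ℓ) (λ p → 𝟙 (admissible? u f) ℤ.* weight (iter (u !_) k) f 0 (parts p (ℓ ∸ p))) ≡
        ∑ (allFin n) (λ z → 𝟙 (S.cut? u u-perm z f) ℤ.* rest (iter (u !_) k) f)
      cut-sum u u-perm f = begin
        ∑ (upTo ℓ) (λ p → ok ℤ.* weight y f 0 (parts p (ℓ ∸ p)))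
          ≡⟨ ∑-cong∈ (upTo ℓ) (λ {p} p∈ → trans (cong (ok ℤ.*_) (weight-parts y f p (ℓ ∸ p)))
               (trans (cong (λ G → ok ℤ.* (rest y f ℤ.* (𝟙 (class f j ℕₚ.≟ p) ℤ.* (𝟙 (class f j′ ℕₚ.≟ ℓ ∸ p) ℤ.* G)))) (gen p (∈ₚ.∈-upTo⁻ p∈)))
                 (shuffle ok (rest y f) (𝟙 (class f j ℕₚ.≟ p)) (𝟙 (class f j′ ℕₚ.≟ ℓ ∸ p)) G))) ⟩
        ∑ (upTo ℓ) (λ p → (ok ℤ.* rest y f ℤ.* G) ℤ.* (𝟙 (class f j ℕₚ.≟ p) ℤ.* 𝟙 (class f j′ ℕₚ.≟ ℓ ∸ p)))
          ≡⟨ ∑-*ˡ (upTo ℓ) (ok ℤ.* rest y f ℤ.* G) _ ⟩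
        (ok ℤ.* rest y f ℤ.* G) ℤ.* ∑ (upTo ℓ) (λ p → 𝟙 (class f j ℕₚ.≟ p) ℤ.* 𝟙 (class f j′ ℕₚ.≟ ℓ ∸ p))
          ≡⟨ cong ((ok ℤ.* rest y f ℤ.* G) ℤ.*_) (∑-delta (class f j) ℓ (λ p → 𝟙 (class f j′ ℕₚ.≟ ℓ ∸ p))) ⟩
        (ok ℤ.* rest y f ℤ.* G) ℤ.* c
          ≡⟨ shuffle′ (ok ℤ.* rest y f) G c ⟩
        G ℤ.* (c ℤ.* (ok ℤ.* rest y f))
          ≡⟨ ∑-*ʳ (allFin n) _ (λ z → 𝟙 (cyclic? y f j′ z)) ⟨
        ∑ (allFin n) (λ z → 𝟙 (cyclic? y f j′ z) ℤ.* (c ℤ.* (ok ℤ.* rest y f)))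
          ≡⟨ ∑-cong (allFin n) (λ z → trans (𝟙-guard (cyclic? y f j′ z) (λ cyc → cong (ℤ._* (ok ℤ.* rest y f)) (sizes z cyc)))
               (sym (trans (cong (ℤ._* rest y f) (brackets z)) (shuffle″ ok (𝟙 (class f j + class f j′ ℕₚ.≟ ℓ)) (𝟙 (cyclic? y f j′ z)) (rest y f))))) ⟩
        ∑ (allFin n) (λ z → 𝟙 (S.cut? u u-perm z f) ℤ.* rest y f) ∎
        where
        open ≡-Reasoning
        y  = iter (u !_) k
        ok = 𝟙 (admissible? u f)
        G  = ∑ (allFin n) (λ z → 𝟙 (cyclic? y f j′ z))
        c  = 𝟙 (class f j ℕₚ.<? ℓ) ℤ.* 𝟙 (class f j′ ℕₚ.≟ ℓ ∸ class f j)
        -- For p < ℓ the power sum part is nonempty, so the convention of `generators` for empty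
        -- parts does not intervene.
        gen : ∀ p → p < ℓ → generators y f j′ pow (ℓ ∸ p) ≡ G
        gen p p<ℓ with ℓ ∸ p | ℕₚ.m<n⇒0<n∸m p<ℓ
        ... | suc _ | _ = refl
        brackets : ∀ z → 𝟙 (S.cut? u u-perm z f) ≡ ok ℤ.* (𝟙 (class f j + class f j′ ℕₚ.≟ ℓ) ℤ.* 𝟙 (cyclic? y f j′ z))
        brackets z = trans (𝟙-× (admissible? u f) ((class f j + class f j′ ℕₚ.≟ ℓ) ×-dec cyclic? y f j′ z)) (cong (ok ℤ.*_) (𝟙-× (class f j + class f j′ ℕₚ.≟ ℓ) (cyclic? y f j′ z)))
        sizes : ∀ z → Cyclic y f j′ z → c ≡ 𝟙 (class f j + class f j′ ℕₚ.≟ ℓ)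
        sizes z (fz , _) = trans (sym (𝟙-× (class f j ℕₚ.<? ℓ) (class f j′ ℕₚ.≟ ℓ ∸ class f j)))
          (𝟙-cong ((class f j ℕₚ.<? ℓ) ×-dec (class f j′ ℕₚ.≟ ℓ ∸ class f j)) (class f j + class f j′ ℕₚ.≟ ℓ)
            (λ (lt , eq) → trans (cong (class f j ℕ.+_) eq) (ℕₚ.m+[n∸m]≡n (ℕₚ.<⇒≤ lt)))
            (λ { refl → ℕₚ.m<m+n (class f j) positive , sym (ℕₚ.m+n∸m≡n (class f j) (class f j′)) }))
          where
          positive : 0 < class f j′
          positive = ℕₚ.n≢0⇒n>0 (λ eq → #≡0⇒none (λ x → f ! x ℕₚ.≟ j′) eq z fz)
        shuffle : ∀ o r a b g → o ℤ.* (r ℤ.* (a ℤ.* (b ℤ.* g))) ≡ (o ℤ.* r ℤ.* g) ℤ.* (a ℤ.* b)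
        shuffle = solve-∀
        shuffle′ : ∀ o g c → (o ℤ.* g) ℤ.* c ≡ g ℤ.* (c ℤ.* o)
        shuffle′ = solve-∀
        shuffle″ : ∀ o s g r → o ℤ.* (s ℤ.* g) ℤ.* r ≡ g ℤ.* (s ℤ.* (o ℤ.* r))
        shuffle″ = solve-∀

      newton-𝔸 : + ℓ ℤ.* 𝔸 (parts ℓ 0) ≡ ∑ (upTo ℓ) (λ p → 𝔸 (parts p (ℓ ∸ p)))
      newton-𝔸 = begin
        + ℓ ℤ.* 𝔸 (parts ℓ 0)
          ≡⟨ ∑-*ˡ (perms n) (+ ℓ) _ ⟨
        ∑ (perms n) (λ u → + ℓ ℤ.* ∑ labellings (λ f → term u ℓ 0 f))
          ≡⟨ ∑-cong∈ (perms n) (λ u∈ → fibre _ (∈-perms⁻ u∈)) ⟩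
        ∑ (perms n) (λ u → ∑ (upTo ℓ) (λ p → ∑ labellings (term u p (ℓ ∸ p))))
          ≡⟨ ∑-swap (perms n) (upTo ℓ) _ ⟩
        ∑ (upTo ℓ) (λ p → 𝔸 (parts p (ℓ ∸ p))) ∎
        where
        open ≡-Reasoning
        term : Vec (Fin n) n → ℕ → ℕ → Vec ℕ n → ℤ
        term u p q f = 𝟙 (admissible? u f) ℤ.* weight (iter (u !_) k) f 0 (parts p q)
        fibre : ∀ u → Perm u → + ℓ ℤ.* ∑ labellings (term u ℓ 0) ≡ ∑ (upTo ℓ) (λ p → ∑ labellings (term u p (ℓ ∸ p)))
        fibre u u-perm = begin
          + ℓ ℤ.* ∑ labellings (term u ℓ 0)
            ≡⟨ ∑-*ˡ labellings (+ ℓ) (term u ℓ 0) ⟨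
          ∑ labellings (λ f → + ℓ ℤ.* term u ℓ 0 f)
            ≡⟨ ∑-cong labellings (whole-sum u u-perm) ⟩
          ∑ labellings (λ f → ∑ (allFin n) (λ z → 𝟙 (S.whole? u u-perm z f) ℤ.* rest y f))
            ≡⟨ ∑-swap labellings (allFin n) _ ⟩
          ∑ (allFin n) (λ z → ∑ labellings (λ f → 𝟙 (S.whole? u u-perm z f) ℤ.* rest y f))
            ≡⟨ ∑-cong (allFin n) (λ z → S.split-sum u u-perm z (rest y) (rest-cong y)) ⟩
          ∑ (allFin n) (λ z → ∑ labellings (λ f → 𝟙 (S.cut? u u-perm z f) ℤ.* rest y f))
            ≡⟨ ∑-swap (allFin n) labellings _ ⟩
          ∑ labellings (λ f → ∑ (allFin n) (λ z → 𝟙 (S.cut? u u-perm z f) ℤ.* rest y f))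
            ≡⟨ ∑-cong labellings (cut-sum u u-perm) ⟨
          ∑ labellings (λ f → ∑ (upTo ℓ) (λ p → term u p (ℓ ∸ p) f))
            ≡⟨ ∑-swap labellings (upTo ℓ) _ ⟩
          ∑ (upTo ℓ) (λ p → ∑ labellings (term u p (ℓ ∸ p))) ∎
          where
          y : Fin n → Fin n
          y = iter (u !_) k

-- Entries of lists by position.

nth : A → List A → ℕ → A
nth d []       i       = d
nth d (x ∷ xs) zero    = x
nth d (x ∷ xs) (suc i) = nth d xs i

nth-++ˡ : (d : A) (xs ys : List A) {i : ℕ} → i < length xs → nth d (xs ++ ys) i ≡ nth d xs i
nth-++ˡ d (x ∷ xs) ys {zero}  lt       = refl
nth-++ˡ d (x ∷ xs) ys {suc i} (s≤s lt) = nth-++ˡ d xs ys lt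

nth-++ʳ : (d : A) (xs ys : List A) (i : ℕ) → nth d (xs ++ ys) (length xs + i) ≡ nth d ys i
nth-++ʳ d []       ys i = refl
nth-++ʳ d (x ∷ xs) ys i = nth-++ʳ d xs ys i

nth-map : (g : A → C) (d : A) (e : C) (xs : List A) {i : ℕ} → i < length xs → nth e (map g xs) i ≡ g (nth d xs i)
nth-map g d e (x ∷ xs) {zero}  lt       = refl
nth-map g d e (x ∷ xs) {suc i} (s≤s lt) = nth-map g d e xs lt

nth-replicate : (d a : A) (ℓ : ℕ) {i : ℕ} → i < ℓ → nth d (replicate ℓ a) i ≡ a
nth-replicate d a (suc ℓ) {zero}  lt       = refl
nth-replicate d a (suc ℓ) {suc i} (s≤s lt) = nth-replicate d a ℓ lt

nth-take : (d : A) (ℓ : ℕ) (ws : List A) {i : ℕ} → i < ℓ → nth d (take ℓ ws) i ≡ nth d ws i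
nth-take d (suc ℓ) []       _                = refl
nth-take d (suc ℓ) (w ∷ ws) {zero}  _        = refl
nth-take d (suc ℓ) (w ∷ ws) {suc i} (s≤s lt) = nth-take d ℓ ws lt

nth-drop : (d : A) (ℓ : ℕ) (ws : List A) (i : ℕ) → nth d (drop ℓ ws) i ≡ nth d ws (ℓ + i)
nth-drop d zero    ws       i = refl
nth-drop d (suc ℓ) []       i = refl
nth-drop d (suc ℓ) (w ∷ ws) i = nth-drop d ℓ ws i

nth-toList : (d : A) (v : Vec A n) (x : Fin n) → nth d (toList v) (toℕ x) ≡ v ! x
nth-toList d (a ∷ v) zero    = refl
nth-toList d (a ∷ v) (suc x) = nth-toList d v x

allPairs⇒nth : (xs : List ℕ) → AllPairs _<_ xs → ∀ {i i′} → i < i′ → i′ < length xs → nth 0 xs i < nth 0 xs i′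
allPairs⇒nth (x ∷ xs) (all ∷ ps) {zero}  {suc i′} lt (s≤s lt′) = go xs all lt′
  where
  go : ∀ {i} ys → All (x <_) ys → i < length ys → x < nth 0 ys i
  go {zero}  (y ∷ ys) (p ∷ _)  lt       = p
  go {suc i} (y ∷ ys) (_ ∷ ps) (s≤s lt) = go ys ps lt
allPairs⇒nth (x ∷ xs) (all ∷ ps) {suc i} {suc i′} (s≤s lt) (s≤s lt′) = allPairs⇒nth xs ps lt lt′

nth⇒allPairs : (xs : List ℕ) → (∀ {i i′} → i < i′ → i′ < length xs → nth 0 xs i < nth 0 xs i′) → AllPairs _<_ xs
nth⇒allPairs []       h = []
nth⇒allPairs (x ∷ xs) h = go xs (λ lt → h {0} (s≤s z≤n) (s≤s lt)) ∷ nth⇒allPairs xs (λ lt lt′ → h (s≤s lt) (s≤s lt′))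
  where
  go : ∀ ys → (∀ {i} → i < length ys → x < nth 0 ys i) → All (x <_) ys
  go []       h = []
  go (y ∷ ys) h = h {0} (s≤s z≤n) ∷ go ys (λ lt → h (s≤s lt))

∑-upTo-suc : (m : ℕ) (g : ℕ → ℤ) → ∑ (upTo (suc m)) g ≡ g 0 ℤ.+ ∑ (upTo m) (g ∘ suc)
∑-upTo-suc m g = cong (λ s → g 0 ℤ.+ s)
  (trans (cong (λ l → ∑ l g) (sym (Listₚ.map-upTo suc m))) (∑-map suc (upTo m) g))

-- Newton's identity on words.

inc : List ℕ → ℤ
inc ts = 𝟙 (allPairs? ℕₚ._<?_ ts)

-- On words with distinct letters this is the noncommutative power sum of the first kind: the
-- alternating sum, with sign (-1)^i, of the ribbons with descent set {1, ..., i}.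
vee : List ℕ → ℤ
vee []          = + 1
vee (x ∷ [])    = + 1
vee (x ∷ y ∷ r) = if does (x ℕₚ.<? y) then inc (y ∷ r) else ℤ.- vee (y ∷ r)

inc-[] : inc [] ≡ + 1
inc-[] = 𝟙-yes (allPairs? ℕₚ._<?_ []) []

inc-[x] : ∀ x → inc (x ∷ []) ≡ + 1
inc-[x] x = 𝟙-yes (allPairs? ℕₚ._<?_ (x ∷ [])) ([] ∷ [])

inc-∷∷ : ∀ x y r → inc (x ∷ y ∷ r) ≡ 𝟙 (x ℕₚ.<? y) ℤ.* inc (y ∷ r)
inc-∷∷ x y r = trans
  (𝟙-cong (allPairs? ℕₚ._<?_ (x ∷ y ∷ r)) ((x ℕₚ.<? y) ×-dec allPairs? ℕₚ._<?_ (y ∷ r))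
    (λ { ((x<y ∷ _) ∷ ps) → x<y , ps })
    (λ { (x<y , ps@(y< ∷ _)) → (x<y ∷ All.map (ℕₚ.<-trans x<y) y<) ∷ ps }))
  (𝟙-× (x ℕₚ.<? y) (allPairs? ℕₚ._<?_ (y ∷ r)))

-- If x < y, the term p = 0 contributes one further copy of `inc`, and the other terms reproduce the
-- identity for `y ∷ r`. Otherwise the terms p = 0 and p = 1 cancel, and every longer prefix
-- contains the non-ascent from x to y and vanishes.
newton-step : ∀ x y r →
  ∑ (upTo (suc (length r))) (λ p → inc (take p (y ∷ r)) ℤ.* vee (drop p (y ∷ r))) ≡ + suc (length r) ℤ.* inc (y ∷ r) →
  ∑ (upTo (suc (suc (length r)))) (λ p → inc (take p (x ∷ y ∷ r)) ℤ.* vee (drop p (x ∷ y ∷ r))) ≡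
  + suc (suc (length r)) ℤ.* inc (x ∷ y ∷ r)
newton-step x y r rec = begin
  ∑ (upTo (suc (suc m))) (λ p → inc (take p (x ∷ ts)) ℤ.* vee (drop p (x ∷ ts)))
    ≡⟨ ∑-upTo-suc (suc m) (λ p → inc (take p (x ∷ ts)) ℤ.* vee (drop p (x ∷ ts))) ⟩
  inc [] ℤ.* vee (x ∷ ts) ℤ.+ ∑ (upTo (suc m)) (λ p → inc (x ∷ take p ts) ℤ.* vee (drop p ts))
    ≡⟨ cong₂ ℤ._+_ (trans (cong (ℤ._* vee (x ∷ ts)) inc-[]) (ℤₚ.*-identityˡ _)) (∑-upTo-suc m (λ p → inc (x ∷ take p ts) ℤ.* vee (drop p ts))) ⟩
  vee (x ∷ ts) ℤ.+ (inc (x ∷ []) ℤ.* vee ts ℤ.+ ∑ (upTo m) (λ q → inc (x ∷ y ∷ take q r) ℤ.* vee (drop q r)))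
    ≡⟨ cong (λ s → vee (x ∷ ts) ℤ.+ s) (cong₂ ℤ._+_ (trans (cong (ℤ._* vee ts) (inc-[x] x)) (ℤₚ.*-identityˡ _))
        (trans (∑-cong (upTo m) (λ q → trans (cong (ℤ._* vee (drop q r)) (inc-∷∷ x y (take q r))) (ℤₚ.*-assoc b _ _))) (∑-*ˡ (upTo m) b _))) ⟩
  vee (x ∷ ts) ℤ.+ (vee ts ℤ.+ b ℤ.* tail-sum)
    ≡⟨ cases (x ℕₚ.<? y) ⟩
  + suc (suc m) ℤ.* (b ℤ.* inc ts)
    ≡⟨ cong (+ suc (suc m) ℤ.*_) (inc-∷∷ x y r) ⟨
  + suc (suc m) ℤ.* inc (x ∷ ts) ∎
  where
  open ≡-Reasoning
  m = length r
  ts = y ∷ r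
  b = 𝟙 (x ℕₚ.<? y)
  tail-sum = ∑ (upTo m) (λ q → inc (y ∷ take q r) ℤ.* vee (drop q r))
  ih : vee ts ℤ.+ tail-sum ≡ + suc m ℤ.* inc ts
  ih = trans (cong (ℤ._+ tail-sum) (sym (trans (cong (ℤ._* vee ts) inc-[]) (ℤₚ.*-identityˡ _))))
    (trans (sym (∑-upTo-suc m (λ p → inc (take p ts) ℤ.* vee (drop p ts)))) rec)
  cancel : ∀ v s → ℤ.- v ℤ.+ (v ℤ.+ + 0 ℤ.* s) ≡ + 0
  cancel = solve-∀
  cases : Dec (x < y) → vee (x ∷ ts) ℤ.+ (vee ts ℤ.+ b ℤ.* tail-sum) ≡ + suc (suc m) ℤ.* (b ℤ.* inc ts)
  cases (yes x<y) = begin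
    vee (x ∷ ts) ℤ.+ (vee ts ℤ.+ b ℤ.* tail-sum)
      ≡⟨ cong₂ (λ a c → a ℤ.+ (vee ts ℤ.+ c ℤ.* tail-sum)) (if-yes (x ℕₚ.<? y) x<y) (𝟙-yes (x ℕₚ.<? y) x<y) ⟩
    inc ts ℤ.+ (vee ts ℤ.+ + 1 ℤ.* tail-sum)
      ≡⟨ cong (λ s → inc ts ℤ.+ s) (trans (cong (λ s → vee ts ℤ.+ s) (ℤₚ.*-identityˡ _)) ih) ⟩
    inc ts ℤ.+ + suc m ℤ.* inc ts
      ≡⟨ ℤₚ.suc-* (+ suc m) (inc ts) ⟨
    + suc (suc m) ℤ.* inc ts
      ≡⟨ cong (+ suc (suc m) ℤ.*_) (trans (cong (ℤ._* inc ts) (𝟙-yes (x ℕₚ.<? y) x<y)) (ℤₚ.*-identityˡ _)) ⟨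
    + suc (suc m) ℤ.* (b ℤ.* inc ts) ∎
  cases (no x≮y) = begin
    vee (x ∷ ts) ℤ.+ (vee ts ℤ.+ b ℤ.* tail-sum)
      ≡⟨ cong₂ (λ a c → a ℤ.+ (vee ts ℤ.+ c ℤ.* tail-sum)) (if-no (x ℕₚ.<? y) x≮y) (𝟙-no (x ℕₚ.<? y) x≮y) ⟩
    ℤ.- vee ts ℤ.+ (vee ts ℤ.+ + 0 ℤ.* tail-sum)
      ≡⟨ cancel (vee ts) tail-sum ⟩
    + 0
      ≡⟨ ℤₚ.*-zeroʳ (+ suc (suc m)) ⟨
    + suc (suc m) ℤ.* + 0
      ≡⟨ cong (λ c → + suc (suc m) ℤ.* (c ℤ.* inc ts)) (𝟙-no (x ℕₚ.<? y) x≮y) ⟨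
    + suc (suc m) ℤ.* (b ℤ.* inc ts) ∎

-- Newton's identity  ℓ h_ℓ = Σ h_p p_{ℓ-p},  term by term on words.
newton-list : ∀ ts → ∑ (upTo (length ts)) (λ p → inc (take p ts) ℤ.* vee (drop p ts)) ≡ + length ts ℤ.* inc ts
newton-list []          = refl
newton-list (x ∷ [])    = trans (cong (λ i → i ℤ.* + 1 ℤ.+ + 0) inc-[]) (sym (cong (+ 1 ℤ.*_) (inc-[x] x)))
newton-list (x ∷ y ∷ r) = newton-step x y r (newton-list (y ∷ r))

blockWeight : Kind → List ℕ → ℤ
blockWeight hom = inc
blockWeight pow = vee

wordWeight : List (Kind × ℕ) → List ℕ → ℤ
wordWeight []            ws = + 1
wordWeight ((κ , ℓ) ∷ Γ) ws = blockWeight κ (take ℓ ws) ℤ.* wordWeight Γ (drop ℓ ws)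

total : List (Kind × ℕ) → ℕ
total []            = 0
total ((_ , ℓ) ∷ Γ) = ℓ + total Γ

wordWeight-++ : ∀ Γ Δ ws → wordWeight (Γ ++ Δ) ws ≡ wordWeight Γ ws ℤ.* wordWeight Δ (drop (total Γ) ws)
wordWeight-++ []            Δ ws = sym (ℤₚ.*-identityˡ _)
wordWeight-++ ((κ , ℓ) ∷ Γ) Δ ws = trans (cong (blockWeight κ (take ℓ ws) ℤ.*_)
    (trans (wordWeight-++ Γ Δ (drop ℓ ws)) (cong (λ l → wordWeight Γ (drop ℓ ws) ℤ.* wordWeight Δ l)
      (Listₚ.drop-drop ℓ (total Γ) ws))))
  (sym (ℤₚ.*-assoc (blockWeight κ (take ℓ ws)) _ _))

wordWeight-empty : ∀ r Δ ws → wordWeight (replicate r (hom , 0) ++ Δ) ws ≡ wordWeight Δ ws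
wordWeight-empty zero    Δ ws = refl
wordWeight-empty (suc r) Δ ws = trans (cong (ℤ._* wordWeight (replicate r (hom , 0) ++ Δ) ws) inc-[])
  (trans (ℤₚ.*-identityˡ _) (wordWeight-empty r Δ ws))

take-drop-comm : (p q : ℕ) (xs : List A) → take q (drop p xs) ≡ drop p (take (p + q) xs)
take-drop-comm zero    q xs       = refl
take-drop-comm (suc p) q []       = Listₚ.take-[] q
take-drop-comm (suc p) q (x ∷ xs) = take-drop-comm p q xs

take-take-≤ : ∀ {p m : ℕ} (xs : List A) → p ≤ m → take p xs ≡ take p (take m xs)
take-take-≤ xs       z≤n     = refl
take-take-≤ []       (s≤s _) = refl
take-take-≤ (x ∷ xs) (s≤s l) = cong (x ∷_) (take-take-≤ xs l)

-- The homogeneous and the power sum block share a window of ℓ letters, which the bound on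
-- `length ws` guarantees to be full. The factors before and after the window do not depend on p, so
-- `newton-list` applies to the window alone.
newton-word : ∀ pre r post ℓ ws → total pre + ℓ ≤ length ws →
  + ℓ ℤ.* wordWeight (pre ++ (hom , ℓ) ∷ replicate r (hom , 0) ++ (pow , 0) ∷ post) ws ≡
  ∑ (upTo ℓ) (λ p → wordWeight (pre ++ (hom , p) ∷ replicate r (hom , 0) ++ (pow , ℓ ∸ p) ∷ post) ws)
newton-word pre r post ℓ ws fits = begin
  + ℓ ℤ.* wordWeight (parts ℓ 0) ws
    ≡⟨ cong (+ ℓ ℤ.*_) (shape ℓ 0) ⟩
  + ℓ ℤ.* (a ℤ.* (inc ts ℤ.* (+ 1 ℤ.* c)))
    ≡⟨ shuffle (+ ℓ) a (inc ts) c ⟩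
  (a ℤ.* c) ℤ.* (+ ℓ ℤ.* inc ts)
    ≡⟨ cong (λ m → (a ℤ.* c) ℤ.* (+ m ℤ.* inc ts)) len ⟨
  (a ℤ.* c) ℤ.* (+ length ts ℤ.* inc ts)
    ≡⟨ cong ((a ℤ.* c) ℤ.*_) (newton-list ts) ⟨
  (a ℤ.* c) ℤ.* ∑ (upTo (length ts)) (λ p → inc (take p ts) ℤ.* vee (drop p ts))
    ≡⟨ cong (λ m → (a ℤ.* c) ℤ.* ∑ (upTo m) (λ p → inc (take p ts) ℤ.* vee (drop p ts))) len ⟩
  (a ℤ.* c) ℤ.* ∑ (upTo ℓ) (λ p → inc (take p ts) ℤ.* vee (drop p ts))
    ≡⟨ ∑-*ˡ (upTo ℓ) (a ℤ.* c) _ ⟨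
  ∑ (upTo ℓ) (λ p → (a ℤ.* c) ℤ.* (inc (take p ts) ℤ.* vee (drop p ts)))
    ≡⟨ ∑-cong∈ (upTo ℓ) (λ p∈ → sym (term _ (ℕₚ.<⇒≤ (∈ₚ.∈-upTo⁻ p∈)))) ⟩
  ∑ (upTo ℓ) (λ p → wordWeight (parts p (ℓ ∸ p)) ws) ∎
  where
  open ≡-Reasoning
  parts : ℕ → ℕ → List (Kind × ℕ)
  parts p q = pre ++ (hom , p) ∷ replicate r (hom , 0) ++ (pow , q) ∷ post
  vs = drop (total pre) ws
  ts = take ℓ vs
  a = wordWeight pre ws
  c = wordWeight post (drop ℓ vs)
  len : length ts ≡ ℓ
  len = trans (Listₚ.length-take ℓ vs) (ℕₚ.m≤n⇒m⊓n≡m (subst (ℓ ≤_) (sym (Listₚ.length-drop (total pre) ws))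
    (ℕₚ.m+n≤o⇒m≤o∸n ℓ (subst (_≤ length ws) (ℕₚ.+-comm (total pre) ℓ) fits))))
  shape : ∀ p q → wordWeight (parts p q) ws ≡
    a ℤ.* (inc (take p vs) ℤ.* (vee (take q (drop p vs)) ℤ.* wordWeight post (drop q (drop p vs))))
  shape p q = trans (wordWeight-++ pre _ ws)
    (cong (λ s → a ℤ.* (inc (take p vs) ℤ.* s)) (wordWeight-empty r ((pow , q) ∷ post) (drop p vs)))
  shuffle : ∀ l a i c → l ℤ.* (a ℤ.* (i ℤ.* (+ 1 ℤ.* c))) ≡ (a ℤ.* c) ℤ.* (l ℤ.* i)
  shuffle = solve-∀
  shuffle′ : ∀ a i v c → a ℤ.* (i ℤ.* (v ℤ.* c)) ≡ (a ℤ.* c) ℤ.* (i ℤ.* v)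
  shuffle′ = solve-∀
  term : ∀ p → p ≤ ℓ → wordWeight (parts p (ℓ ∸ p)) ws ≡ (a ℤ.* c) ℤ.* (inc (take p ts) ℤ.* vee (drop p ts))
  term p p≤ℓ = begin
    wordWeight (parts p (ℓ ∸ p)) ws
      ≡⟨ shape p (ℓ ∸ p) ⟩
    a ℤ.* (inc (take p vs) ℤ.* (vee (take (ℓ ∸ p) (drop p vs)) ℤ.* wordWeight post (drop (ℓ ∸ p) (drop p vs))))
      ≡⟨ cong (λ l → a ℤ.* (inc (take p vs) ℤ.* (vee (take (ℓ ∸ p) (drop p vs)) ℤ.* wordWeight post l)))
           (trans (Listₚ.drop-drop p (ℓ ∸ p) vs) (cong (λ m → drop m vs) (ℕₚ.m+[n∸m]≡n p≤ℓ))) ⟩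
    a ℤ.* (inc (take p vs) ℤ.* (vee (take (ℓ ∸ p) (drop p vs)) ℤ.* c))
      ≡⟨ cong₂ (λ l l′ → a ℤ.* (inc l ℤ.* (vee l′ ℤ.* c))) (take-take-≤ vs p≤ℓ)
           (trans (take-drop-comm p (ℓ ∸ p) vs) (cong (λ m → drop p (take m vs)) (ℕₚ.m+[n∸m]≡n p≤ℓ))) ⟩
    a ℤ.* (inc (take p ts) ℤ.* (vee (drop p ts) ℤ.* c))
      ≡⟨ shuffle′ a (inc (take p ts)) (vee (drop p ts)) c ⟩
    (a ℤ.* c) ℤ.* (inc (take p ts) ℤ.* vee (drop p ts)) ∎

-- Sorted labellings and the weights of flat block sequences.

labels : ℕ → List (Kind × ℕ) → List ℕ
labels a []            = []
labels a ((_ , ℓ) ∷ Γ) = replicate ℓ a ++ labels (suc a) Γ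

labels-++ : ∀ a Γ Δ → labels a (Γ ++ Δ) ≡ labels a Γ ++ labels (a + length Γ) Δ
labels-++ a []            Δ = cong (λ b → labels b Δ) (sym (ℕₚ.+-identityʳ a))
labels-++ a ((_ , ℓ) ∷ Γ) Δ = trans (cong (replicate ℓ a ++_)
    (trans (labels-++ (suc a) Γ Δ) (cong (λ b → labels (suc a) Γ ++ labels b Δ) (sym (ℕₚ.+-suc a (length Γ))))))
  (sym (Listₚ.++-assoc (replicate ℓ a) _ _))

labels-empty : ∀ a r → labels a (replicate r (hom , 0)) ≡ []
labels-empty a zero    = refl
labels-empty a (suc r) = labels-empty (suc a) r

length-labels : ∀ a Γ → length (labels a Γ) ≡ total Γ
length-labels a []            = refl
length-labels a ((_ , ℓ) ∷ Γ) = trans (Listₚ.length-++ (replicate ℓ a))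
  (cong₂ _+_ (Listₚ.length-replicate ℓ) (length-labels (suc a) Γ))

data Side (ℓ : ℕ) (i : ℕ) : Set where
  before : i < ℓ → Side ℓ i
  after  : ∀ i′ → i ≡ ℓ + i′ → Side ℓ i

side : ∀ ℓ i → Side ℓ i
side ℓ i with i ℕₚ.<? ℓ
... | yes lt = before lt
... | no  ge = after (i ∸ ℓ) (sym (ℕₚ.m+[n∸m]≡n (ℕₚ.≮⇒≥ ge)))

nth-before : (d a : A) (ℓ : ℕ) (ys : List A) {i : ℕ} → i < ℓ → nth d (replicate ℓ a ++ ys) i ≡ a
nth-before d a ℓ ys lt = trans (nth-++ˡ d (replicate ℓ a) ys (subst (_ <_) (sym (Listₚ.length-replicate ℓ)) lt)) (nth-replicate d a ℓ lt)

nth-after : (d a : A) (ℓ : ℕ) (ys : List A) (i : ℕ) → nth d (replicate ℓ a ++ ys) (ℓ + i) ≡ nth d ys i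
nth-after d a ℓ ys i = trans (cong (λ m → nth d (replicate ℓ a ++ ys) (m + i)) (sym (Listₚ.length-replicate ℓ)))
  (nth-++ʳ d (replicate ℓ a) ys i)

labels-bounds : ∀ a Γ {i} → i < total Γ → a ≤ nth 0 (labels a Γ) i × nth 0 (labels a Γ) i < a + length Γ
labels-bounds a ((_ , ℓ) ∷ Γ) {i} lt with side ℓ i
... | before p rewrite nth-before 0 a ℓ (labels (suc a) Γ) p = ℕₚ.≤-refl , ℕₚ.m<m+n a (s≤s z≤n)
... | after i′ refl rewrite nth-after 0 a ℓ (labels (suc a) Γ) i′ | ℕₚ.+-suc a (length Γ) =
  let (lo , hi) = labels-bounds (suc a) Γ (ℕₚ.+-cancelˡ-< ℓ _ _ lt) in ℕₚ.<⇒≤ lo , hi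

labels-mono : ∀ a Γ {i i′} → i < i′ → i′ < total Γ → nth 0 (labels a Γ) i ≤ nth 0 (labels a Γ) i′
labels-mono a ((κ , ℓ) ∷ Γ) {i} {i′} i<i′ lt with side ℓ i | side ℓ i′
... | before p | _ rewrite nth-before 0 a ℓ (labels (suc a) Γ) p = proj₁ (labels-bounds a ((κ , ℓ) ∷ Γ) lt)
... | after j refl | before p = contradiction (ℕₚ.<-trans i<i′ p) (ℕₚ.m+n≮m ℓ j)
... | after j refl | after j′ refl rewrite nth-after 0 a ℓ (labels (suc a) Γ) j | nth-after 0 a ℓ (labels (suc a) Γ) j′ =
  labels-mono (suc a) Γ (ℕₚ.+-cancelˡ-< ℓ _ _ i<i′) (ℕₚ.+-cancelˡ-< ℓ _ _ lt)

count : ℕ → List ℕ → ℕ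
count b []       = 0
count b (x ∷ xs) = (if does (x ℕₚ.≟ b) then 1 else 0) + count b xs

#-nth : ∀ b (xs : List ℕ) → length xs ≡ n → # {n} (λ x → nth 0 xs (toℕ x) ℕₚ.≟ b) ≡ count b xs
#-nth b []       refl = refl
#-nth b (x ∷ xs) refl = cong ((if does (x ℕₚ.≟ b) then 1 else 0) ℕ.+_) (#-nth b xs refl)

count-++ : ∀ b xs ys → count b (xs ++ ys) ≡ count b xs + count b ys
count-++ b []       ys = refl
count-++ b (x ∷ xs) ys = trans (cong (_ ℕ.+_) (count-++ b xs ys)) (sym (ℕₚ.+-assoc (if does (x ℕₚ.≟ b) then 1 else 0) _ _))

count-replicate-≡ : ∀ b ℓ → count b (replicate ℓ b) ≡ ℓ
count-replicate-≡ b zero    = refl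
count-replicate-≡ b (suc ℓ) = cong₂ _+_ (if-yes (b ℕₚ.≟ b) refl) (count-replicate-≡ b ℓ)

count-replicate-≢ : ∀ {a b} ℓ → a ≢ b → count b (replicate ℓ a) ≡ 0
count-replicate-≢ zero    a≢b = refl
count-replicate-≢ {a} {b} (suc ℓ) a≢b = cong₂ _+_ (if-no (a ℕₚ.≟ b) a≢b) (count-replicate-≢ ℓ a≢b)

count-below : ∀ {a b} Γ → b < a → count b (labels a Γ) ≡ 0
count-below []                _   = refl
count-below {a} {b} ((_ , ℓ) ∷ Γ) b<a = trans (count-++ b (replicate ℓ a) _)
  (cong₂ _+_ (count-replicate-≢ ℓ (ℕₚ.<⇒≢ b<a ∘ sym)) (count-below Γ (ℕₚ.m<n⇒m<1+n b<a)))

count-here : ∀ a κ ℓ Γ → count a (labels a ((κ , ℓ) ∷ Γ)) ≡ ℓ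
count-here a κ ℓ Γ = trans (count-++ a (replicate ℓ a) _)
  (trans (cong₂ _+_ (count-replicate-≡ a ℓ) (count-below Γ (ℕₚ.n<1+n a))) (ℕₚ.+-identityʳ ℓ))

count-there : ∀ {a b} κ ℓ Γ → a < b → count b (labels a ((κ , ℓ) ∷ Γ)) ≡ count b (labels (suc a) Γ)
count-there {a} {b} κ ℓ Γ a<b = trans (count-++ b (replicate ℓ a) _) (cong (ℕ._+ count b (labels (suc a) Γ)) (count-replicate-≢ ℓ (ℕₚ.<⇒≢ a<b)))

HasSizes : ℕ → List (Kind × ℕ) → Vec ℕ n → Set
HasSizes a []            f = ⊤
HasSizes a ((_ , ℓ) ∷ Γ) f = class f a ≡ ℓ × HasSizes (suc a) Γ f

hasSizes? : ∀ a Γ (f : Vec ℕ n) → Dec (HasSizes a Γ f)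
hasSizes? a []            f = yes tt
hasSizes? a ((_ , ℓ) ∷ Γ) f = (class f a ℕₚ.≟ ℓ) ×-dec hasSizes? (suc a) Γ f

hasSizes⇒count : ∀ a Γ (f : Vec ℕ n) → HasSizes a Γ f → ∀ {b} → a ≤ b → b < a + length Γ → class f b ≡ count b (labels a Γ)
hasSizes⇒count a []            f _        a≤b b< = contradiction (ℕₚ.<-≤-trans b< (ℕₚ.≤-trans (ℕₚ.≤-reflexive (ℕₚ.+-identityʳ a)) a≤b)) (ℕₚ.<-irrefl refl)
hasSizes⇒count a ((κ , ℓ) ∷ Γ) f (eq , rest) {b} a≤b b< with ℕₚ.m≤n⇒m<n∨m≡n a≤b
... | inj₂ refl = trans eq (sym (count-here a κ ℓ Γ))
... | inj₁ a<b  = trans (hasSizes⇒count (suc a) Γ f rest a<b (subst (b <_) (ℕₚ.+-suc a (length Γ)) b<)) (sym (count-there κ ℓ Γ a<b))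

count⇒hasSizes : ∀ a Γ (f : Vec ℕ n) → (∀ b → a ≤ b → class f b ≡ count b (labels a Γ)) → HasSizes a Γ f
count⇒hasSizes a []            f eq = tt
count⇒hasSizes a ((κ , ℓ) ∷ Γ) f eq = trans (eq a ℕₚ.≤-refl) (count-here a κ ℓ Γ) ,
  count⇒hasSizes (suc a) Γ f (λ b a<b → trans (eq b (ℕₚ.<⇒≤ a<b)) (count-there κ ℓ Γ a<b))

-- An empty power sum block has the same weight as an empty homogeneous one, for labellings and for
-- words alike. Admitting it here is what lets the recursion terminate.
Flat : List (Kind × ℕ) → Set
Flat = All (λ (κ , ℓ) → κ ≡ hom ⊎ ℓ ≡ 0)

weight-flat : (y : Fin n → Fin n) (f : Vec ℕ n) (a : ℕ) {Γ : List (Kind × ℕ)} → Flat Γ →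
  weight y f a Γ ≡ 𝟙 (hasSizes? a Γ f)
weight-flat y f a {[]} [] = sym (𝟙-yes (yes tt) tt)
weight-flat y f a {(κ , ℓ) ∷ Γ} (flat ∷ rest) = trans
  (cong₂ ℤ._*_ (trans (cong (𝟙 (class f a ℕₚ.≟ ℓ) ℤ.*_) (trivial κ flat)) (ℤₚ.*-identityʳ (𝟙 (class f a ℕₚ.≟ ℓ)))) (weight-flat y f (suc a) rest))
  (sym (𝟙-× (class f a ℕₚ.≟ ℓ) (hasSizes? (suc a) Γ f)))
  where
  trivial : ∀ κ → κ ≡ hom ⊎ ℓ ≡ 0 → generators y f a κ ℓ ≡ + 1
  trivial hom _           = refl
  trivial pow (inj₂ refl) = refl

Blocks : List (Kind × ℕ) → List ℕ → Set
Blocks []            ws = ⊤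
Blocks ((_ , ℓ) ∷ Γ) ws = AllPairs _<_ (take ℓ ws) × Blocks Γ (drop ℓ ws)

blocks? : ∀ Γ ws → Dec (Blocks Γ ws)
blocks? []            ws = yes tt
blocks? ((_ , ℓ) ∷ Γ) ws = allPairs? ℕₚ._<?_ (take ℓ ws) ×-dec blocks? Γ (drop ℓ ws)

wordWeight-flat : ∀ {Γ} → Flat Γ → ∀ ws → wordWeight Γ ws ≡ 𝟙 (blocks? Γ ws)
wordWeight-flat {[]} [] ws = sym (𝟙-yes (yes tt) tt)
wordWeight-flat {(κ , ℓ) ∷ Γ} (flat ∷ rest) ws = trans (cong₂ ℤ._*_ (block κ flat) (wordWeight-flat rest (drop ℓ ws)))
  (sym (𝟙-× (allPairs? ℕₚ._<?_ (take ℓ ws)) (blocks? Γ (drop ℓ ws))))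
  where
  block : ∀ κ → κ ≡ hom ⊎ ℓ ≡ 0 → blockWeight κ (take ℓ ws) ≡ inc (take ℓ ws)
  block hom _           = refl
  block pow (inj₂ refl) = sym inc-[]

blocks⇒increasing : ∀ a Γ ws → length ws ≡ total Γ → Blocks Γ ws →
  ∀ {i i′} → i < i′ → i′ < total Γ → nth 0 (labels a Γ) i ≡ nth 0 (labels a Γ) i′ → nth 0 ws i < nth 0 ws i′
blocks⇒increasing a ((κ , ℓ) ∷ Γ) ws len (first , rest) {i} {i′} i<i′ lt eq with side ℓ i | side ℓ i′
... | before p | before p′ = subst (λ (a , b) → a < b) (cong₂ _,_ (nth-take 0 ℓ ws p) (nth-take 0 ℓ ws p′))
        (allPairs⇒nth (take ℓ ws) first i<i′ (subst (i′ <_) (sym len′) p′))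
  where
  len′ : length (take ℓ ws) ≡ ℓ
  len′ = trans (Listₚ.length-take ℓ ws) (ℕₚ.m≤n⇒m⊓n≡m (subst (ℓ ≤_) (sym len) (ℕₚ.m≤m+n ℓ (total Γ))))
... | before p | after j′ refl = contradiction
        (trans (sym (nth-before 0 a ℓ (labels (suc a) Γ) p)) (trans eq (nth-after 0 a ℓ (labels (suc a) Γ) j′)))
        (ℕₚ.<⇒≢ (proj₁ (labels-bounds (suc a) Γ (ℕₚ.+-cancelˡ-< ℓ _ _ lt))))
... | after j refl | before p = contradiction (ℕₚ.<-trans i<i′ p) (ℕₚ.m+n≮m ℓ j)
... | after j refl | after j′ refl = subst (λ (a , b) → a < b) (cong₂ _,_ (nth-drop 0 ℓ ws j) (nth-drop 0 ℓ ws j′))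
        (blocks⇒increasing (suc a) Γ (drop ℓ ws)
          (trans (Listₚ.length-drop ℓ ws) (trans (cong (_∸ ℓ) len) (ℕₚ.m+n∸m≡n ℓ (total Γ)))) rest
          (ℕₚ.+-cancelˡ-< ℓ _ _ i<i′) (ℕₚ.+-cancelˡ-< ℓ _ _ lt)
          (trans (sym (nth-after 0 a ℓ (labels (suc a) Γ) j)) (trans eq (nth-after 0 a ℓ (labels (suc a) Γ) j′))))

increasing⇒blocks : ∀ a Γ ws → length ws ≡ total Γ →
  (∀ {i i′} → i < i′ → i′ < total Γ → nth 0 (labels a Γ) i ≡ nth 0 (labels a Γ) i′ → nth 0 ws i < nth 0 ws i′) → Blocks Γ ws
increasing⇒blocks a []            ws len h = tt
increasing⇒blocks a ((κ , ℓ) ∷ Γ) ws len h =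
  nth⇒allPairs (take ℓ ws) (λ {i} {i′} i<i′ lt → let p′ = subst (i′ <_) len′ lt ; p = ℕₚ.<-trans i<i′ p′ in
    subst (λ (a , b) → a < b) (sym (cong₂ _,_ (nth-take 0 ℓ ws p) (nth-take 0 ℓ ws p′)))
      (h i<i′ (ℕₚ.<-≤-trans p′ (ℕₚ.m≤m+n ℓ (total Γ)))
        (trans (nth-before 0 a ℓ (labels (suc a) Γ) p) (sym (nth-before 0 a ℓ (labels (suc a) Γ) p′))))) ,
  increasing⇒blocks (suc a) Γ (drop ℓ ws)
    (trans (Listₚ.length-drop ℓ ws) (trans (cong (_∸ ℓ) len) (ℕₚ.m+n∸m≡n ℓ (total Γ))))
    (λ {i} {i′} i<i′ lt eq → subst (λ (a , b) → a < b) (sym (cong₂ _,_ (nth-drop 0 ℓ ws i) (nth-drop 0 ℓ ws i′)))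
      (h (ℕₚ.+-monoʳ-< ℓ i<i′) (ℕₚ.+-monoʳ-< ℓ lt)
        (trans (nth-after 0 a ℓ (labels (suc a) Γ) i) (trans eq (sym (nth-after 0 a ℓ (labels (suc a) Γ) i′))))))
  where
  len′ : length (take ℓ ws) ≡ ℓ
  len′ = trans (Listₚ.length-take ℓ ws) (ℕₚ.m≤n⇒m⊓n≡m (subst (ℓ ≤_) (sym len) (ℕₚ.m≤m+n ℓ (total Γ))))

entries : Vec (Fin n) n → List ℕ
entries v = map toℕ (toList v)

length-entries : (v : Vec (Fin n) n) → length (entries v) ≡ n
length-entries v = trans (Listₚ.length-map toℕ (toList v)) (Vecₚ.length-toList v)

nth-entries : (v : Vec (Fin n) n) (x : Fin n) → nth 0 (entries v) (toℕ x) ≡ toℕ (v ! x)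
nth-entries v x = trans (cong (λ l → nth 0 l (toℕ x)) (sym (Vecₚ.toList-map toℕ v)))
  (trans (nth-toList 0 (Vec.map toℕ v) x) (Vecₚ.lookup-map x toℕ v))

-- A block p_ℓ is preceded by ℓ empty slots that receive the h's produced by Newton's recursion.
slots : List ℕ → List (Kind × ℕ)
slots []      = []
slots (ℓ ∷ γ) = replicate ℓ (hom , 0) ++ (pow , ℓ) ∷ slots γ

-- From complete homogeneous to power sum blocks.

module Characters {n : ℕ} (κ M : ℕ) (ε : ℕ → Bool) (S : List Bool) (S-length : length S ≡ n) where

  open Newton {n} κ M ε public

  sgn : Fin n → Bool
  sgn x = nth false S (toℕ x)

  Torsion : Vec (Fin n) n → Set
  Torsion v = (∀ x → iter (v !_) k x ≡ x) × (∀ x → parity (v !_) sgn k x ≡ false)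

  torsion? : ∀ v → Dec (Torsion v)
  torsion? v = Finₚ.all? (λ x → iter (v !_) k x Finₚ.≟ x) ×-dec Finₚ.all? (λ x → parity (v !_) sgn k x Boolₚ.≟ false)

  Φ : List (Kind × ℕ) → ℤ
  Φ Γ = ∑ (perms n) (λ v → 𝟙 (torsion? v) ℤ.* wordWeight Γ (entries v))

  N! : ℤ
  N! = ∑ (perms n) (λ _ → + 1)

  -- Two invariants of Newton's recursion: the number of slots, which bounds the labels, and the
  -- sequence of signs read along the sorted labelling.
  Fits : List (Kind × ℕ) → Set
  Fits Γ = length Γ ≡ M × map ε (labels 0 Γ) ≡ S

  fits⇒total : ∀ {Γ} → Fits Γ → total Γ ≡ n
  fits⇒total {Γ} (_ , eq) = trans (sym (length-labels 0 Γ))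
    (trans (sym (Listₚ.length-map ε (labels 0 Γ))) (trans (cong length eq) S-length))

  -- For flat sequences the weight of a labelling is a condition on class sizes and the weight of a
  -- word says that its blocks increase. These are the two sides of the Gessel-Reutenauer bijection,
  -- with the sorted labelling as `f₀`.
  flat-case : ∀ Γ → Flat Γ → Fits Γ → 𝔸 Γ ≡ N! ℤ.* Φ Γ
  flat-case Γ flat fits@(len , sgns) = begin
    𝔸 Γ
      ≡⟨ ∑-cong (perms n) (λ u → ∑-cong labellings (λ f → trans (cong (𝟙 (admissible? u f) ℤ.*_) (weight-flat (iter (u !_) k) f 0 flat))
           (trans (sym (𝟙-× (admissible? u f) (hasSizes? 0 Γ f)))
             (𝟙-cong (admissible? u f ×-dec hasSizes? 0 Γ f) (GR.labelled? (u , f)) (λ ((a , b) , c) → a , b , c) (λ (a , b , c) → (a , b) , c))))) ⟩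
    ∑ (perms n) (λ u → ∑ labellings (λ f → 𝟙 (GR.labelled? (u , f))))
      ≡⟨ GR.theorem ⟩
    N! ℤ.* ∑ (perms n) (λ v → 𝟙 (GR.root? v))
      ≡⟨ cong (N! ℤ.*_) (∑-cong (perms n) (λ v → trans
           (𝟙-cong (GR.root? v) (torsion? v ×-dec blocks? Γ (entries v)) (to v) (from v))
           (trans (𝟙-× (torsion? v) (blocks? Γ (entries v))) (cong (𝟙 (torsion? v) ℤ.*_) (sym (wordWeight-flat flat (entries v))))))) ⟩
    N! ℤ.* Φ Γ ∎
    where
    open ≡-Reasoning
    tot : total Γ ≡ n
    tot = fits⇒total {Γ} fits
    f₀ : Vec ℕ n
    f₀ = tabulate (λ x → nth 0 (labels 0 Γ) (toℕ x))
    f₀! : ∀ x → f₀ ! x ≡ nth 0 (labels 0 Γ) (toℕ x)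
    f₀! = Vecₚ.lookup∘tabulate (λ x → nth 0 (labels 0 Γ) (toℕ x))
    x<tot : ∀ (x : Fin n) → toℕ x < total Γ
    x<tot x = subst (toℕ x <_) (sym tot) (Finₚ.toℕ<n x)
    f₀<M : ∀ x → f₀ ! x < M
    f₀<M x rewrite f₀! x | sym len = proj₂ (labels-bounds 0 Γ (x<tot x))
    f₀-sorted : Sorted _≤_ f₀
    f₀-sorted x y x<y rewrite f₀! x | f₀! y = labels-mono 0 Γ x<y (x<tot y)
    class-f₀ : ∀ b → class f₀ b ≡ count b (labels 0 Γ)
    class-f₀ b = trans (#-cong (λ x → f₀ ! x ℕₚ.≟ b) (λ x → nth 0 (labels 0 Γ) (toℕ x) ℕₚ.≟ b)
        (λ x e → trans (sym (f₀! x)) e) (λ x e → trans (f₀! x) e))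
      (#-nth b (labels 0 Γ) (trans (length-labels 0 Γ) tot))
    sizes⇒ : ∀ f → (∀ x → f ! x < M) → HasSizes 0 Γ f → ∀ a → class f a ≡ class f₀ a
    sizes⇒ f f<M hs a with a ℕₚ.<? M
    ... | yes a<M = trans (hasSizes⇒count 0 Γ f hs z≤n (subst (a <_) (sym len) a<M)) (sym (class-f₀ a))
    -- Neither labelling takes values beyond the bound, so both classes are empty.
    ... | no  a≮M = trans (#-none (λ x → f ! x ℕₚ.≟ a) (λ x e → a≮M (subst (_< M) e (f<M x))))
                     (sym (#-none (λ x → f₀ ! x ℕₚ.≟ a) (λ x e → a≮M (subst (_< M) e (f₀<M x)))))
    ⇒sizes : ∀ f → (∀ a → class f a ≡ class f₀ a) → HasSizes 0 Γ f
    ⇒sizes f eq = count⇒hasSizes 0 Γ f (λ b _ → trans (eq b) (class-f₀ b))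
    module GR = GesselReutenauer κ M ε f₀ f₀-sorted f₀<M (HasSizes 0 Γ) (hasSizes? 0 Γ) sizes⇒ ⇒sizes
    sgn-f₀ : ∀ x → ε (f₀ ! x) ≡ sgn x
    sgn-f₀ x = trans (cong ε (f₀! x)) (trans
      (sym (nth-map ε 0 false (labels 0 Γ) (subst (toℕ x <_) (sym (length-labels 0 Γ)) (x<tot x))))
      (cong (λ l → nth false l (toℕ x)) sgns))
    word-length : ∀ v → length (entries v) ≡ total Γ
    word-length v = trans (length-entries v) (sym tot)
    to : ∀ v → GR.Root v → Torsion v × Blocks Γ (entries v)
    to v ((root , good) , increasing) = (root , λ x → trans (sym (parity-cong (v !_) sgn-f₀ k x)) (good x)) ,
      increasing⇒blocks 0 Γ (entries v) (word-length v) go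
      where
      go : ∀ {i i′} → i < i′ → i′ < total Γ → nth 0 (labels 0 Γ) i ≡ nth 0 (labels 0 Γ) i′ → nth 0 (entries v) i < nth 0 (entries v) i′
      go {i} {i′} i<i′ lt eq = subst (λ (a , b) → a < b) (cong₂ _,_ (at lt₁) (at lt₂))
        (increasing (fromℕ< lt₁) (fromℕ< lt₂) (subst (λ (a , b) → a < b) (sym (cong₂ _,_ (Finₚ.toℕ-fromℕ< lt₁) (Finₚ.toℕ-fromℕ< lt₂))) i<i′)
          (trans (lab lt₁) (trans eq (sym (lab lt₂)))))
        where
        lt₂ : i′ < n
        lt₂ = subst (i′ <_) tot lt
        lt₁ : i < n
        lt₁ = ℕₚ.<-trans i<i′ lt₂
        at : ∀ {i} (lt : i < n) → toℕ (v ! fromℕ< lt) ≡ nth 0 (entries v) i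
        at lt = trans (sym (nth-entries v (fromℕ< lt))) (cong (nth 0 (entries v)) (Finₚ.toℕ-fromℕ< lt))
        lab : ∀ {i} (lt : i < n) → f₀ ! fromℕ< lt ≡ nth 0 (labels 0 Γ) i
        lab lt = trans (f₀! (fromℕ< lt)) (cong (nth 0 (labels 0 Γ)) (Finₚ.toℕ-fromℕ< lt))
    from : ∀ v → Torsion v × Blocks Γ (entries v) → GR.Root v
    from v ((root , good) , blocks) = (root , λ x → trans (parity-cong (v !_) sgn-f₀ k x) (good x)) ,
      λ x y x<y eq → subst (λ (a , b) → a < b) (cong₂ _,_ (nth-entries v x) (nth-entries v y))
        (blocks⇒increasing 0 Γ (entries v) (word-length v) blocks x<y (x<tot y)
          (trans (sym (f₀! x)) (trans eq (f₀! y))))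

  -- All slots reserved for a block carry the sign of that block, so letters can move between them
  -- without changing the sign sequence.
  Slotted : ℕ → List ℕ → Set
  Slotted a []      = ⊤
  Slotted a (ℓ ∷ γ) = (∀ i → i < ℓ → ε (a + i) ≡ ε (a + ℓ)) × Slotted (suc (a + ℓ)) γ

  module Slot (pre : List (Kind × ℕ)) (r : ℕ) (post : List (Kind × ℕ)) where

    parts : ℕ → ℕ → List (Kind × ℕ)
    parts p q = pre ++ (hom , p) ∷ replicate r (hom , 0) ++ (pow , q) ∷ post

    length-parts : ∀ p q → length (parts p q) ≡ length pre + suc (r + suc (length post))
    length-parts p q = trans (Listₚ.length-++ pre) (cong (λ m → length pre + suc m)
      (trans (Listₚ.length-++ (replicate r (hom , 0))) (cong (ℕ._+ suc (length post)) (Listₚ.length-replicate r))))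

    signs : ε (length pre) ≡ ε (suc (length pre + r)) → ∀ p q → map ε (labels 0 (parts p q)) ≡
      map ε (labels 0 pre) ++ replicate (p + q) (ε (suc (length pre + r))) ++ map ε (labels (suc (suc (length pre + r))) post)
    signs same p q = begin
      map ε (labels 0 (parts p q))
        ≡⟨ cong (map ε) (trans (labels-++ 0 pre _) (cong (λ l → labels 0 pre ++ replicate p j ++ l)
             (trans (labels-++ (suc j) (replicate r (hom , 0)) _) (cong₂ _++_ (labels-empty (suc j) r)
               (cong (λ m → labels (suc (j + m)) ((pow , q) ∷ post)) (Listₚ.length-replicate r)))))) ⟩
      map ε (labels 0 pre ++ replicate p j ++ replicate q j′ ++ labels (suc j′) post)
        ≡⟨ trans (Listₚ.map-++ ε (labels 0 pre) _) (cong (map ε (labels 0 pre) ++_)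
             (trans (Listₚ.map-++ ε (replicate p j) _) (cong₂ _++_ (Listₚ.map-replicate ε p j)
               (trans (Listₚ.map-++ ε (replicate q j′) _) (cong (_++ map ε (labels (suc j′) post)) (Listₚ.map-replicate ε q j′)))))) ⟩
      map ε (labels 0 pre) ++ replicate p (ε j) ++ replicate q (ε j′) ++ map ε (labels (suc j′) post)
        ≡⟨ cong (λ b → map ε (labels 0 pre) ++ replicate p b ++ replicate q (ε j′) ++ map ε (labels (suc j′) post)) same ⟩
      map ε (labels 0 pre) ++ replicate p (ε j′) ++ replicate q (ε j′) ++ map ε (labels (suc j′) post)
        ≡⟨ cong (map ε (labels 0 pre) ++_) (trans (sym (Listₚ.++-assoc (replicate p (ε j′)) _ _))
             (cong (_++ map ε (labels (suc j′) post)) (merge p))) ⟩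
      map ε (labels 0 pre) ++ replicate (p + q) (ε j′) ++ map ε (labels (suc j′) post) ∎
      where
      open ≡-Reasoning
      j  = length pre
      j′ = suc (j + r)
      merge : ∀ p → replicate p (ε j′) ++ replicate q (ε j′) ≡ replicate (p + q) (ε j′)
      merge zero    = refl
      merge (suc p) = cong (_ ∷_) (merge p)

    fits-parts : ε (length pre) ≡ ε (suc (length pre + r)) → ∀ {p q p′ q′} → p + q ≡ p′ + q′ →
      Fits (parts p q) → Fits (parts p′ q′)
    fits-parts same {p} {q} {p′} {q′} eq (len , sgns) =
      trans (length-parts p′ q′) (trans (sym (length-parts p q)) len) ,
      trans (signs same p′ q′) (trans (cong (λ m → map ε (labels 0 pre) ++ replicate m (ε (suc (length pre + r))) ++ map ε (labels (suc (suc (length pre + r))) post)) (sym eq)) (trans (sym (signs same p q)) sgns))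

    newton-Φ : ∀ ℓ → Fits (parts 0 ℓ) → + ℓ ℤ.* Φ (parts ℓ 0) ≡ ∑ (upTo ℓ) (λ p → Φ (parts p (ℓ ∸ p)))
    newton-Φ ℓ fits = begin
      + ℓ ℤ.* Φ (parts ℓ 0)
        ≡⟨ ∑-*ˡ (perms n) (+ ℓ) _ ⟨
      ∑ (perms n) (λ v → + ℓ ℤ.* (𝟙 (torsion? v) ℤ.* wordWeight (parts ℓ 0) (entries v)))
        ≡⟨ ∑-cong (perms n) (λ v → trans (swap³ (+ ℓ) (𝟙 (torsion? v)) _)
             (trans (cong (𝟙 (torsion? v) ℤ.*_) (newton-word pre r post ℓ (entries v) (enough v))) (sym (∑-*ˡ (upTo ℓ) (𝟙 (torsion? v)) _)))) ⟩
      ∑ (perms n) (λ v → ∑ (upTo ℓ) (λ p → 𝟙 (torsion? v) ℤ.* wordWeight (parts p (ℓ ∸ p)) (entries v)))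
        ≡⟨ ∑-swap (perms n) (upTo ℓ) _ ⟩
      ∑ (upTo ℓ) (λ p → Φ (parts p (ℓ ∸ p))) ∎
      where
      open ≡-Reasoning
      swap³ : ∀ a b c → a ℤ.* (b ℤ.* c) ≡ b ℤ.* (a ℤ.* c)
      swap³ = solve-∀
      total-++ : ∀ Γ Δ → total (Γ ++ Δ) ≡ total Γ + total Δ
      total-++ []            Δ = refl
      total-++ ((_ , m) ∷ Γ) Δ = trans (cong (m ℕ.+_) (total-++ Γ Δ)) (sym (ℕₚ.+-assoc m _ _))
      total-empty : ∀ r Δ → total (replicate r (hom , 0) ++ Δ) ≡ total Δ
      total-empty zero    Δ = refl
      total-empty (suc r) Δ = total-empty r Δ
      enough : ∀ v → total pre + ℓ ≤ length (entries v)
      enough v = subst (total pre + ℓ ≤_) (sym (trans (length-entries v) (sym (fits⇒total {parts 0 ℓ} fits))))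
        (subst (total pre + ℓ ≤_) (sym (trans (total-++ pre _) (cong (total pre ℕ.+_) (total-empty r ((pow , ℓ) ∷ post)))))
          (ℕₚ.+-monoʳ-≤ (total pre) (ℕₚ.m≤m+n ℓ (total post))))

  Claim : List (Kind × ℕ) → Set
  Claim Γ = Fits Γ → 𝔸 Γ ≡ N! ℤ.* Φ Γ

  Claim-cong : ∀ {Γ Δ} → Γ ≡ Δ → Claim Γ → Claim Δ
  Claim-cong refl c = c

  -- Newton's identity is solved for its term p = 0, the only one with a power sum of full size ℓ,
  -- and its coefficient is 1. Every other term puts h_p into the first empty slot and leaves r - 1
  -- slots for a power sum of size ℓ - p, so `ℓ ≤ r` persists and the number of slots is always
  -- sufficient.
  slot-step : ∀ L post → (∀ pre → Flat pre → length pre ≡ L → Claim (pre ++ post)) →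
    ∀ r ℓ pre → ℓ ≤ r → Flat pre → suc (length pre + r) ≡ L → (∀ i → i < r → ε (length pre + i) ≡ ε (length pre + r)) →
    Claim (pre ++ replicate r (hom , 0) ++ (pow , ℓ) ∷ post)
  slot-step L post base = go
    where
    flat-replicate : ∀ r → Flat (replicate r (hom , 0))
    flat-replicate zero    = []
    flat-replicate (suc r) = inj₁ refl ∷ flat-replicate r

    -- Once the power sum is empty, everything up to it is flat, and the remaining blocks are
    -- covered by `base`.
    closing : ∀ pre X → Flat pre → Flat X → suc (length pre + length X) ≡ L → Claim (pre ++ X ++ (pow , 0) ∷ post)
    closing pre X flat flatX len = Claim-cong
      (trans (Listₚ.++-assoc pre _ post) (cong (pre ++_) (Listₚ.++-assoc X _ post)))
      (base (pre ++ X ++ (pow , 0) ∷ []) (Allₚ.++⁺ flat (Allₚ.++⁺ flatX (inj₂ refl ∷ [])))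
        (trans (Listₚ.length-++ pre) (trans (cong (length pre ℕ.+_) (trans (Listₚ.length-++ X) (ℕₚ.+-comm (length X) 1)))
          (trans (ℕₚ.+-suc (length pre) (length X)) len))))

    solve-for : ∀ l N a a′ b φ φ′ β → l ℤ.* b ≡ a ℤ.+ a′ → l ℤ.* β ≡ φ ℤ.+ φ′ → b ≡ N ℤ.* β → a′ ≡ N ℤ.* φ′ → a ≡ N ℤ.* φ
    solve-for l N a a′ b φ φ′ β e₁ e₂ refl refl = begin
      a ≡⟨ add a (N ℤ.* φ′) ⟩
      (a ℤ.+ N ℤ.* φ′) ℤ.- N ℤ.* φ′ ≡⟨ cong (ℤ._- N ℤ.* φ′) e₁ ⟨
      l ℤ.* (N ℤ.* β) ℤ.- N ℤ.* φ′ ≡⟨ pull l N β φ′ ⟩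
      N ℤ.* (l ℤ.* β ℤ.- φ′) ≡⟨ cong (λ s → N ℤ.* (s ℤ.- φ′)) e₂ ⟩
      N ℤ.* ((φ ℤ.+ φ′) ℤ.- φ′) ≡⟨ cong (N ℤ.*_) (add φ φ′) ⟨
      N ℤ.* φ ∎
      where
      open ≡-Reasoning
      add : ∀ a b → a ≡ (a ℤ.+ b) ℤ.- b
      add = solve-∀
      pull : ∀ l N β φ → l ℤ.* (N ℤ.* β) ℤ.- N ℤ.* φ ≡ N ℤ.* (l ℤ.* β ℤ.- φ)
      pull = solve-∀

    go : ∀ r ℓ pre → ℓ ≤ r → Flat pre → suc (length pre + r) ≡ L → (∀ i → i < r → ε (length pre + i) ≡ ε (length pre + r)) →
      Claim (pre ++ replicate r (hom , 0) ++ (pow , ℓ) ∷ post)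
    go r zero pre ℓ≤r flat len same = closing pre (replicate r (hom , 0)) flat (flat-replicate r)
      (trans (cong (λ m → suc (length pre + m)) (Listₚ.length-replicate r)) len)
    go (suc r) (suc ℓ) pre (s≤s ℓ≤r) flat len same fits =
      solve-for (+ suc ℓ) N! _ (∑ (upTo ℓ) (λ p → 𝔸 (parts (suc p) (ℓ ∸ p)))) (𝔸 (parts (suc ℓ) 0))
        _ (∑ (upTo ℓ) (λ p → Φ (parts (suc p) (ℓ ∸ p)))) (Φ (parts (suc ℓ) 0))
        (trans (newton-𝔸 j′<M ε-same) (∑-upTo-suc ℓ (λ p → 𝔸 (parts p (suc ℓ ∸ p)))))
        (trans (newton-Φ (suc ℓ) fits) (∑-upTo-suc ℓ (λ p → Φ (parts p (suc ℓ ∸ p)))))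
        (closing pre ((hom , suc ℓ) ∷ replicate r (hom , 0)) flat (inj₁ refl ∷ flat-replicate r)
          (trans (cong (λ m → suc (length pre + suc m)) (Listₚ.length-replicate r)) len)
          (fits-parts same₀ (sym (ℕₚ.+-identityʳ (suc ℓ))) fits))
        (trans (∑-cong∈ (upTo ℓ) (λ p∈ → smaller _ (∈ₚ.∈-upTo⁻ p∈))) (∑-*ˡ (upTo ℓ) N! (λ p → Φ (parts (suc p) (ℓ ∸ p)))))
      where
      open Slot pre r post
      open Recursion pre (replicate r (hom , 0)) post (suc ℓ) using (j′; newton-𝔸)
      j′≡ : j′ ≡ suc (length pre + r)
      j′≡ = cong (λ m → suc (length pre + m)) (Listₚ.length-replicate r)
      same₀ : ε (length pre) ≡ ε (suc (length pre + r))
      same₀ = trans (cong ε (sym (ℕₚ.+-identityʳ (length pre)))) (trans (same 0 (s≤s z≤n)) (cong ε (ℕₚ.+-suc (length pre) r)))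
      ε-same : ε (length pre) ≡ ε j′
      ε-same = trans same₀ (cong ε (sym j′≡))
      j′<M : j′ < M
      j′<M = subst (_< M) (sym j′≡) (subst (suc (length pre + r) <_) (trans (sym (length-parts 0 (suc ℓ))) (proj₁ fits))
        (subst (_< length pre + suc (r + suc (length post))) (ℕₚ.+-suc (length pre) r)
          (ℕₚ.+-monoʳ-< (length pre) (s≤s (ℕₚ.m<m+n r (s≤s z≤n))))))
      smaller : ∀ p → p < ℓ → 𝔸 (parts (suc p) (ℓ ∸ p)) ≡ N! ℤ.* Φ (parts (suc p) (ℓ ∸ p))
      smaller p p<ℓ = Claim-cong (Listₚ.++-assoc pre ((hom , suc p) ∷ []) _)
        (go r (ℓ ∸ p) (pre ++ (hom , suc p) ∷ []) (ℕₚ.≤-trans (ℕₚ.m∸n≤m ℓ p) ℓ≤r) (Allₚ.++⁺ flat (inj₁ refl ∷ []))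
          (trans (cong suc (shift r)) len)
          (λ i i<r → trans (cong ε (shift i)) (trans (same (suc i) (s≤s i<r)) (cong ε (sym (shift r))))))
        (fits-parts same₀ (cong suc (sym (ℕₚ.m+[n∸m]≡n (ℕₚ.<⇒≤ p<ℓ)))) fits)
        where
        shift : ∀ i → length (pre ++ (hom , suc p) ∷ []) + i ≡ length pre + suc i
        shift i = trans (cong (ℕ._+ i) (Listₚ.length-++ pre)) (ℕₚ.+-assoc (length pre) 1 i)

  slots-claim : ∀ γ pre → Flat pre → Slotted (length pre) γ → Claim (pre ++ slots γ)
  slots-claim []      pre flat _ fits = flat-case (pre ++ []) (subst Flat (sym (Listₚ.++-identityʳ pre)) flat) fits
  slots-claim (ℓ ∷ γ) pre flat (same , slotted) = slot-step (suc (length pre + ℓ)) (slots γ)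
    (λ pre′ flat′ len → slots-claim γ pre′ flat′ (subst (λ a → Slotted a γ) (sym len) slotted))
    ℓ ℓ pre ℕₚ.≤-refl flat refl same

  power-sums : ∀ γ → Slotted 0 γ → Fits (slots γ) → 𝔸 (slots γ) ≡ N! ℤ.* Φ (slots γ)
  power-sums γ slotted = slots-claim γ [] [] slotted

-- Roots of the product of the block cycles.

start : (γ : List ℕ) → Fin (length γ) → ℕ
start (ℓ ∷ γ) zero    = 0
start (ℓ ∷ γ) (suc i) = ℓ + start γ i

start-bound : ∀ γ i {o} → o < List.lookup γ i → start γ i + o < sum γ
start-bound (ℓ ∷ γ) zero    lt = ℕₚ.<-≤-trans lt (ℕₚ.m≤m+n ℓ (sum γ))
start-bound (ℓ ∷ γ) (suc i) {o} lt = subst (_< ℓ + sum γ) (sym (ℕₚ.+-assoc ℓ (start γ i) o))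
  (ℕₚ.+-monoʳ-< ℓ (start-bound γ i lt))

locate : ∀ γ {x} → x < sum γ → ∃ λ i → ∃ λ o → x ≡ start γ i + o × o < List.lookup γ i
locate (ℓ ∷ γ) {x} lt with side ℓ x
... | before p      = zero , x , refl , p
... | after x′ refl = let (i , o , eq , lt′) = locate γ (ℕₚ.+-cancelˡ-< ℓ _ _ lt) in
  suc i , o , trans (cong (ℓ ℕ.+_) eq) (sym (ℕₚ.+-assoc ℓ (start γ i) o)) , lt′

locate-unique : ∀ γ i i′ {o o′} → o < List.lookup γ i → o′ < List.lookup γ i′ → start γ i + o ≡ start γ i′ + o′ → i ≡ i′ × o ≡ o′
locate-unique (ℓ ∷ γ) zero    zero     p p′ eq = refl , eq
locate-unique (ℓ ∷ γ) zero    (suc i′) {o} {o′} p p′ refl = contradiction (subst (_< ℓ) (ℕₚ.+-assoc ℓ (start γ i′) o′) p) (ℕₚ.m+n≮m ℓ _)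
locate-unique (ℓ ∷ γ) (suc i) zero     {o} {o′} p p′ refl = contradiction (subst (_< ℓ) (ℕₚ.+-assoc ℓ (start γ i) o) p′) (ℕₚ.m+n≮m ℓ _)
locate-unique (ℓ ∷ γ) (suc i) (suc i′) {o} {o′} p p′ eq =
  let (e , e′) = locate-unique γ i i′ p p′ (ℕₚ.+-cancelˡ-≡ ℓ _ _
        (trans (sym (ℕₚ.+-assoc ℓ (start γ i) o)) (trans eq (ℕₚ.+-assoc ℓ (start γ i′) o′))))
  in cong suc e , e′

-- The power sum slot of a block of size ℓ follows its ℓ empty slots; hence `a + ℓ` here and
-- `suc (a + ℓ)` as the first label of the next block.
lab : ℕ → (γ : List ℕ) → Fin (length γ) → ℕ
lab a (ℓ ∷ γ) zero    = a + ℓ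
lab a (ℓ ∷ γ) (suc i) = lab (suc (a + ℓ)) γ i

lab-≥ : ∀ a γ i → a ≤ lab a γ i
lab-≥ a (ℓ ∷ γ) zero    = ℕₚ.m≤m+n a ℓ
lab-≥ a (ℓ ∷ γ) (suc i) = ℕₚ.≤-trans (ℕₚ.m≤n⇒m≤1+n (ℕₚ.m≤m+n a ℓ)) (lab-≥ (suc (a + ℓ)) γ i)

lab-head< : ∀ a ℓ γ i → a + ℓ < lab (suc (a + ℓ)) γ i
lab-head< a ℓ γ i = lab-≥ (suc (a + ℓ)) γ i

lab-injective : ∀ a γ i i′ → lab a γ i ≡ lab a γ i′ → i ≡ i′
lab-injective a (ℓ ∷ γ) zero    zero     eq = refl
lab-injective a (ℓ ∷ γ) zero    (suc i′) eq = contradiction eq (ℕₚ.<⇒≢ (lab-head< a ℓ γ i′))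
lab-injective a (ℓ ∷ γ) (suc i) zero     eq = contradiction (sym eq) (ℕₚ.<⇒≢ (lab-head< a ℓ γ i))
lab-injective a (ℓ ∷ γ) (suc i) (suc i′) eq = cong suc (lab-injective (suc (a + ℓ)) γ i i′ eq)

length-slots : ∀ ℓ γ → length (slots (ℓ ∷ γ)) ≡ ℓ + suc (length (slots γ))
length-slots ℓ γ = trans (Listₚ.length-++ (replicate ℓ (hom , 0))) (cong (ℕ._+ suc (length (slots γ))) (Listₚ.length-replicate ℓ))

lab-< : ∀ a γ i → lab a γ i < a + length (slots γ)
lab-< a (ℓ ∷ γ) zero    rewrite length-slots ℓ γ = ℕₚ.+-monoʳ-< a (ℕₚ.m<m+n ℓ (s≤s z≤n))
lab-< a (ℓ ∷ γ) (suc i) rewrite length-slots ℓ γ = subst (lab (suc (a + ℓ)) γ i <_)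
  (trans (cong suc (ℕₚ.+-assoc a ℓ _)) (trans (sym (ℕₚ.+-suc a _)) (cong (a ℕ.+_) (sym (ℕₚ.+-suc ℓ _)))))
  (lab-< (suc (a + ℓ)) γ i)

labels-slots-∷ : ∀ a ℓ γ → labels a (slots (ℓ ∷ γ)) ≡ replicate ℓ (a + ℓ) ++ labels (suc (a + ℓ)) (slots γ)
labels-slots-∷ a ℓ γ = trans (labels-++ a (replicate ℓ (hom , 0)) _) (cong₂ _++_ (labels-empty a ℓ)
  (cong (λ m → labels (a + m) ((pow , ℓ) ∷ slots γ)) (Listₚ.length-replicate ℓ)))

nth-labels-slots : ∀ a γ i {o} → o < List.lookup γ i → nth 0 (labels a (slots γ)) (start γ i + o) ≡ lab a γ i
nth-labels-slots a (ℓ ∷ γ) zero    {o} lt rewrite labels-slots-∷ a ℓ γ = nth-before 0 (a + ℓ) ℓ _ lt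
nth-labels-slots a (ℓ ∷ γ) (suc i) {o} lt rewrite labels-slots-∷ a ℓ γ | ℕₚ.+-assoc ℓ (start γ i) o =
  trans (nth-after 0 (a + ℓ) ℓ _ (start γ i + o)) (nth-labels-slots (suc (a + ℓ)) γ i lt)

least : {P : ℕ → Set} → (∀ t → Dec (P t)) → ∀ d → P d → ∃ λ d′ → P d′ × (∀ t → t < d′ → ¬ P t)
least P? zero    p = 0 , p , λ _ ()
least P? (suc d) p with P? 0
... | yes p₀ = 0 , p₀ , λ _ ()
... | no ¬p₀ = let (d′ , p′ , min) = least (P? ∘ suc) d p in
  suc d′ , p′ , λ { zero _ → ¬p₀ ; (suc t) (s≤s lt) → min t lt }

-- A class that is a single orbit has as many elements as the minimal period of its generator. This
-- converts the class sizes prescribed by a composition into cycle lengths.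
module Period {n : ℕ} (y : Fin n → Fin n) (y-inj : ∀ {a b} → y a ≡ y b → a ≡ b) (z : Fin n)
  {P : Fin n → Set} (P? : ∀ x → Dec (P x)) (into : ∀ x → Orbits.Orbit y y-inj z x → P x)
  (onto : ∀ x → P x → Orbits.Orbit y y-inj z x) where

  open Orbits y y-inj

  minimal : ∃ λ d → (iter y (suc d) z ≡ z) × (∀ t → t < d → iter y (suc t) z ≢ z)
  minimal = let (d , _ , eq) = period z in least (λ t → iter y (suc t) z Finₚ.≟ z) d eq

  d : ℕ
  d = suc (proj₁ minimal)

  returns : iter y d z ≡ z
  returns = proj₁ (proj₂ minimal)

  iter-multiple : ∀ q → iter y (q * d) z ≡ z
  iter-multiple zero    = refl
  iter-multiple (suc q) = trans (iter-+ y d (q * d) z) (trans (cong (iter y d) (iter-multiple q)) returns)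

  iter-mod : ∀ t → iter y t z ≡ iter y (t % d) z
  iter-mod t = trans (cong (λ t → iter y t z) (m≡m%n+[m/n]*n t d))
    (trans (iter-+ y (t % d) ((t / d) * d) z) (cong (iter y (t % d)) (iter-multiple (t / d))))

  distinct< : ∀ {a b} → a < b → b < d → iter y a z ≢ iter y b z
  distinct< {a} {b} a<b b<d eq with ℕₚ.m≤n⇒∃[o]m+o≡n a<b
  ... | e , refl = proj₂ (proj₂ minimal) e (ℕₚ.≤-pred (ℕₚ.≤-trans (s≤s (s≤s (ℕₚ.m≤n+m e a))) b<d))
    (sym (iter-inj a (trans eq (trans (cong (λ t → iter y t z) (sym (ℕₚ.+-suc a e))) (iter-+ y a (suc e) z)))))

  distinct : ∀ {a b} → a < d → b < d → iter y a z ≡ iter y b z → a ≡ b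
  distinct {a} {b} a<d b<d eq with ℕₚ.<-cmp a b
  ... | tri< lt _ _ = contradiction eq (distinct< lt b<d)
  ... | tri≈ _ e _  = e
  ... | tri> _ _ gt = contradiction (sym eq) (distinct< gt a<d)

  size≡d : # P? ≡ d
  size≡d = #-image P? (λ (t : Fin d) → iter y (toℕ t) z)
    (λ {i} {j} eq → Finₚ.toℕ-injective (distinct (Finₚ.toℕ<n i) (Finₚ.toℕ<n j) eq))
    (λ t → into _ (orbit-iter (orbit-refl z) (toℕ t)))
    (λ x p → let (t , eq) = onto x p ; lt = m%n<n (toℕ t) d in
      fromℕ< lt , trans (cong (λ t → iter y t z) (Finₚ.toℕ-fromℕ< lt)) (trans (sym (iter-mod (toℕ t))) eq))

parity-natural : (u u′ : Fin n → Fin n) (h : Fin n → Fin n) (s s′ : Fin n → Bool) →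
  (∀ x → h (u′ x) ≡ u (h x)) → (∀ x → s′ x ≡ s (h x)) → ∀ t x → parity u′ s′ t x ≡ parity u s t (h x)
parity-natural u u′ h s s′ eq eqs zero    x = refl
parity-natural u u′ h s s′ eq eqs (suc t) x = cong₂ _xor_ (eqs x)
  (trans (parity-natural u u′ h s s′ eq eqs t (u′ x)) (cong (parity u s t) (eq x)))

-- Choosing one generator for each block expands the product of sums in `weight` into a sum over
-- vectors of generators.
Generated : ℕ → (γ : List ℕ) → (Fin n → Fin n) → Vec ℕ n → Vec (Fin n) (length γ) → Set
Generated a []      y f []       = ⊤
Generated a (ℓ ∷ γ) y f (z ∷ zs) = HasSizes a (replicate ℓ (hom , 0)) f ×
  (class f (a + ℓ) ≡ ℓ × Cyclic y f (a + ℓ) z) × Generated (suc (a + ℓ)) γ y f zs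

generated? : ∀ a γ y (f : Vec ℕ n) zs → Dec (Generated a γ y f zs)
generated? a []      y f []       = yes tt
generated? a (ℓ ∷ γ) y f (z ∷ zs) = hasSizes? a (replicate ℓ (hom , 0)) f ×-dec
  (((class f (a + ℓ) ℕₚ.≟ ℓ) ×-dec cyclic? y f (a + ℓ) z) ×-dec generated? (suc (a + ℓ)) γ y f zs)

-- Positivity enters because an empty power sum has weight 1 although an empty class has no
-- generator.
weight-slots : ∀ a γ → All (1 ≤_) γ → (y : Fin n → Fin n) (f : Vec ℕ n) →
  weight y f a (slots γ) ≡ ∑ (allVecs (allFin n) (length γ)) (λ zs → 𝟙 (generated? a γ y f zs))
weight-slots a []      _ y f = sym (trans (ℤₚ.+-identityʳ _) (𝟙-yes (yes tt) tt))
weight-slots {n} a (suc ℓ ∷ γ) (s≤s z≤n ∷ pos) y f = begin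
  weight y f a (slots (suc ℓ ∷ γ))
    ≡⟨ weight-++ y f a (replicate (suc ℓ) (hom , 0)) _ ⟩
  weight y f a (replicate (suc ℓ) (hom , 0)) ℤ.* weight y f (a + length (replicate (suc ℓ) (hom , 0))) ((pow , suc ℓ) ∷ slots γ)
    ≡⟨ cong₂ ℤ._*_ (weight-flat y f a (flat (suc ℓ))) (cong (λ m → weight y f (a + m) ((pow , suc ℓ) ∷ slots γ)) (Listₚ.length-replicate (suc ℓ))) ⟩
  empty ℤ.* ((sized ℤ.* ∑ (allFin n) cyc) ℤ.* weight y f (suc b) (slots γ))
    ≡⟨ cong (λ s → empty ℤ.* ((sized ℤ.* ∑ (allFin n) cyc) ℤ.* s)) (weight-slots (suc b) γ pos y f) ⟩
  empty ℤ.* ((sized ℤ.* ∑ (allFin n) cyc) ℤ.* ∑ zss gen)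
    ≡⟨ shuffle empty sized _ _ ⟩
  ∑ (allFin n) cyc ℤ.* (empty ℤ.* sized ℤ.* ∑ zss gen)
    ≡⟨ ∑-*ʳ (allFin n) _ cyc ⟨
  ∑ (allFin n) (λ z → cyc z ℤ.* (empty ℤ.* sized ℤ.* ∑ zss gen))
    ≡⟨ ∑-cong (allFin n) (λ z → trans (sym (ℤₚ.*-assoc (cyc z) (empty ℤ.* sized) _)) (trans (sym (∑-*ˡ zss (cyc z ℤ.* (empty ℤ.* sized)) gen))
         (∑-cong zss (λ zs → trans (shuffle′ (cyc z) empty sized (gen zs)) (sym (brackets z zs)))))) ⟩
  ∑ (allFin n) (λ z → ∑ zss (λ zs → 𝟙 (generated? a (suc ℓ ∷ γ) y f (z ∷ zs))))
    ≡⟨ ∑-allVecs-suc (allFin n) (length γ) _ ⟨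
  ∑ (allVecs (allFin n) (suc (length γ))) (λ zs → 𝟙 (generated? a (suc ℓ ∷ γ) y f zs)) ∎
  where
  open ≡-Reasoning
  b = a + suc ℓ
  zss = allVecs (allFin n) (length γ)
  empty = 𝟙 (hasSizes? a (replicate (suc ℓ) (hom , 0)) f)
  sized = 𝟙 (class f b ℕₚ.≟ suc ℓ)
  cyc : Fin n → ℤ
  cyc z = 𝟙 (cyclic? y f b z)
  gen : Vec (Fin n) (length γ) → ℤ
  gen zs = 𝟙 (generated? (suc b) γ y f zs)
  flat : ∀ r → Flat (replicate r (hom , 0))
  flat zero    = []
  flat (suc r) = inj₁ refl ∷ flat r
  brackets : ∀ z zs → 𝟙 (generated? a (suc ℓ ∷ γ) y f (z ∷ zs)) ≡ empty ℤ.* ((sized ℤ.* cyc z) ℤ.* gen zs)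
  brackets z zs = trans (𝟙-× (hasSizes? a (replicate (suc ℓ) (hom , 0)) f) (((class f b ℕₚ.≟ suc ℓ) ×-dec cyclic? y f b z) ×-dec generated? (suc b) γ y f zs))
    (cong (empty ℤ.*_) (trans (𝟙-× ((class f b ℕₚ.≟ suc ℓ) ×-dec cyclic? y f b z) (generated? (suc b) γ y f zs))
      (cong (ℤ._* gen zs) (𝟙-× (class f b ℕₚ.≟ suc ℓ) (cyclic? y f b z)))))
  shuffle : ∀ e s c g → e ℤ.* ((s ℤ.* c) ℤ.* g) ≡ c ℤ.* (e ℤ.* s ℤ.* g)
  shuffle = solve-∀
  shuffle′ : ∀ c e s g → c ℤ.* (e ℤ.* s) ℤ.* g ≡ e ℤ.* ((s ℤ.* c) ℤ.* g)
  shuffle′ = solve-∀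

generated⇒ : ∀ a γ y (f : Vec ℕ n) zs → Generated a γ y f zs →
  ∀ i → class f (lab a γ i) ≡ List.lookup γ i × Cyclic y f (lab a γ i) (zs ! i)
generated⇒ a (ℓ ∷ γ) y f (z ∷ zs) (_ , p , _) zero    = p
generated⇒ a (ℓ ∷ γ) y f (z ∷ zs) (_ , _ , q) (suc i) = generated⇒ (suc (a + ℓ)) γ y f zs q i

⇒generated : ∀ a γ y (f : Vec ℕ n) zs →
  (∀ i → class f (lab a γ i) ≡ List.lookup γ i × Cyclic y f (lab a γ i) (zs ! i)) →
  (∀ b → a ≤ b → (∀ i → b ≢ lab a γ i) → class f b ≡ 0) → Generated a γ y f zs
⇒generated a []      y f []       _ _     = tt
⇒generated a (ℓ ∷ γ) y f (z ∷ zs) h empty =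
  empties ℓ a ℕₚ.≤-refl ℕₚ.≤-refl , h zero ,
  ⇒generated (suc (a + ℓ)) γ y f zs (h ∘ suc) (λ b le b≢ → empty b (ℕₚ.≤-trans (ℕₚ.m≤n⇒m≤1+n (ℕₚ.m≤m+n a ℓ)) le)
    (λ { zero e → ℕₚ.<⇒≢ le (sym e) ; (suc i) e → b≢ i e }))
  where
  empties : ∀ r b → a ≤ b → b + r ≤ a + ℓ → HasSizes b (replicate r (hom , 0)) f
  empties zero    b a≤b le = tt
  empties (suc r) b a≤b le = empty b a≤b (λ i e → ℕₚ.<⇒≢ (ℕₚ.<-≤-trans b< (big i)) e) ,
    empties r (suc b) (ℕₚ.m≤n⇒m≤1+n a≤b) (subst (_≤ a + ℓ) (ℕₚ.+-suc b r) le)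
    where
    b< : b < a + ℓ
    b< = ℕₚ.<-≤-trans (ℕₚ.m<m+n b (s≤s z≤n)) le
    big : ∀ i → a + ℓ ≤ lab a (ℓ ∷ γ) i
    big zero    = ℕₚ.≤-refl
    big (suc i) = ℕₚ.<⇒≤ (lab-head< a ℓ γ i)

module Cycles {n : ℕ} (κ M : ℕ) (ε : ℕ → Bool) (S : List Bool) (S-length : length S ≡ n)
  (γ : List ℕ) (γ-pos : All (1 ≤_) γ) (γ-sum : sum γ ≡ n) (c : Fin n → Fin n)
  (c-step : ∀ x i o → toℕ x ≡ start γ i + o → suc o < List.lookup γ i → toℕ (c x) ≡ start γ i + suc o)
  (c-wrap : ∀ x i o → toℕ x ≡ start γ i + o → suc o ≡ List.lookup γ i → toℕ (c x) ≡ start γ i + 0)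
  (slots-fit : Characters.Fits κ M ε S S-length (slots γ)) where

  open Characters {n} κ M ε S S-length

  m : ℕ
  m = length γ

  located : ∀ (x : Fin n) → ∃ λ i → ∃ λ o → toℕ x ≡ start γ i + o × o < List.lookup γ i
  located x = locate γ (subst (toℕ x <_) (sym γ-sum) (Finₚ.toℕ<n x))

  bl : Fin n → Fin m
  bl x = proj₁ (located x)

  off : Fin n → ℕ
  off x = proj₁ (proj₂ (located x))

  pos≡ : ∀ x → toℕ x ≡ start γ (bl x) + off x
  pos≡ x = proj₁ (proj₂ (proj₂ (located x)))

  off< : ∀ x → off x < List.lookup γ (bl x)
  off< x = proj₂ (proj₂ (proj₂ (located x)))

  at-unique : ∀ x i o → toℕ x ≡ start γ i + o → o < List.lookup γ i → bl x ≡ i × off x ≡ o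
  at-unique x i o eq lt = locate-unique γ (bl x) i (off< x) lt (trans (sym (pos≡ x)) eq)

  place< : ∀ i {o} → o < List.lookup γ i → start γ i + o < n
  place< i lt = subst (_ <_) γ-sum (start-bound γ i lt)

  place : ∀ i {o} → o < List.lookup γ i → Fin n
  place i lt = fromℕ< (place< i lt)

  toℕ-place : ∀ i {o} (lt : o < List.lookup γ i) → toℕ (place i lt) ≡ start γ i + o
  toℕ-place i lt = Finₚ.toℕ-fromℕ< (place< i lt)

  size>0 : ∀ i → 0 < List.lookup γ i
  size>0 i = All.lookup γ-pos (∈ₚ.∈-lookup i)

  first : Fin m → Fin n
  first i = place i (size>0 i)

  label : Fin n → ℕ
  label x = lab 0 γ (bl x)

  sgn-label : ∀ x → sgn x ≡ ε (label x)
  sgn-label x = begin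
    nth false S (toℕ x) ≡⟨ cong (λ l → nth false l (toℕ x)) (proj₂ slots-fit) ⟨
    nth false (map ε (labels 0 (slots γ))) (toℕ x) ≡⟨ nth-map ε 0 false (labels 0 (slots γ)) (subst (toℕ x <_) (sym (trans (length-labels 0 (slots γ)) (fits⇒total {slots γ} slots-fit))) (Finₚ.toℕ<n x)) ⟩
    ε (nth 0 (labels 0 (slots γ)) (toℕ x)) ≡⟨ cong (λ j → ε (nth 0 (labels 0 (slots γ)) j)) (pos≡ x) ⟩
    ε (nth 0 (labels 0 (slots γ)) (start γ (bl x) + off x)) ≡⟨ cong ε (nth-labels-slots 0 γ (bl x) (off< x)) ⟩
    ε (label x) ∎
    where open ≡-Reasoning

  c-block : ∀ x → bl (c x) ≡ bl x
  c-block x with ℕₚ.m≤n⇒m<n∨m≡n (off< x)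
  ... | inj₁ lt = proj₁ (at-unique (c x) (bl x) (suc (off x)) (c-step x (bl x) (off x) (pos≡ x) lt) lt)
  ... | inj₂ eq = proj₁ (at-unique (c x) (bl x) 0 (c-wrap x (bl x) (off x) (pos≡ x) eq) (size>0 (bl x)))

  CycleRoot : Vec (Fin n) n → Set
  CycleRoot u = (∀ x → iter (u !_) k x ≡ c x) × (∀ x → parity (u !_) sgn k x ≡ false)

  cycleRoot? : ∀ u → Dec (CycleRoot u)
  cycleRoot? u = Finₚ.all? (λ x → iter (u !_) k x Finₚ.≟ c x) ×-dec Finₚ.all? (λ x → parity (u !_) sgn k x Boolₚ.≟ false)

  Triple : Set
  Triple = Vec (Fin n) n × Vec ℕ n × Vec (Fin n) m

  Marked : Triple → Set
  Marked (u , f , z) = Admissible u f × Generated 0 γ (iter (u !_) k) f z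

  marked? : ∀ t → Dec (Marked t)
  marked? (u , f , z) = admissible? u f ×-dec generated? 0 γ (iter (u !_) k) f z

  triples : List Triple
  triples = cartesianProduct (perms n) (cartesianProduct labellings (allVecs (allFin n) m))

  -- The generators linearise the cycles of y = u^k: `g` sends the position with offset o in block i
  -- to y^o z_i. It conjugates `c` into y, so the conjugate of `u` by `g` is a k-th root of `c`.
  φ : Triple → Vec (Fin n) n × Vec (Fin n) n
  φ (u , f , z) = let g = tabulate (λ x → iter (iter (u !_) k) (off x) (z ! bl x)) in g , inv g ⊙ (u ⊙ g)

  ψ : Vec (Fin n) n × Vec (Fin n) n → Triple
  ψ (g , v) = g ⊙ (v ⊙ inv g) , tabulate (λ x → label (inv g ! x)) , tabulate (λ i → g ! first i)

  module To (u : Vec (Fin n) n) (f : Vec ℕ n) (z : Vec (Fin n) m) (u-perm : Perm u) (marked : Marked (u , f , z)) where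

    y : Fin n → Fin n
    y = iter (u !_) k

    y-inj : ∀ {a b} → y a ≡ y b → a ≡ b
    y-inj = Perm-iter u-perm k

    f-inv : ∀ x → f ! y x ≡ f ! x
    f-inv = proj₁ (proj₁ marked)

    gen = generated⇒ 0 γ y f z (proj₂ marked)

    f-z : ∀ i → f ! (z ! i) ≡ lab 0 γ i
    f-z i = proj₁ (proj₂ (gen i))

    f-iter : ∀ t x → f ! iter y t x ≡ f ! x
    f-iter zero    x = refl
    f-iter (suc t) x = trans (f-inv _) (f-iter t x)

    f-orbit : ∀ i x → Orbits.Orbit y y-inj (z ! i) x → f ! x ≡ lab 0 γ i
    f-orbit i x (t , refl) = trans (f-iter (toℕ t) (z ! i)) (f-z i)

    module Per (i : Fin m) = Period y y-inj (z ! i) (λ x → f ! x ℕₚ.≟ lab 0 γ i) (f-orbit i) (proj₂ (proj₂ (gen i)))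

    d≡ : ∀ i → Per.d i ≡ List.lookup γ i
    d≡ i = trans (sym (Per.size≡d i)) (proj₁ (gen i))

    g : Vec (Fin n) n
    g = tabulate (λ x → iter y (off x) (z ! bl x))

    g! : ∀ x → g ! x ≡ iter y (off x) (z ! bl x)
    g! = Vecₚ.lookup∘tabulate (λ x → iter y (off x) (z ! bl x))

    g-at : ∀ x i o → toℕ x ≡ start γ i + o → o < List.lookup γ i → g ! x ≡ iter y o (z ! i)
    g-at x i o eq lt = trans (g! x) (let (e , e′) = at-unique x i o eq lt in cong₂ (λ o i → iter y o (z ! i)) e′ e)

    f-g : ∀ x → f ! (g ! x) ≡ label x
    f-g x = trans (cong (f !_) (g! x)) (trans (f-iter (off x) _) (f-z (bl x)))

    g-perm : Perm g
    g-perm = injective λ a b eq →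
      let i≡ = lab-injective 0 γ (bl a) (bl b) (trans (sym (f-g a)) (trans (cong (f !_) eq) (f-g b)))
          o≡ = Per.distinct (bl a) (subst (off a <_) (sym (d≡ (bl a))) (off< a))
                 (subst (off b <_) (trans (cong (List.lookup γ) (sym i≡)) (sym (d≡ (bl a)))) (off< b))
                 (trans (sym (g! a)) (trans eq (trans (g! b) (cong (λ i → iter y (off b) (z ! i)) (sym i≡)))))
      in Finₚ.toℕ-injective (trans (pos≡ a) (trans (cong₂ (λ i o → start γ i + o) i≡ o≡) (sym (pos≡ b))))

    y-g : ∀ x → y (g ! x) ≡ g ! c x
    y-g x with ℕₚ.m≤n⇒m<n∨m≡n (off< x)
    ... | inj₁ lt = trans (cong y (g! x)) (sym (g-at (c x) (bl x) (suc (off x)) (c-step x (bl x) (off x) (pos≡ x) lt) lt))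
    -- At the end of a block the exponent reaches the period of the generator, and y returns to it.
    ... | inj₂ eq = trans (cong y (g! x)) (trans (trans (cong (λ t → iter y t (z ! bl x)) (trans eq (sym (d≡ (bl x))))) (Per.returns (bl x)))
            (sym (g-at (c x) (bl x) 0 (c-wrap x (bl x) (off x) (pos≡ x) eq) (size>0 (bl x)))))

    v : Vec (Fin n) n
    v = inv g ⊙ (u ⊙ g)

    v-perm : Perm v
    v-perm = Perm-⊙ (Perm-inv g-perm) (Perm-⊙ u-perm g-perm)

    g-v : ∀ x → g ! (v ! x) ≡ u ! (g ! x)
    g-v x = trans (cong (g !_) (⊙! (inv g) (u ⊙ g) x)) (trans (inv-r g g-perm _) (⊙! u g x))

    v-root : CycleRoot v
    v-root = (λ x → inj g-perm _ _ (trans (iter-natural (v !_) (u !_) (g !_) g-v k x) (y-g x))) ,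
      λ x → trans (parity-natural (u !_) (v !_) (g !_) (λ x → ε (f ! x)) sgn g-v
        (λ x → trans (sgn-label x) (cong ε (sym (f-g x)))) k x) (proj₂ (proj₁ marked) (g ! x))

    u-recovered : g ⊙ (v ⊙ inv g) ≡ u
    u-recovered = vec-ext λ x → trans (⊙! g (v ⊙ inv g) x) (trans (cong (g !_) (⊙! v (inv g) x))
      (trans (g-v _) (cong (u !_) (inv-r g g-perm x))))

    f-recovered : tabulate (λ x → label (inv g ! x)) ≡ f
    f-recovered = vec-ext λ x → trans (Vecₚ.lookup∘tabulate (λ x → label (inv g ! x)) x)
      (trans (sym (f-g _)) (cong (f !_) (inv-r g g-perm x)))

    z-recovered : tabulate (λ i → g ! first i) ≡ z
    z-recovered = vec-ext λ i → trans (Vecₚ.lookup∘tabulate (λ i → g ! first i) i)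
      (g-at (first i) i 0 (toℕ-place i (size>0 i)) (size>0 i))

    ψφ : ψ (φ (u , f , z)) ≡ (u , f , z)
    ψφ = cong₂ _,_ u-recovered (cong₂ _,_ f-recovered z-recovered)

  module From (g v : Vec (Fin n) n) (g-perm : Perm g) (v-perm : Perm v) (root : CycleRoot v) where

    u : Vec (Fin n) n
    u = g ⊙ (v ⊙ inv g)

    f : Vec ℕ n
    f = tabulate (λ x → label (inv g ! x))

    z : Vec (Fin n) m
    z = tabulate (λ i → g ! first i)

    u-perm : Perm u
    u-perm = Perm-⊙ g-perm (Perm-⊙ v-perm (Perm-inv g-perm))

    y : Fin n → Fin n
    y = iter (u !_) k

    open Orbits y (Perm-iter u-perm k)

    g-v : ∀ x → g ! (v ! x) ≡ u ! (g ! x)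
    g-v x = sym (trans (⊙! g (v ⊙ inv g) (g ! x)) (cong (g !_) (trans (⊙! v (inv g) (g ! x)) (cong (v !_) (inv-l g g-perm x)))))

    y-g : ∀ x → y (g ! x) ≡ g ! c x
    y-g x = trans (sym (iter-natural (v !_) (u !_) (g !_) g-v k x)) (cong (g !_) (proj₁ root x))

    f! : ∀ x → f ! x ≡ label (inv g ! x)
    f! = Vecₚ.lookup∘tabulate (λ x → label (inv g ! x))

    f-g : ∀ x → f ! (g ! x) ≡ label x
    f-g x = trans (f! (g ! x)) (cong label (inv-l g g-perm x))

    on-image : {P : Fin n → Set} → (∀ x → P (g ! x)) → ∀ x → P x
    on-image {P} h x = subst P (inv-r g g-perm x) (h (inv g ! x))

    admissible : Admissible u f
    admissible =
      on-image (λ x → trans (cong (f !_) (y-g x)) (trans (f-g (c x)) (trans (cong (lab 0 γ) (c-block x)) (sym (f-g x))))) ,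
      on-image (λ x → trans (sym (parity-natural (u !_) (v !_) (g !_) (λ x → ε (f ! x)) sgn g-v
        (λ x → trans (sgn-label x) (cong ε (sym (f-g x)))) k x)) (proj₂ root x))

    z! : ∀ i → z ! i ≡ g ! first i
    z! = Vecₚ.lookup∘tabulate (λ i → g ! first i)

    along : ∀ i o (lt : o < List.lookup γ i) → g ! place i lt ≡ iter y o (z ! i)
    along i zero    lt = trans (cong (g !_) (Finₚ.toℕ-injective (trans (toℕ-place i lt) (sym (toℕ-place i (size>0 i)))))) (sym (z! i))
    along i (suc o) lt = trans (cong (g !_) (Finₚ.toℕ-injective (trans (toℕ-place i lt) (sym (c-step (place i lt′) i o (toℕ-place i lt′) lt)))))
      (trans (sym (y-g (place i lt′))) (cong y (along i o lt′)))
      where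
      lt′ : o < List.lookup γ i
      lt′ = ℕₚ.<-trans (ℕₚ.n<1+n o) lt

    in-place : ∀ x → place (bl x) (off< x) ≡ x
    in-place x = Finₚ.toℕ-injective (trans (toℕ-place (bl x) (off< x)) (sym (pos≡ x)))

    bl-place : ∀ i {o} (lt : o < List.lookup γ i) → bl (place i lt) ≡ i
    bl-place i {o} lt = proj₁ (at-unique (place i lt) i o (toℕ-place i lt) lt)

    class≡ : ∀ i → class f (lab 0 γ i) ≡ List.lookup γ i
    class≡ i = trans (sym (#-perm (λ x → f ! x ℕₚ.≟ lab 0 γ i) g-perm))
      (#-image (λ x → f ! (g ! x) ℕₚ.≟ lab 0 γ i) (λ t → place i (Finₚ.toℕ<n t))
        (λ {a} {b} eq → Finₚ.toℕ-injective (ℕₚ.+-cancelˡ-≡ (start γ i) _ _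
          (trans (sym (toℕ-place i (Finₚ.toℕ<n a))) (trans (cong toℕ eq) (toℕ-place i (Finₚ.toℕ<n b))))))
        (λ t → trans (f-g _) (cong (lab 0 γ) (bl-place i (Finₚ.toℕ<n t))))
        onto)
      where
      onto : ∀ x → f ! (g ! x) ≡ lab 0 γ i → ∃ λ (t : Fin (List.lookup γ i)) → place i (Finₚ.toℕ<n t) ≡ x
      onto x eq with refl ← lab-injective 0 γ (bl x) i (trans (sym (f-g x)) eq) =
        fromℕ< (off< x) , Finₚ.toℕ-injective (trans (toℕ-place (bl x) (Finₚ.toℕ<n (fromℕ< (off< x))))
          (trans (cong (start γ (bl x) ℕ.+_) (Finₚ.toℕ-fromℕ< (off< x))) (sym (pos≡ x))))

    cyclic : ∀ i → Cyclic y f (lab 0 γ i) (z ! i)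
    cyclic i = trans (cong (f !_) (z! i)) (trans (f-g (first i)) (cong (lab 0 γ) (bl-place i (size>0 i)))) ,
      on-image (λ x eq → reach x (lab-injective 0 γ (bl x) i (trans (sym (f-g x)) eq)))
      where
      reach : ∀ x → bl x ≡ i → Orbit (z ! i) (g ! x)
      reach x refl = subst (Orbit (z ! bl x)) (trans (sym (along (bl x) (off x) (off< x))) (cong (g !_) (in-place x)))
        (orbit-iter (orbit-refl (z ! bl x)) (off x))

    marked : Marked (u , f , z)
    marked = admissible , ⇒generated 0 γ y f z (λ i → class≡ i , cyclic i)
      (λ b _ b≢ → #-none (λ x → f ! x ℕₚ.≟ b) (λ x eq → b≢ (bl (inv g ! x)) (trans (sym eq) (f! x))))

    f<M : ∀ x → f ! x < M
    f<M x = subst (_< M) (sym (f! x)) (subst (label (inv g ! x) <_) (proj₁ slots-fit) (lab-< 0 γ (bl (inv g ! x))))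

    g-recovered : tabulate (λ x → iter y (off x) (z ! bl x)) ≡ g
    g-recovered = vec-ext λ x → trans (Vecₚ.lookup∘tabulate (λ x → iter y (off x) (z ! bl x)) x)
      (trans (sym (along (bl x) (off x) (off< x))) (cong (g !_) (in-place x)))

    φψ : φ (u , f , z) ≡ (g , v)
    φψ = trans (cong (λ g → g , inv g ⊙ (u ⊙ g)) g-recovered) (cong (g ,_) (vec-ext λ x →
      trans (⊙! (inv g) (u ⊙ g) x) (trans (cong (inv g !_) (trans (⊙! u g x) (sym (g-v x)))) (inv-l g g-perm _))))

  roots-of-cycles : 𝔸 (slots γ) ≡ N! ℤ.* ∑ (perms n) (λ v → 𝟙 (cycleRoot? v))
  roots-of-cycles = begin
    𝔸 (slots γ)
      ≡⟨ ∑-cong (perms n) (λ u → ∑-cong labellings (λ f → trans (cong (𝟙 (admissible? u f) ℤ.*_) (weight-slots 0 γ γ-pos (iter (u !_) k) f))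
           (trans (sym (∑-*ˡ zs (𝟙 (admissible? u f)) _)) (∑-cong zs (λ z → sym (𝟙-× (admissible? u f) (generated? 0 γ (iter (u !_) k) f z))))))) ⟩
    ∑ (perms n) (λ u → ∑ labellings (λ f → ∑ zs (λ z → 𝟙 (marked? (u , f , z)))))
      ≡⟨ ∑-cong (perms n) (λ u → sym (∑-product labellings zs (λ fz → 𝟙 (marked? (u , fz))))) ⟩
    ∑ (perms n) (λ u → ∑ (cartesianProduct labellings zs) (λ fz → 𝟙 (marked? (u , fz))))
      ≡⟨ ∑-product (perms n) (cartesianProduct labellings zs) (λ t → 𝟙 (marked? t)) ⟨
    ∑ triples (λ t → 𝟙 (marked? t))
      ≡⟨ ∑-bij-perms (Uniqueₚ.cartesianProduct⁺ perms-unique (Uniqueₚ.cartesianProduct⁺ (allVecs-unique n (Uniqueₚ.upTo⁺ M)) (allVecs-unique m (Uniqueₚ.allFin⁺ n))))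
           marked? cycleRoot? φ ψ to from ⟩
    N! ℤ.* ∑ (perms n) (λ v → 𝟙 (cycleRoot? v)) ∎
    where
    open ≡-Reasoning
    zs = allVecs (allFin n) m
    to : ∀ {t} → t ∈ triples → Marked t → Perm (proj₁ (φ t)) × Perm (proj₂ (φ t)) × CycleRoot (proj₂ (φ t)) × (ψ (φ t) ≡ t)
    to {u , f , z} t∈ marked = T.g-perm , T.v-perm , T.v-root , T.ψφ
      where
      module T = To u f z (∈-perms⁻ (proj₁ (∈ₚ.∈-cartesianProduct⁻ (perms n) (cartesianProduct labellings zs) t∈))) marked
    from : ∀ {g v} → Perm g → Perm v → CycleRoot v → (ψ (g , v) ∈ triples) × Marked (ψ (g , v)) × (φ (ψ (g , v)) ≡ (g , v))
    from {g} {v} g-perm v-perm root =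
      ∈ₚ.∈-cartesianProduct⁺ (∈-perms⁺ F.u-perm) (∈ₚ.∈-cartesianProduct⁺
        (∈-allVecs⁺ F.f (λ x → ∈ₚ.∈-upTo⁺ (F.f<M x))) (∈-allVecs⁺ F.z (λ i → ∈ₚ.∈-allFin (F.z ! i)))) ,
      F.marked , F.φψ
      where
      module F = From g v g-perm v-perm root

  N!≢0 : N! ≢ + 0
  N!≢0 eq = nonempty (perms n) (∈-perms⁺ (injective {u = tabulate id} λ x y e →
      trans (sym (Vecₚ.lookup∘tabulate id x)) (trans e (Vecₚ.lookup∘tabulate id y)))) (ℤₚ.+-injective (trans (length-∑ (perms n)) eq))
    where
    nonempty : ∀ (xs : List (Vec (Fin n) n)) {x} → x ∈ xs → length xs ≢ 0
    nonempty (_ ∷ _) _ ()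

  -- Multiplied by n!, both counts equal `𝔸 (slots γ)`: one through the bijection with triples, the
  -- other through Newton's recursion.
  core : Slotted 0 γ → ∑ (perms n) (λ v → 𝟙 (cycleRoot? v)) ≡ Φ (slots γ)
  core slotted = ℤₚ.*-cancelˡ-≡ N! _ _ {{ℤ.≢-nonZero N!≢0}} (trans (sym roots-of-cycles) (power-sums γ slotted slots-fit))

-- Characters of F₂ⁿ and Fourier inversion.

bits : ∀ n → List (Vec Bool n)
bits n = allVecs (false ∷ true ∷ []) n

bits-unique : Unique (bits n)
bits-unique {n} = allVecs-unique n (((λ ()) ∷ []) ∷ [] ∷ [])

∈-bool : ∀ b → b ∈ false ∷ true ∷ []
∈-bool false = here refl
∈-bool true  = there (here refl)

∈-bits : (s : Vec Bool n) → s ∈ bits n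
∈-bits s = ∈-allVecs⁺ s (λ x → ∈-bool (s ! x))

-1ℤ : ℤ
-1ℤ = ℤ.- (+ 1)

sign : Bool → ℤ
sign b = if b then -1ℤ else + 1

-- The pairing (-1)^(r·s) of F₂ⁿ with itself.
χ : (Fin n → Bool) → (Fin n → Bool) → ℤ
χ {zero}  r s = + 1
χ {suc n} r s = sign (r zero ∧ s zero) ℤ.* χ (r ∘ suc) (s ∘ suc)

χ-cong : {r r′ s s′ : Fin n → Bool} → (∀ x → r x ≡ r′ x) → (∀ x → s x ≡ s′ x) → χ r s ≡ χ r′ s′
χ-cong {zero}  eq eq′ = refl
χ-cong {suc n} eq eq′ = cong₂ ℤ._*_ (cong₂ (λ a b → sign (a ∧ b)) (eq zero) (eq′ zero)) (χ-cong (eq ∘ suc) (eq′ ∘ suc))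

χ-comm : (r s : Fin n → Bool) → χ r s ≡ χ s r
χ-comm {zero}  r s = refl
χ-comm {suc n} r s = cong₂ ℤ._*_ (cong sign (Boolₚ.∧-comm (r zero) (s zero))) (χ-comm (r ∘ suc) (s ∘ suc))

χ-xor : (r s q : Fin n → Bool) → χ r (λ x → s x xor q x) ≡ χ r s ℤ.* χ r q
χ-xor {zero}  r s q = refl
χ-xor {suc n} r s q = trans (cong₂ ℤ._*_ (bit (r zero) (s zero) (q zero)) (χ-xor (r ∘ suc) (s ∘ suc) (q ∘ suc)))
  (shuffle (sign (r zero ∧ s zero)) (sign (r zero ∧ q zero)) _ _)
  where
  bit : ∀ a b c → sign (a ∧ (b xor c)) ≡ sign (a ∧ b) ℤ.* sign (a ∧ c)
  bit false b     c     = refl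
  bit true  false false = refl
  bit true  false true  = refl
  bit true  true  false = refl
  bit true  true  true  = refl
  shuffle : ∀ a b c d → a ℤ.* b ℤ.* (c ℤ.* d) ≡ a ℤ.* c ℤ.* (b ℤ.* d)
  shuffle = solve-∀

χ-false : (r : Fin n → Bool) → χ r (λ _ → false) ≡ + 1
χ-false {zero}  r = refl
χ-false {suc n} r = trans (cong₂ ℤ._*_ (cong sign (Boolₚ.∧-zeroʳ (r zero))) (χ-false (r ∘ suc))) refl

χ-# : (r s : Fin n → Bool) → χ r s ≡ -1ℤ ℤ.^ # (λ x → Boolₚ.T? (r x ∧ s x))
χ-# {zero}  r s = refl
χ-# {suc n} r s = trans (cong (sign (r zero ∧ s zero) ℤ.*_) (χ-# (r ∘ suc) (s ∘ suc))) (bit (r zero ∧ s zero) _)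
  where
  bit : ∀ b m → sign b ℤ.* -1ℤ ℤ.^ m ≡ -1ℤ ℤ.^ ((if b then 1 else 0) + m)
  bit false m = ℤₚ.*-identityˡ _
  bit true  m = refl

χ-perm : {v : Vec (Fin n) n} → Perm v → (r s : Fin n → Bool) → χ (λ x → r (v ! x)) (λ x → s (v ! x)) ≡ χ r s
χ-perm {v = v} p r s = trans (χ-# (λ x → r (v ! x)) (λ x → s (v ! x))) (trans (cong (-1ℤ ℤ.^_) (#-perm (λ x → Boolₚ.T? (r x ∧ s x)) p)) (sym (χ-# r s)))

two^ : ℕ → ℤ
two^ zero    = + 1
two^ (suc n) = + 2 ℤ.* two^ n

two^≢0 : ∀ n → two^ n ≢ + 0
two^≢0 zero    ()
two^≢0 (suc n) eq with ℤₚ.i*j≡0⇒i≡0∨j≡0 (+ 2) eq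
... | inj₂ eq′ = two^≢0 n eq′

zero? : (q : Fin n → Bool) → Dec (∀ x → q x ≡ false)
zero? q = Finₚ.all? (λ x → q x Boolₚ.≟ false)

-- Orthogonality of characters: the two values of the first bit of r cancel if q is 1 there, and
-- double the remaining sum if q is 0 there.
∑-χ : (q : Fin n → Bool) → ∑ (bits n) (λ r → χ (r !_) q) ≡ two^ n ℤ.* 𝟙 (zero? q)
∑-χ {zero}  q = trans (ℤₚ.+-identityʳ _) (sym (trans (ℤₚ.*-identityˡ _) (𝟙-yes (zero? q) λ ())))
∑-χ {suc n} q = begin
  ∑ (bits (suc n)) (λ r → χ (r !_) q)
    ≡⟨ ∑-allVecs-suc (false ∷ true ∷ []) n _ ⟩
  ∑ (false ∷ true ∷ []) (λ b → ∑ (bits n) (λ r → sign (b ∧ q zero) ℤ.* χ (r !_) (q ∘ suc)))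
    ≡⟨ ∑-cong (false ∷ true ∷ []) (λ b → ∑-*ˡ (bits n) (sign (b ∧ q zero)) (λ r → χ (r !_) (q ∘ suc))) ⟩
  + 1 ℤ.* X ℤ.+ (sign (q zero) ℤ.* X ℤ.+ + 0)
    ≡⟨ cong (λ X → + 1 ℤ.* X ℤ.+ (sign (q zero) ℤ.* X ℤ.+ + 0)) (∑-χ (q ∘ suc)) ⟩
  + 1 ℤ.* (two^ n ℤ.* t) ℤ.+ (sign (q zero) ℤ.* (two^ n ℤ.* t) ℤ.+ + 0)
    ≡⟨ cases (q zero) ⟩
  + 2 ℤ.* two^ n ℤ.* (𝟙 (q zero Boolₚ.≟ false) ℤ.* t)
    ≡⟨ cong (+ 2 ℤ.* two^ n ℤ.*_) (sym (trans
         (𝟙-cong (zero? q) ((q zero Boolₚ.≟ false) ×-dec zero? (q ∘ suc)) (λ h → h zero , h ∘ suc) (λ { (a , b) zero → a ; (a , b) (suc x) → b x }))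
         (𝟙-× (q zero Boolₚ.≟ false) (zero? (q ∘ suc))))) ⟩
  two^ (suc n) ℤ.* 𝟙 (zero? q) ∎
  where
  open ≡-Reasoning
  X = ∑ (bits n) (λ r → χ (r !_) (q ∘ suc))
  t = 𝟙 (zero? (q ∘ suc))
  double : ∀ a t → + 1 ℤ.* (a ℤ.* t) ℤ.+ (+ 1 ℤ.* (a ℤ.* t) ℤ.+ + 0) ≡ + 2 ℤ.* a ℤ.* (+ 1 ℤ.* t)
  double = solve-∀
  cancel : ∀ a t → + 1 ℤ.* (a ℤ.* t) ℤ.+ (-1ℤ ℤ.* (a ℤ.* t) ℤ.+ + 0) ≡ + 2 ℤ.* a ℤ.* (+ 0 ℤ.* t)
  cancel = solve-∀
  cases : ∀ b → + 1 ℤ.* (two^ n ℤ.* t) ℤ.+ (sign b ℤ.* (two^ n ℤ.* t) ℤ.+ + 0) ≡ + 2 ℤ.* two^ n ℤ.* (𝟙 (b Boolₚ.≟ false) ℤ.* t)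
  cases false = trans (double (two^ n) t) (cong (λ c → + 2 ℤ.* two^ n ℤ.* (c ℤ.* t)) (sym (𝟙-yes (false Boolₚ.≟ false) refl)))
  cases true  = trans (cancel (two^ n) t) (cong (λ c → + 2 ℤ.* two^ n ℤ.* (c ℤ.* t)) (sym (𝟙-no (true Boolₚ.≟ false) λ ())))

-- `parity` adds its terms from the front, whereas powers of a signed permutation produce them from
-- the back.
parity-snoc : (u : Fin n → Fin n) (s : Fin n → Bool) (t : ℕ) (x : Fin n) →
  parity u s (suc t) x ≡ parity u s t x xor s (iter u t x)
parity-snoc u s zero    x = Boolₚ.xor-identityʳ (s x)
parity-snoc u s (suc t) x = trans (cong (s x xor_) (trans (parity-snoc u s t (u x)) (cong (λ y → parity u s t (u x) xor s y) (iter-comm u t x))))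
  (sym (Boolₚ.xor-assoc (s x) _ _))

-- A linear system over F₂ is counted by the characters of the kernel of its transpose.
module Fourier (κ : ℕ) {n : ℕ} (v : Vec (Fin n) n) (v-perm : Perm v) where

  k : ℕ
  k = suc κ

  w : Fin n → Fin n
  w = inv v !_

  -- Reindexing by `v` preserves the pairing and moves `v`, inverted, to the other argument; hence
  -- the transpose of T_v is T_w with w = v⁻¹.
  adjoint : ∀ t (r s : Fin n → Bool) → χ r (parity (v !_) s t) ≡ χ (parity w r t) s
  adjoint zero    r s = trans (χ-false r) (sym (trans (χ-comm (λ _ → false) s) (χ-false s)))
  adjoint (suc t) r s = begin
    χ r (λ x → s x xor parity (v !_) s t (v ! x))
      ≡⟨ χ-xor r s _ ⟩
    χ r s ℤ.* χ r (λ x → parity (v !_) s t (v ! x))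
      ≡⟨ cong (χ r s ℤ.*_) (χ-cong (λ x → cong r (sym (inv-l v v-perm x))) (λ _ → refl)) ⟩
    χ r s ℤ.* χ (λ x → r (w (v ! x))) (λ x → parity (v !_) s t (v ! x))
      ≡⟨ cong (χ r s ℤ.*_) (χ-perm v-perm (r ∘ w) (parity (v !_) s t)) ⟩
    χ r s ℤ.* χ (r ∘ w) (parity (v !_) s t)
      ≡⟨ cong (χ r s ℤ.*_) (adjoint t (r ∘ w) s) ⟩
    χ r s ℤ.* χ (parity w (r ∘ w) t) s
      ≡⟨ cong (χ r s ℤ.*_) (χ-cong (parity-natural w w w r (r ∘ w) (λ _ → refl) (λ _ → refl) t) (λ _ → refl)) ⟩
    χ r s ℤ.* χ (λ x → parity w r t (w x)) s
      ≡⟨ cong₂ ℤ._*_ (χ-comm r s) (χ-comm _ s) ⟩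
    χ s r ℤ.* χ s (λ x → parity w r t (w x))
      ≡⟨ χ-xor s r _ ⟨
    χ s (parity w r (suc t))
      ≡⟨ χ-comm s _ ⟩
    χ (parity w r (suc t)) s ∎
    where open ≡-Reasoning

  -- The orbit segment x, w x, ..., wᵗ x read backwards is the segment of `v` that starts at wᵗ x.
  reverse : ∀ (r : Fin n → Bool) t x → parity w r (suc t) x ≡ parity (v !_) r (suc t) (iter w t x)
  reverse r zero    x = refl
  reverse r (suc t) x = begin
    parity w r (suc (suc t)) x ≡⟨ parity-snoc w r (suc t) x ⟩
    parity w r (suc t) x xor r (iter w (suc t) x) ≡⟨ Boolₚ.xor-comm _ (r (iter w (suc t) x)) ⟩
    r (iter w (suc t) x) xor parity w r (suc t) x ≡⟨ cong (r (iter w (suc t) x) xor_) (reverse r t x) ⟩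
    r (iter w (suc t) x) xor parity (v !_) r (suc t) (iter w t x) ≡⟨ cong (λ y → r (iter w (suc t) x) xor parity (v !_) r (suc t) y) (sym (inv-r v v-perm (iter w t x))) ⟩
    r (iter w (suc t) x) xor parity (v !_) r (suc t) (v ! (w (iter w t x))) ∎
    where open ≡-Reasoning

  iter-cancel : ∀ t x → iter w t (iter (v !_) t x) ≡ x
  iter-cancel zero    x = refl
  iter-cancel (suc t) x = trans (sym (iter-comm w t _)) (trans (cong (iter w t) (inv-l v v-perm _)) (iter-cancel t x))

  -- The two operators differ only by the substitution of w^κ x for x, which is onto, so they vanish
  -- on the same sign vectors.
  same-kernel : ∀ r → (∀ x → parity w r k x ≡ false) → ∀ x → parity (v !_) r k x ≡ false
  same-kernel r h x = trans (cong (parity (v !_) r k) (sym (iter-cancel κ x))) (trans (sym (reverse r κ _)) (h _))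

  same-kernel′ : ∀ r → (∀ x → parity (v !_) r k x ≡ false) → ∀ x → parity w r k x ≡ false
  same-kernel′ r h x = trans (reverse r κ x) (h _)

  solves? : (s β : Fin n → Bool) → Dec (∀ x → parity (v !_) s k x ≡ β x)
  solves? s β = Finₚ.all? (λ x → parity (v !_) s k x Boolₚ.≟ β x)

  -- Orthogonality is used twice. The indicator of T_v s = β is expanded over r; the sum over s then
  -- retains the r in the kernel of the transpose, which coincides with the kernel of T_v.
  fourier : ∀ β → ∑ (bits n) (λ s → 𝟙 (solves? (s !_) β)) ≡ ∑ (bits n) (λ r → 𝟙 (solves? (r !_) (λ _ → false)) ℤ.* χ (r !_) β)
  fourier β = ℤₚ.*-cancelˡ-≡ (two^ n) _ _ {{ℤ.≢-nonZero (two^≢0 n)}} (begin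
    two^ n ℤ.* ∑ (bits n) (λ s → 𝟙 (solves? (s !_) β))
      ≡⟨ ∑-*ˡ (bits n) (two^ n) _ ⟨
    ∑ (bits n) (λ s → two^ n ℤ.* 𝟙 (solves? (s !_) β))
      ≡⟨ ∑-cong (bits n) (λ s → trans (cong (two^ n ℤ.*_) (𝟙-cong (solves? (s !_) β) (zero? (λ x → parity (v !_) (s !_) k x xor β x))
           (λ h x → trans (cong (_xor β x) (h x)) (Boolₚ.xor-same (β x))) (λ h x → xor-false (h x))))
           (sym (∑-χ (λ x → parity (v !_) (s !_) k x xor β x)))) ⟩
    ∑ (bits n) (λ s → ∑ (bits n) (λ r → χ (r !_) (λ x → parity (v !_) (s !_) k x xor β x)))
      ≡⟨ ∑-swap (bits n) (bits n) _ ⟩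
    ∑ (bits n) (λ r → ∑ (bits n) (λ s → χ (r !_) (λ x → parity (v !_) (s !_) k x xor β x)))
      ≡⟨ ∑-cong (bits n) (λ r → trans (∑-cong (bits n) (λ s → trans (χ-xor (r !_) _ β)
           (cong (ℤ._* χ (r !_) β) (trans (adjoint k (r !_) (s !_)) (χ-comm _ (s !_))))))
           (trans (∑-*ʳ (bits n) (χ (r !_) β) _) (cong (ℤ._* χ (r !_) β) (∑-χ (parity w (r !_) k))))) ⟩
    ∑ (bits n) (λ r → two^ n ℤ.* 𝟙 (zero? (parity w (r !_) k)) ℤ.* χ (r !_) β)
      ≡⟨ ∑-cong (bits n) (λ r → trans (ℤₚ.*-assoc (two^ n) _ _) (cong (λ c → two^ n ℤ.* (c ℤ.* χ (r !_) β))
           (𝟙-cong (zero? (parity w (r !_) k)) (solves? (r !_) (λ _ → false)) (same-kernel (r !_)) (same-kernel′ (r !_))))) ⟩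
    ∑ (bits n) (λ r → two^ n ℤ.* (𝟙 (solves? (r !_) (λ _ → false)) ℤ.* χ (r !_) β))
      ≡⟨ ∑-*ˡ (bits n) (two^ n) _ ⟩
    two^ n ℤ.* ∑ (bits n) (λ r → 𝟙 (solves? (r !_) (λ _ → false)) ℤ.* χ (r !_) β) ∎)
    where
    open ≡-Reasoning
    xor-false : ∀ {a b} → a xor b ≡ false → a ≡ b
    xor-false {false} {false} _ = refl
    xor-false {true}  {true}  _ = refl

-- Signed permutations as pairs of a permutation and a sign vector.

letters≡product : ∀ n → letters n ≡ cartesianProduct (allFin n) (false ∷ true ∷ [])
letters≡product n = go (allFin n)
  where
  go : ∀ js → concatMap (λ j → (j , false) ∷ (j , true) ∷ []) js ≡ cartesianProduct js (false ∷ true ∷ [])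
  go []       = refl
  go (j ∷ js) = cong (λ l → (j , false) ∷ (j , true) ∷ l) (go js)

letters-unique : Unique (letters n)
letters-unique {n} = subst Unique (sym (letters≡product n))
  (Uniqueₚ.cartesianProduct⁺ (Uniqueₚ.allFin⁺ n) (((λ ()) ∷ []) ∷ [] ∷ []))

∈-letters : (a : Fin n × Bool) → a ∈ letters n
∈-letters {n} (j , b) = subst ((j , b) ∈_) (sym (letters≡product n)) (∈ₚ.∈-cartesianProduct⁺ (∈ₚ.∈-allFin j) (∈-bool b))

finEq⇒ : {i j : Fin n} → T (finEqᵇ i j) → i ≡ j
finEq⇒ {i = i} {j} t = Finₚ.toℕ-injective (ℕₚ.≡ᵇ⇒≡ (toℕ i) (toℕ j) t)

⇒finEq : {i j : Fin n} → i ≡ j → T (finEqᵇ i j)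
⇒finEq {i = i} {j} eq = ℕₚ.≡⇒≡ᵇ (toℕ i) (toℕ j) (cong toℕ eq)

boolEq⇒ : ∀ {a b} → T (boolEqᵇ a b) → a ≡ b
boolEq⇒ {false} {false} _ = refl
boolEq⇒ {true}  {true}  _ = refl

⇒boolEq : ∀ {a b} → a ≡ b → T (boolEqᵇ a b)
⇒boolEq {false} refl = tt
⇒boolEq {true}  refl = tt

∧⇒ : ∀ {a b} → T (a ∧ b) → T a × T b
∧⇒ {a} {b} = Equivalence.to (Boolₚ.T-∧ {a} {b})

⇒∧ : ∀ {a b} → T a → T b → T (a ∧ b)
⇒∧ {a} {b} p q = Equivalence.from (Boolₚ.T-∧ {a} {b}) (p , q)

sEq⇒ : ∀ {m} (u v : Vec (Fin n × Bool) m) →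
  T (and (toList (Vec.zipWith (λ a b → finEqᵇ (proj₁ a) (proj₁ b) ∧ boolEqᵇ (proj₂ a) (proj₂ b)) u v))) → ∀ x → u ! x ≡ v ! x
sEq⇒ (a ∷ u) (b ∷ v) t zero    = let (p , q) = ∧⇒ (proj₁ (∧⇒ t)) in cong₂ _,_ (finEq⇒ p) (boolEq⇒ q)
sEq⇒ (a ∷ u) (b ∷ v) t (suc x) = sEq⇒ u v (proj₂ (∧⇒ t)) x

⇒sEq : ∀ {m} (u v : Vec (Fin n × Bool) m) → (∀ x → u ! x ≡ v ! x) →
  T (and (toList (Vec.zipWith (λ a b → finEqᵇ (proj₁ a) (proj₁ b) ∧ boolEqᵇ (proj₂ a) (proj₂ b)) u v)))
⇒sEq []      []      h = tt
⇒sEq (a ∷ u) (b ∷ v) h = ⇒∧ (⇒∧ (⇒finEq (cong proj₁ (h zero))) (⇒boolEq (cong proj₂ (h zero)))) (⇒sEq u v (h ∘ suc))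

powers : ∀ (u : SVec n) t x → (u ^ˢ t) ! x ≡
  (iter (λ y → proj₁ (u ! y)) t x , parity (λ y → proj₁ (u ! y)) (λ y → proj₂ (u ! y)) t x)
powers {n} u zero    x = Vecₚ.lookup∘tabulate (λ i → (i , false)) x
powers {n} u (suc t) x = trans (Vecₚ.lookup∘tabulate _ x)
  (trans (cong (λ jb → (proj₁ (u ! proj₁ jb) , proj₂ jb xor proj₂ (u ! proj₁ jb))) (powers u t x))
    (cong (iter (λ y → proj₁ (u ! y)) (suc t) x ,_) (sym (parity-snoc (λ y → proj₁ (u ! y)) (λ y → proj₂ (u ! y)) t x))))

-- A surjection has an injective section. By finiteness the section is surjective as well, hence a
-- two-sided inverse.
signedPerm⇒ : (u : SVec n) → T (isSignedPermᵇ u) → Perm (Vec.map proj₁ u)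
signedPerm⇒ {n} u t = injective λ x y eq → trans (sym (retract x)) (trans (cong (r !_) eq) (retract y))
  where
  v = Vec.map proj₁ u
  hit : ∀ {m} (w : Vec (Fin n × Bool) m) j → T (any (λ a → finEqᵇ (proj₁ a) j) (toList w)) → ∃ λ x → proj₁ (w ! x) ≡ j
  hit (a ∷ w) j t with Equivalence.to (Boolₚ.T-∨ {finEqᵇ (proj₁ a) j}) t
  ... | inj₁ p = zero , finEq⇒ p
  ... | inj₂ q = let (x , eq) = hit w j q in suc x , eq
  pre : ∀ j → ∃ λ x → proj₁ (u ! x) ≡ j
  pre j = hit u j (All.lookup (Allₚ.all⁺ (λ j → any (λ a → finEqᵇ (proj₁ a) j) (toList u)) (allFin n) t) (∈ₚ.∈-allFin j))
  r : Vec (Fin n) n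
  r = tabulate (λ j → proj₁ (pre j))
  section : ∀ j → v ! (r ! j) ≡ j
  section j = trans (cong (v !_) (Vecₚ.lookup∘tabulate (λ j → proj₁ (pre j)) j))
    (trans (Vecₚ.lookup-map (proj₁ (pre j)) proj₁ u) (proj₂ (pre j)))
  r-perm : Perm r
  r-perm = injective λ a b eq → trans (sym (section a)) (trans (cong (v !_) eq) (section b))
  retract : ∀ x → r ! (v ! x) ≡ x
  retract x = let (j , eq) = surjective r r-perm x in
    trans (cong (λ y → r ! (v ! y)) (sym eq)) (trans (cong (r !_) (section j)) eq)

⇒signedPerm : (u : SVec n) → Perm (Vec.map proj₁ u) → T (isSignedPermᵇ u)
⇒signedPerm {n} u p = Allₚ.all⁻ _ (All.tabulate {xs = allFin n} (λ {j} _ → let (x , eq) = surjective _ p j in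
    hit u j x (trans (sym (Vecₚ.lookup-map x proj₁ u)) eq)))
  where
  hit : ∀ {m} (w : Vec (Fin n × Bool) m) j x → proj₁ (w ! x) ≡ j → T (any (λ a → finEqᵇ (proj₁ a) j) (toList w))
  hit (a ∷ w) j zero    eq = Equivalence.from (Boolₚ.T-∨ {finEqᵇ (proj₁ a) j}) (inj₁ (⇒finEq eq))
  hit (a ∷ w) j (suc x) eq = Equivalence.from (Boolₚ.T-∨ {finEqᵇ (proj₁ a) j}) (inj₂ (hit w j x eq))

HasPower : ℕ → SVec n → Vec (Fin n) n → Vec Bool n → Set
HasPower k t v s = (∀ x → iter (v !_) k x ≡ proj₁ (t ! x)) × (∀ x → parity (v !_) (s !_) k x ≡ proj₂ (t ! x))

hasPower? : ∀ k (t : SVec n) v s → Dec (HasPower k t v s)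
hasPower? k t v s = Finₚ.all? (λ x → iter (v !_) k x Finₚ.≟ proj₁ (t ! x)) ×-dec
  Finₚ.all? (λ x → parity (v !_) (s !_) k x Boolₚ.≟ proj₂ (t ! x))

-- Stated for an arbitrary target `t` and summand `F`, so that it serves the roots of `w` as well as
-- the roots of the identity.
∑-roots : ∀ n k (t : SVec n) (F : SVec n → ℤ) →
  ∑ (filter (λ u → Boolₚ.T? (sEqᵇ (u ^ˢ k) t)) (B n)) F ≡
  ∑ (perms n) (λ v → ∑ (bits n) (λ s → 𝟙 (hasPower? k t v s) ℤ.* F (Vec.zip v s)))
∑-roots n k t F = begin
  ∑ (filter Q? (B n)) F
    ≡⟨ ∑-filter Q? (B n) F ⟩
  ∑ (B n) (λ u → 𝟙 (Q? u) ℤ.* F u)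
    ≡⟨ ∑-filter P? all-vecs _ ⟩
  ∑ all-vecs (λ u → 𝟙 (P? u) ℤ.* (𝟙 (Q? u) ℤ.* F u))
    ≡⟨ ∑-cong all-vecs (λ u → trans (sym (ℤₚ.*-assoc (𝟙 (P? u)) _ _)) (cong (ℤ._* F u) (sym (𝟙-× (P? u) (Q? u))))) ⟩
  ∑ all-vecs (λ u → 𝟙 (P? u ×-dec Q? u) ℤ.* F u)
    ≡⟨ ∑-bij (allVecs-unique n letters-unique) (Uniqueₚ.cartesianProduct⁺ perms-unique bits-unique)
         (λ u → P? u ×-dec Q? u) (λ (v , s) → hasPower? k t v s) F (λ (v , s) → F (Vec.zip v s)) split join to from ⟩
  ∑ (cartesianProduct (perms n) (bits n)) (λ (v , s) → 𝟙 (hasPower? k t v s) ℤ.* F (Vec.zip v s))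
    ≡⟨ ∑-product (perms n) (bits n) _ ⟩
  ∑ (perms n) (λ v → ∑ (bits n) (λ s → 𝟙 (hasPower? k t v s) ℤ.* F (Vec.zip v s))) ∎
  where
  open ≡-Reasoning
  all-vecs = allVecs (letters n) n
  P? : (u : SVec n) → Dec (T (isSignedPermᵇ u))
  P? u = Boolₚ.T? (isSignedPermᵇ u)
  Q? : (u : SVec n) → Dec (T (sEqᵇ (u ^ˢ k) t))
  Q? u = Boolₚ.T? (sEqᵇ (u ^ˢ k) t)
  split : SVec n → Vec (Fin n) n × Vec Bool n
  split u = Vec.map proj₁ u , Vec.map proj₂ u
  join : Vec (Fin n) n × Vec Bool n → SVec n
  join (v , s) = Vec.zip v s
  join-split : ∀ u → join (split u) ≡ u
  join-split u = vec-ext (λ x → trans (Vecₚ.lookup-zip x (Vec.map proj₁ u) (Vec.map proj₂ u))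
    (cong₂ _,_ (Vecₚ.lookup-map x proj₁ u) (Vecₚ.lookup-map x proj₂ u)))
  split-join : ∀ v s → split (join (v , s)) ≡ (v , s)
  split-join v s = cong₂ _,_
    (vec-ext (λ x → trans (Vecₚ.lookup-map x proj₁ (Vec.zip v s)) (cong proj₁ (Vecₚ.lookup-zip x v s))))
    (vec-ext (λ x → trans (Vecₚ.lookup-map x proj₂ (Vec.zip v s)) (cong proj₂ (Vecₚ.lookup-zip x v s))))
  power : ∀ u x → (u ^ˢ k) ! x ≡ (iter (Vec.map proj₁ u !_) k x , parity (Vec.map proj₁ u !_) (Vec.map proj₂ u !_) k x)
  power u x = trans (powers u k x) (cong₂ _,_
    (iter-cong (λ y → sym (Vecₚ.lookup-map y proj₁ u)) k x)
    (trans (parity-map k x) (parity-cong (Vec.map proj₁ u !_) (λ y → sym (Vecₚ.lookup-map y proj₂ u)) k x)))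
    where
    parity-map : ∀ t x → parity (λ y → proj₁ (u ! y)) (λ y → proj₂ (u ! y)) t x ≡ parity (Vec.map proj₁ u !_) (λ y → proj₂ (u ! y)) t x
    parity-map t x = sym (parity-natural (λ y → proj₁ (u ! y)) (Vec.map proj₁ u !_) id _ _ (λ y → Vecₚ.lookup-map y proj₁ u) (λ _ → refl) t x)
  hasPower⇐ : ∀ u → T (sEqᵇ (u ^ˢ k) t) → HasPower k t (Vec.map proj₁ u) (Vec.map proj₂ u)
  hasPower⇐ u eq = (λ x → cong proj₁ (trans (sym (power u x)) (sEq⇒ (u ^ˢ k) t eq x))) ,
                   (λ x → cong proj₂ (trans (sym (power u x)) (sEq⇒ (u ^ˢ k) t eq x)))
  ⇒power : ∀ u → HasPower k t (Vec.map proj₁ u) (Vec.map proj₂ u) → T (sEqᵇ (u ^ˢ k) t)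
  ⇒power u (p , q) = ⇒sEq (u ^ˢ k) t (λ x → trans (power u x) (cong₂ _,_ (p x) (q x)))
  to : ∀ {u} → u ∈ all-vecs → T (isSignedPermᵇ u) × T (sEqᵇ (u ^ˢ k) t) →
    (split u ∈ cartesianProduct (perms n) (bits n)) × HasPower k t (proj₁ (split u)) (proj₂ (split u)) ×
    (join (split u) ≡ u) × (F u ≡ F (join (split u)))
  to {u} _ (p , q) = ∈ₚ.∈-cartesianProduct⁺ (∈-perms⁺ (signedPerm⇒ u p)) (∈-bits _) , hasPower⇐ u q ,
    join-split u , cong F (sym (join-split u))
  from : ∀ {vs} → vs ∈ cartesianProduct (perms n) (bits n) → HasPower k t (proj₁ vs) (proj₂ vs) →
    (join vs ∈ all-vecs) × (T (isSignedPermᵇ (join vs)) × T (sEqᵇ (join vs ^ˢ k) t)) × (split (join vs) ≡ vs)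
  from {v , s} vs∈ h = ∈-allVecs⁺ (join (v , s)) (λ x → ∈-letters _) ,
    (⇒signedPerm (join (v , s)) (subst Perm (sym (cong proj₁ (split-join v s))) (∈-perms⁻ (proj₁ (∈ₚ.∈-cartesianProduct⁻ (perms n) (bits n) vs∈)))) ,
     ⇒power (join (v , s)) (subst (λ (v , s) → HasPower k t v s) (sym (split-join v s)) h)) ,
    split-join v s

-- The search loop local to nextS has no name of its own; it is the solution of the hole below.
mutual
  search : SDesc → ℕ → ℕ → ℕ → ℕ
  search σ j f i = _

  nextS-suc : ∀ σ j f → size σ ∸ j ≡ suc f → nextS σ j ≡ (if inS σ j then j else search σ j f (suc j))
  nextS-suc σ j f eq with size σ ∸ j
  nextS-suc σ j f refl | .(suc f) with suc j
  ... | i = refl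

search-suc : ∀ σ j f i → search σ j (suc f) i ≡ (if inS σ i then i else search σ j f (suc i))
search-suc σ j f i = refl

search-zero : ∀ σ j i → search σ j 0 i ≡ i
search-zero σ j i = refl

nextS-zero : ∀ σ j → size σ ∸ j ≡ 0 → nextS σ j ≡ j
nextS-zero σ j eq with size σ ∸ j
nextS-zero σ j refl | .0 = refl

-- Signed descent sets and the weight of a block.

closed : List Bool → Bool
closed []          = true
closed (b ∷ [])    = true
closed (b ∷ c ∷ r) = (not c ∨ b) ∧ closed (c ∷ r)

trues : List Bool → ℕ
trues []      = 0
trues (b ∷ r) = (if b then 1 else 0) + trues r

descents : List ℕ → List Bool
descents []          = []
descents (x ∷ [])    = []
descents (x ∷ y ∷ r) = (y ℕ.<ᵇ x) ∷ descents (y ∷ r)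

signed : List Bool → ℤ
signed ds = if closed ds then -1ℤ ℤ.^ trues ds else + 0

<ᵇ-true : ∀ {x y} → x < y → (x ℕ.<ᵇ y) ≡ true
<ᵇ-true {x} {y} lt = Equivalence.to Boolₚ.T-≡ (ℕₚ.<⇒<ᵇ lt)

<ᵇ-false : ∀ {x y} → ¬ x < y → (x ℕ.<ᵇ y) ≡ false
<ᵇ-false {x} {y} ge with x ℕ.<ᵇ y in eq
... | false = refl
... | true  = contradiction (ℕₚ.<ᵇ⇒< x y (Equivalence.from Boolₚ.T-≡ eq)) ge

-- The leading `false` stands for an ascent already read; with it in front, closedness forbids every
-- later descent.
inc-signed : ∀ y r → Unique (y ∷ r) → inc (y ∷ r) ≡ signed (false ∷ descents (y ∷ r))
inc-signed y []      _ = inc-[x] y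
inc-signed y (z ∷ r) ((y≢z ∷ _) ∷ uniq) with ℕₚ.<-cmp y z
... | tri≈ _ eq _ = contradiction eq y≢z
... | tri< y<z _ z≮y rewrite <ᵇ-false z≮y = trans (inc-∷∷ y z r)
  (trans (cong (ℤ._* inc (z ∷ r)) (𝟙-yes (y ℕₚ.<? z) y<z)) (trans (ℤₚ.*-identityˡ _) (inc-signed z r uniq)))
... | tri> y≮z _ z<y rewrite <ᵇ-true z<y = trans (inc-∷∷ y z r) (cong (ℤ._* inc (z ∷ r)) (𝟙-no (y ℕₚ.<? z) y≮z))

-- With distinct letters a non-ascent is a descent. Each initial descent contributes a factor -1,
-- and from the first ascent on `inc-signed` takes over.
vee-signed : ∀ ts → Unique ts → vee ts ≡ signed (descents ts)
vee-signed []          _ = refl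
vee-signed (x ∷ [])    _ = refl
vee-signed (x ∷ y ∷ r) ((x≢y ∷ _) ∷ uniq) with ℕₚ.<-cmp x y
... | tri≈ _ eq _ = contradiction eq x≢y
... | tri< x<y _ y≮x rewrite <ᵇ-false y≮x = trans (if-yes (x ℕₚ.<? y) x<y) (inc-signed y r uniq)
... | tri> x≮y _ y<x rewrite <ᵇ-true y<x = trans (if-no (x ℕₚ.<? y) x≮y) (trans (cong ℤ.-_ (vee-signed (y ∷ r) uniq)) (flip (descents (y ∷ r))))
  where
  closed-true : ∀ ds → closed (true ∷ ds) ≡ closed ds
  closed-true []      = refl
  closed-true (c ∷ ds) = cong (_∧ closed (c ∷ ds)) (Boolₚ.∨-zeroʳ (not c))
  flip : ∀ ds → ℤ.- signed ds ≡ signed (true ∷ ds)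
  flip ds rewrite closed-true ds with closed ds
  ... | true  = sym (ℤₚ.-1*i≡-i _)
  ... | false = refl

descents-applyUpTo : ∀ ts → descents ts ≡ applyUpTo (λ j → nth 0 ts (suc j) ℕ.<ᵇ nth 0 ts j) (length ts ∸ 1)
descents-applyUpTo []          = refl
descents-applyUpTo (x ∷ [])    = refl
descents-applyUpTo (x ∷ y ∷ r) = cong ((y ℕ.<ᵇ x) ∷_) (descents-applyUpTo (y ∷ r))

applyUpTo-cong : {g h : ℕ → A} (m : ℕ) → (∀ j → j < m → g j ≡ h j) → applyUpTo g m ≡ applyUpTo h m
applyUpTo-cong zero    eq = refl
applyUpTo-cong (suc m) eq = cong₂ _∷_ (eq 0 (s≤s z≤n)) (applyUpTo-cong m (λ j lt → eq (suc j) (s≤s lt)))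

all-closed : (g : ℕ → Bool) (p : ℕ → Bool) (f : ℕ → ℕ) (m : ℕ) → (∀ j → p (f j) ≡ not (g (suc j)) ∨ g j) →
  all p (applyUpTo f m) ≡ closed (applyUpTo g (suc m))
all-closed g p f zero    eq = refl
all-closed g p f (suc m) eq = cong₂ _∧_ (eq 0) (all-closed (g ∘ suc) p (f ∘ suc) m (eq ∘ suc))

all-applyUpTo⇒ : (p : ℕ → Bool) (f : ℕ → ℕ) (m : ℕ) → T (all p (applyUpTo f m)) → ∀ j → j < m → T (p (f j))
all-applyUpTo⇒ p f (suc m) t zero    lt       = proj₁ (∧⇒ t)
all-applyUpTo⇒ p f (suc m) t (suc j) (s≤s lt) = all-applyUpTo⇒ p (f ∘ suc) m (proj₂ (∧⇒ {p (f 0)} t)) j lt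

⇒all-applyUpTo : (p : ℕ → Bool) (f : ℕ → ℕ) (m : ℕ) → (∀ j → j < m → T (p (f j))) → T (all p (applyUpTo f m))
⇒all-applyUpTo p f zero    h = tt
⇒all-applyUpTo p f (suc m) h = ⇒∧ (h 0 (s≤s z≤n)) (⇒all-applyUpTo p (f ∘ suc) m (λ j lt → h (suc j) (s≤s lt)))

trues-++ : ∀ bs cs → trues (bs ++ cs) ≡ trues bs + trues cs
trues-++ []       cs = refl
trues-++ (b ∷ bs) cs = trans (cong ((if b then 1 else 0) ℕ.+_) (trues-++ bs cs)) (sym (ℕₚ.+-assoc (if b then 1 else 0) _ _))

applyUpTo-++ : (g : ℕ → A) (l m : ℕ) → applyUpTo g (l + m) ≡ applyUpTo g l ++ applyUpTo (λ j → g (l + j)) m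
applyUpTo-++ g zero    m = refl
applyUpTo-++ g (suc l) m = cong (g 0 ∷_) (applyUpTo-++ (g ∘ suc) l m)

length-filter-T : (p : ℕ → Bool) (f : ℕ → ℕ) (m : ℕ) →
  length (filter (λ s → Boolₚ.T? (p s)) (applyUpTo f m)) ≡ trues (applyUpTo (p ∘ f) m)
length-filter-T p f zero    = refl
length-filter-T p f (suc m) with p (f 0)
... | true  = cong suc (length-filter-T p (f ∘ suc) m)
... | false = length-filter-T p (f ∘ suc) m

sizes : List (ℕ × Bool) → List ℕ
sizes = map proj₁

sum-sizes : ∀ γ → partsSum γ ≡ sum (sizes γ)
sum-sizes []            = refl
sum-sizes ((l , b) ∷ γ) = cong (l ℕ.+_) (sum-sizes γ)

Const : List ℕ → List Bool → Set
Const []      S = ⊤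
Const (l ∷ γ) S = All (_≡ nth false S 0) (take l S) × Const γ (drop l S)

const? : ∀ γ S → Dec (Const γ S)
const? []      S = yes tt
const? (l ∷ γ) S = All.all? (λ b → b Boolₚ.≟ nth false S 0) (take l S) ×-dec const? γ (drop l S)

-- For signs constant on the blocks this is the factor (-1)^(n_γ) of the weight.
barSign : List (ℕ × Bool) → List Bool → ℤ
barSign []            S = + 1
barSign ((l , b) ∷ γ) S = sign (nth false S 0 ∧ b) ℤ.* barSign γ (drop l S)

all⇒nth : ∀ {P : A → Set} (d : A) (xs : List A) → All P xs → ∀ {i} → i < length xs → P (nth d xs i)
all⇒nth d (x ∷ xs) (p ∷ _)  {zero}  _        = p
all⇒nth d (x ∷ xs) (_ ∷ ps) {suc i} (s≤s lt) = all⇒nth d xs ps lt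

nth⇒all : ∀ {P : A → Set} (d : A) (xs : List A) → (∀ {i} → i < length xs → P (nth d xs i)) → All P xs
nth⇒all d []       h = []
nth⇒all d (x ∷ xs) h = h {0} (s≤s z≤n) ∷ nth⇒all d xs (λ lt → h (s≤s lt))

length-take-≤ : (l : ℕ) (xs : List A) → l ≤ length xs → length (take l xs) ≡ l
length-take-≤ l xs le = trans (Listₚ.length-take l xs) (ℕₚ.m≤n⇒m⊓n≡m le)

module Weights {n : ℕ} (v : Vec (Fin n) n) (v-perm : Perm v) (s : Vec Bool n) where

  u : SVec n
  u = Vec.zip v s
  σ : SDesc
  σ = sDes u
  ws : List ℕ
  ws = entries v
  S : List Bool
  S = toList s

  get-vals : ∀ {i} → i < n → get (vals u) (suc i) ≡ (suc (nth 0 ws i) , nth false S i)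
  get-vals = go v s
    where
    go : ∀ {m} (v : Vec (Fin n) m) (s : Vec Bool m) {i} → i < m →
      get (map (λ x → (suc (toℕ (proj₁ x)) , proj₂ x)) (toList (Vec.zip v s))) (suc i) ≡ (suc (nth 0 (map toℕ (toList v)) i) , nth false (toList s) i)
    go (a ∷ v) (b ∷ s) {zero}  lt       = refl
    go (a ∷ v) (b ∷ s) {suc i} (s≤s lt) = go v s lt

  inS-inner : ∀ {i} → suc i < n → inS σ (suc i) ≡
    ((suc (nth 0 ws i) , nth false S i) >r (suc (nth 0 ws (suc i)) , nth false S (suc i))) ∨ (nth false S i ∧ not (nth false S (suc i)))
  inS-inner {i} lt = begin
    (suc i ℕ.≡ᵇ n) ∨ ((suc i ℕ.<ᵇ n) ∧ X) ≡⟨ cong₂ (λ p q → p ∨ (q ∧ X)) ≢ᵇ (<ᵇ-true lt) ⟩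
    X ≡⟨ cong₂ (λ a b → (a >r b) ∨ (proj₂ a ∧ not (proj₂ b))) (get-vals (ℕₚ.<-trans (ℕₚ.n<1+n i) lt)) (get-vals lt) ⟩
    _ ∎
    where
    open ≡-Reasoning
    X = (get (vals u) (suc i) >r get (vals u) (suc (suc i))) ∨ (proj₂ (get (vals u) (suc i)) ∧ not (proj₂ (get (vals u) (suc (suc i)))))
    ≢ᵇ : (suc i ℕ.≡ᵇ n) ≡ false
    ≢ᵇ with suc i ℕ.≡ᵇ n in eq
    ... | false = refl
    ... | true  = contradiction (ℕₚ.≡ᵇ⇒≡ (suc i) n (Equivalence.from Boolₚ.T-≡ eq)) (ℕₚ.<⇒≢ lt)

  -- Among barred letters the order <_r is the order of absolute values, as it is among unbarred
  -- ones; so between equal signs only the underlying permutation matters.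
  inS-descent : ∀ {i} → suc i < n → nth false S i ≡ nth false S (suc i) → inS σ (suc i) ≡ (nth 0 ws (suc i) ℕ.<ᵇ nth 0 ws i)
  inS-descent {i} lt eq rewrite inS-inner lt | sym eq with nth false S i
  ... | true  = Boolₚ.∨-identityʳ _
  ... | false = Boolₚ.∨-identityʳ _

  -- Every sign change belongs to S: from unbarred to barred is a descent for <_r, and from barred
  -- to unbarred is included by definition.
  not-inS : ∀ {i} → suc i < n → inS σ (suc i) ≡ false → nth false S i ≡ nth false S (suc i)
  not-inS {i} lt eq with nth false S i | nth false S (suc i) | trans (sym (inS-inner lt)) eq
  ... | true  | true  | _ = refl
  ... | false | false | _ = refl
  ... | true  | false | ()
  ... | false | true  | ()

  eps-sign : ∀ {i} → i < n → eps σ (suc i) ≡ nth false S i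
  eps-sign lt = cong proj₂ (get-vals lt)

  -- The search passes only over positions outside S, where the sign does not change, so the sign
  -- found at the end is the sign at the start. Hence ε̃ is the sign vector itself.
  search-sign : ∀ j f {i} → suc i + f ≡ n → eps σ (search σ j f (suc i)) ≡ nth false S i
  search-sign j zero    {i} eq = trans (cong (eps σ) (search-zero σ j (suc i))) (eps-sign (subst (i <_) (trans (sym (ℕₚ.+-identityʳ (suc i))) eq) (ℕₚ.n<1+n i)))
  search-sign j (suc f) {i} eq = trans (cong (eps σ) (search-suc σ j f (suc i))) (step (inS σ (suc i)) refl)
    where
    eq′ : suc (suc i) + f ≡ n
    eq′ = trans (sym (ℕₚ.+-suc (suc i) f)) eq
    lt : suc i < n
    lt = subst (suc i <_) eq′ (ℕₚ.m≤m+n (suc (suc i)) f)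
    step : ∀ b → inS σ (suc i) ≡ b → eps σ (if b then suc i else search σ j f (suc (suc i))) ≡ nth false S i
    step true  _   = eps-sign (ℕₚ.<-trans (ℕₚ.n<1+n i) lt)
    step false out = trans (search-sign j f eq′) (sym (not-inS lt out))

  epsT-sign : ∀ {i} → i < n → epsT σ (suc i) ≡ nth false S i
  epsT-sign {i} lt = go (n ∸ suc i) refl
    where
    go : ∀ m → n ∸ suc i ≡ m → epsT σ (suc i) ≡ nth false S i
    go zero    eq = trans (cong (eps σ) (nextS-zero σ (suc i) eq)) (eps-sign lt)
    go (suc f) eq = trans (cong (eps σ) (nextS-suc σ (suc i) f eq)) (step (inS σ (suc i)) refl)
      where
      eq′ : suc (suc i) + f ≡ n
      eq′ = trans (sym (ℕₚ.+-suc (suc i) f)) (trans (cong (suc i ℕ.+_) (sym eq)) (ℕₚ.m+[n∸m]≡n lt))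
      step : ∀ b → inS σ (suc i) ≡ b → eps σ (if b then suc i else search σ (suc i) f (suc (suc i))) ≡ nth false S i
      step true  _   = eps-sign lt
      step false out = trans (search-sign (suc i) f eq′) (sym (not-inS (subst (suc i <_) eq′ (ℕₚ.m≤m+n (suc (suc i)) f)) out))

  bit : ℕ → ℕ → Bool
  bit a j = inS σ (suc (a + j))

  -- The last position of a block is a partial sum and belongs to S(γ), so a block of size l has
  -- `l ∸ 1` positions that can lie in S outside S(γ).
  inner : ℕ → List (ℕ × Bool) → ℕ
  inner a []            = 0
  inner a ((l , b) ∷ γ) = trues (applyUpTo (bit a) (l ∸ 1)) + inner (a + l) γ

  partialSums-≥ : ∀ a γ → All (a ≤_) (partialSums a γ)
  partialSums-≥ a []            = []
  partialSums-≥ a ((l , b) ∷ γ) = ℕₚ.m≤m+n a l ∷ All.map (ℕₚ.≤-trans (ℕₚ.m≤m+n a l)) (partialSums-≥ (a + l) γ)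

  any-false : ∀ t xs → All (_≢ t) xs → any (λ r → r ℕ.≡ᵇ t) xs ≡ false
  any-false t []       []        = refl
  any-false t (x ∷ xs) (ne ∷ ps) = cong₂ _∨_ (≡ᵇ-false ne) (any-false t xs ps)
    where
    ≡ᵇ-false : ∀ {x t} → x ≢ t → (x ℕ.≡ᵇ t) ≡ false
    ≡ᵇ-false {x} {t} ne with x ℕ.≡ᵇ t in eq
    ... | false = refl
    ... | true  = contradiction (ℕₚ.≡ᵇ⇒≡ x t (Equivalence.from Boolₚ.T-≡ eq)) ne

  outside : ℕ → List (ℕ × Bool) → ℕ → Bool
  outside a γ j = inS σ (suc (a + j)) ∧ not (any (λ r → r ℕ.≡ᵇ suc (a + j)) (partialSums a γ))

  -- The inner positions of the first block lie below every partial sum, its last position is one of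
  -- them, and the positions beyond need to be tested against the later partial sums only.
  outside≡inner : ∀ a γ → All (λ p → 1 ≤ proj₁ p) γ → trues (applyUpTo (outside a γ) (partsSum γ)) ≡ inner a γ
  outside≡inner a []                _           = refl
  outside≡inner a ((suc l , b) ∷ γ) (_ ∷ pos) = begin
    trues (applyUpTo g (suc l + partsSum γ))
      ≡⟨ cong trues (applyUpTo-++ g (suc l) (partsSum γ)) ⟩
    trues (applyUpTo g (suc l) ++ applyUpTo (λ j → g (suc l + j)) (partsSum γ))
      ≡⟨ trues-++ (applyUpTo g (suc l)) _ ⟩
    trues (applyUpTo g (suc l)) + trues (applyUpTo (λ j → g (suc l + j)) (partsSum γ))
      ≡⟨ cong₂ _+_ (trans (cong trues (sym (Listₚ.applyUpTo-∷ʳ g l))) (trans (trues-++ (applyUpTo g l) (g l ∷ []))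
           (trans (cong₂ _+_ (cong trues (applyUpTo-cong l within)) (cong (λ c → trues (c ∷ [])) last)) (ℕₚ.+-identityʳ _))))
           (trans (cong trues (applyUpTo-cong (partsSum γ) (λ j _ → beyond j))) (outside≡inner (a + suc l) γ pos)) ⟩
    trues (applyUpTo (bit a) l) + inner (a + suc l) γ ∎
    where
    open ≡-Reasoning
    g = outside a ((suc l , b) ∷ γ)
    within : ∀ j → j < l → g j ≡ bit a j
    within j lt = trans (cong (λ c → bit a j ∧ not c) (any-false (suc (a + j)) (partialSums a ((suc l , b) ∷ γ))
        (ne ℕₚ.≤-refl ∷ All.map ne (partialSums-≥ (a + suc l) γ)))) (Boolₚ.∧-identityʳ _)
      where
      ne : ∀ {r} → a + suc l ≤ r → r ≢ suc (a + j)
      ne le refl = ℕₚ.<⇒≱ (ℕₚ.+-monoʳ-< a (s≤s lt)) (subst (a + suc l ≤_) (sym (ℕₚ.+-suc a j)) le)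
    last : g l ≡ false
    last = trans (cong (λ c → bit a l ∧ not (c ∨ any (λ r → r ℕ.≡ᵇ suc (a + l)) (partialSums (a + suc l) γ)))
      (Equivalence.to Boolₚ.T-≡ (ℕₚ.≡⇒≡ᵇ (a + suc l) (suc (a + l)) (ℕₚ.+-suc a l)))) (Boolₚ.∧-zeroʳ _)
    beyond : ∀ j → g (suc l + j) ≡ outside (a + suc l) γ j
    beyond j rewrite sym (ℕₚ.+-assoc a (suc l) j) = cong (λ c → inS σ (suc (a + suc l + j)) ∧ not (c ∨ any (λ r → r ℕ.≡ᵇ suc (a + suc l + j)) (partialSums (a + suc l) γ)))
      (trans (sym (Boolₚ.∨-identityʳ _)) (any-false (suc (a + suc l + j)) (a + suc l ∷ []) (ℕₚ.<⇒≢ (s≤s (ℕₚ.m≤m+n (a + suc l) j)) ∷ [])))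

  sMinus≡inner : ∀ γ → IsSignedComposition n γ → sMinusSγ σ γ ≡ inner 0 γ
  sMinus≡inner γ (pos , total) = trans
    (length-filter-T (λ t → inS σ t ∧ not (any (λ r → r ℕ.≡ᵇ t) (partialSums 0 γ))) (λ j → 1 + j) n)
    (trans (cong (λ m → trues (applyUpTo (outside 0 γ) m)) (sym total)) (outside≡inner 0 γ pos))

  ws-unique : Unique ws
  ws-unique = Uniqueₚ.map⁺ Finₚ.toℕ-injective (subst Unique (trans (sym (tab (v !_))) (cong toList (Vecₚ.tabulate∘lookup v)))
    (Uniqueₚ.tabulate⁺ {f = v !_} (λ {x} {y} → inj v-perm x y)))
    where
    tab : ∀ {m} (f : Fin m → A) → toList (tabulate f) ≡ List.tabulate f
    tab {m = zero}  f = refl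
    tab {m = suc m} f = cong (f zero ∷_) (tab (f ∘ suc))

  S-length : length S ≡ n
  S-length = Vecₚ.length-toList s

  module Block (a l : ℕ) (fits : a + suc l ≤ n) where

    S′ : List Bool
    S′ = take (suc l) (drop a S)
    ws′ : List ℕ
    ws′ = take (suc l) (drop a ws)

    room : ∀ {X : Set} (xs : List X) → length xs ≡ n → suc l ≤ length (drop a xs)
    room xs eq = subst (suc l ≤_) (sym (trans (Listₚ.length-drop a xs) (cong (_∸ a) eq)))
      (ℕₚ.m+n≤o⇒m≤o∸n (suc l) (subst (_≤ n) (ℕₚ.+-comm a (suc l)) fits))

    S′-length : length S′ ≡ suc l
    S′-length = length-take-≤ (suc l) (drop a S) (room S S-length)
    ws′-length : length ws′ ≡ suc l
    ws′-length = length-take-≤ (suc l) (drop a ws) (room ws (length-entries v))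

    nth-S′ : ∀ {j} → j < suc l → nth false S′ j ≡ nth false S (a + j)
    nth-S′ lt = trans (nth-take false (suc l) (drop a S) lt) (nth-drop false a S _)
    nth-ws′ : ∀ {j} → j < suc l → nth 0 ws′ j ≡ nth 0 ws (a + j)
    nth-ws′ lt = trans (nth-take 0 (suc l) (drop a ws) lt) (nth-drop 0 a ws _)

    Constant : Set
    Constant = All (_≡ nth false (drop a S) 0) S′
    constant? : Dec Constant
    constant? = All.all? (λ b → b Boolₚ.≟ nth false (drop a S) 0) S′

    head≡ : nth false (drop a S) 0 ≡ nth false S (a + 0)
    head≡ = nth-drop false a S 0

    in-range : ∀ {j} → j < suc l → a + j < n
    in-range lt = ℕₚ.<-≤-trans (ℕₚ.+-monoʳ-< a lt) fits

    epsT-first : epsT σ (suc a) ≡ nth false (drop a S) 0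
    epsT-first = trans (cong (λ m → epsT σ (suc m)) (sym (ℕₚ.+-identityʳ a))) (trans (epsT-sign (in-range (s≤s z≤n))) (sym head≡))

    first-part : all (λ j → not (inS σ j) ∨ inS σ (j ∸ 1)) (range (a + 2) (a + suc l ∸ 1)) ≡ closed (applyUpTo (bit a) l)
    first-part = trans (cong (λ m → all (λ j → not (inS σ j) ∨ inS σ (j ∸ 1)) (applyUpTo (λ j → a + 2 + j) m)) count≡) (by-size l)
      where
      -- The block has size `suc l`; its l inner positions form `l ∸ 1` neighbouring pairs.
      count≡ : suc (a + suc l ∸ 1) ∸ (a + 2) ≡ l ∸ 1
      count≡ = trans (cong (λ m → suc (m ∸ 1) ∸ (a + 2)) (ℕₚ.+-suc a l))
        (trans (cong (_∸ (a + 2)) (sym (ℕₚ.+-suc a l))) (ℕₚ.[m+n]∸[m+o]≡n∸o a (suc l) 2))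
      by-size : ∀ l → all (λ j → not (inS σ j) ∨ inS σ (j ∸ 1)) (applyUpTo (λ j → a + 2 + j) (l ∸ 1)) ≡ closed (applyUpTo (bit a) l)
      by-size zero    = refl
      by-size (suc l) = all-closed (bit a) _ (λ j → a + 2 + j) l (λ j → cong₂ (λ p q → not (inS σ p) ∨ inS σ q) (shift j) (cong ℕ.pred (trans (shift j) (cong suc (ℕₚ.+-suc a j)))))
        where
        shift : ∀ j → a + 2 + j ≡ suc (a + suc j)
        shift j = trans (ℕₚ.+-assoc a 2 j) (ℕₚ.+-suc a (suc j))

    second : Bool
    second = all (λ j → boolEqᵇ (epsT σ j) (epsT σ (suc a))) (range (suc a) (a + suc l))

    second⇒ : T second → Constant
    second⇒ t = nth⇒all false S′ (λ {j} lt → let lt′ = subst (j <_) S′-length lt in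
      trans (nth-S′ lt′) (trans (sym (epsT-sign (in-range lt′))) (trans
        (boolEq⇒ (all-applyUpTo⇒ _ (λ j → suc a + j) (a + suc l ∸ a) t j (subst (j <_) (sym (ℕₚ.m+n∸m≡n a (suc l))) lt′))) epsT-first)))

    ⇒second : Constant → T second
    ⇒second c = ⇒all-applyUpTo _ (λ j → suc a + j) (a + suc l ∸ a) (λ j lt → let lt′ = subst (j <_) (ℕₚ.m+n∸m≡n a (suc l)) lt in
      ⇒boolEq (trans (epsT-sign (in-range lt′)) (trans (sym (nth-S′ lt′))
        (trans (all⇒nth false S′ c (subst (j <_) (sym S′-length) lt′)) (sym epsT-first)))))

    bits≡ : Constant → applyUpTo (bit a) l ≡ descents ws′
    bits≡ c = sym (trans (descents-applyUpTo ws′) (trans (cong (λ m → applyUpTo (λ j → nth 0 ws′ (suc j) ℕ.<ᵇ nth 0 ws′ j) (m ∸ 1)) ws′-length) (applyUpTo-cong l (λ j lt →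
      trans (cong₂ ℕ._<ᵇ_ (trans (nth-ws′ (s≤s lt)) (cong (nth 0 ws) (ℕₚ.+-suc a j))) (nth-ws′ (ℕₚ.m<n⇒m<1+n lt)))
        (sym (inS-descent (subst (_< n) (ℕₚ.+-suc a j) (in-range (s≤s lt)))
          (trans (same (ℕₚ.m<n⇒m<1+n lt)) (trans (sym (same (s≤s lt))) (cong (nth false S) (ℕₚ.+-suc a j))))))))))
      where
      same : ∀ {j} → j < suc l → nth false S (a + j) ≡ nth false (drop a S) 0
      same {j} lt = trans (sym (nth-S′ lt)) (all⇒nth false S′ c (subst (j <_) (sym S′-length) lt))

    -- On a block of constant sign, membership in S at inner positions is a descent of the
    -- underlying permutation, so the initial segment condition together with its sign is `vee`. On
    -- a block of mixed sign both sides vanish.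
    block-factor : ∀ b →
      (if blockOK σ a (suc l) then -1ℤ ℤ.^ (trues (applyUpTo (bit a) l) + (if epsT σ (suc a) ∧ b then 1 else 0)) else + 0) ≡
      𝟙 constant? ℤ.* (sign (nth false (drop a S) 0 ∧ b) ℤ.* vee ws′)
    block-factor b rewrite first-part | epsT-first with constant?
    ... | no ¬c = trans (cong (λ p → if closed (applyUpTo (bit a) l) ∧ p then X else + 0) no-second)
        (trans (cong (λ p → if p then X else + 0) (Boolₚ.∧-zeroʳ (closed (applyUpTo (bit a) l)))) (sym (cong (ℤ._* _) (𝟙-no (no ¬c) ¬c))))
      where
      X = -1ℤ ℤ.^ (trues (applyUpTo (bit a) l) + (if nth false (drop a S) 0 ∧ b then 1 else 0))
      no-second : all (λ j → boolEqᵇ (epsT σ j) (nth false (drop a S) 0)) (range (suc a) (a + suc l)) ≡ false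
      no-second = trans (cong (λ p → all (λ j → boolEqᵇ (epsT σ j) p) (range (suc a) (a + suc l))) (sym epsT-first)) (go second refl)
        where
        go : ∀ b → second ≡ b → second ≡ false
        go false eq = eq
        go true  eq = contradiction (second⇒ (Equivalence.from Boolₚ.T-≡ eq)) ¬c
    ... | yes c = begin
      (if closed (applyUpTo (bit a) l) ∧ all (λ j → boolEqᵇ (epsT σ j) e₀) (range (suc a) (a + suc l)) then X else + 0)
        ≡⟨ cong (λ p → if closed (applyUpTo (bit a) l) ∧ p then X else + 0)
             (trans (cong (λ p → all (λ j → boolEqᵇ (epsT σ j) p) (range (suc a) (a + suc l))) (sym epsT-first)) (Equivalence.to Boolₚ.T-≡ (⇒second c))) ⟩
      (if closed (applyUpTo (bit a) l) ∧ true then X else + 0)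
        ≡⟨ cong (λ p → if p then X else + 0) (Boolₚ.∧-identityʳ (closed (applyUpTo (bit a) l))) ⟩
      (if closed (applyUpTo (bit a) l) then X else + 0)
        ≡⟨ split (closed (applyUpTo (bit a) l)) (trues (applyUpTo (bit a) l)) (e₀ ∧ b) ⟩
      sign (e₀ ∧ b) ℤ.* signed (applyUpTo (bit a) l)
        ≡⟨ cong (sign (e₀ ∧ b) ℤ.*_) (trans (cong signed (bits≡ c)) (sym (vee-signed ws′ (Uniqueₚ.take⁺ (suc l) (Uniqueₚ.drop⁺ a ws-unique))))) ⟩
      sign (e₀ ∧ b) ℤ.* vee ws′
        ≡⟨ trans (cong (ℤ._* (sign (e₀ ∧ b) ℤ.* vee ws′)) (𝟙-yes (yes c) c)) (ℤₚ.*-identityˡ _) ⟨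
      𝟙 (yes c) ℤ.* (sign (e₀ ∧ b) ℤ.* vee ws′) ∎
      where
      open ≡-Reasoning
      e₀ = nth false (drop a S) 0
      X = -1ℤ ℤ.^ (trues (applyUpTo (bit a) l) + (if e₀ ∧ b then 1 else 0))
      split : ∀ cl m e → (if cl then -1ℤ ℤ.^ (m + (if e then 1 else 0)) else + 0) ≡ sign e ℤ.* (if cl then -1ℤ ℤ.^ m else + 0)
      split false m e     = sym (ℤₚ.*-zeroʳ (sign e))
      split true  m false = trans (cong (-1ℤ ℤ.^_) (ℕₚ.+-identityʳ m)) (sym (ℤₚ.*-identityˡ _))
      split true  m true  = cong (-1ℤ ℤ.^_) (ℕₚ.+-comm m 1)

  blocks-weight : ∀ a γ → All (λ p → 1 ≤ proj₁ p) γ → a + partsSum γ ≤ n →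
    (if allBlocksOK σ a γ then -1ℤ ℤ.^ (inner a γ + nGamma σ a γ) else + 0) ≡
    𝟙 (const? (sizes γ) (drop a S)) ℤ.* (barSign γ (drop a S) ℤ.* wordWeight (slots (sizes γ)) (drop a ws))
  blocks-weight a []                _           _    = sym (trans (cong (ℤ._* (+ 1 ℤ.* + 1)) (𝟙-yes (yes tt) tt)) refl)
  blocks-weight a ((suc l , b) ∷ γ) (_ ∷ pos) fits = begin
    (if ok ∧ oks then -1ℤ ℤ.^ (i + is + (g + gs)) else + 0)
      ≡⟨ factor ok oks i is g gs ⟩
    (if ok then -1ℤ ℤ.^ (i + g) else + 0) ℤ.* (if oks then -1ℤ ℤ.^ (is + gs) else + 0)
      ≡⟨ cong₂ ℤ._*_ (Bl.block-factor b) (blocks-weight (a + suc l) γ pos (subst (_≤ n) (sym (ℕₚ.+-assoc a (suc l) (partsSum γ))) fits)) ⟩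
    (c ℤ.* (d ℤ.* vee Bl.ws′)) ℤ.* (𝟙 (const? (sizes γ) (drop (a + suc l) S)) ℤ.* (barSign γ (drop (a + suc l) S) ℤ.* wordWeight (slots (sizes γ)) (drop (a + suc l) ws)))
      ≡⟨ cong₂ (λ S″ w″ → (c ℤ.* (d ℤ.* vee Bl.ws′)) ℤ.* (𝟙 (const? (sizes γ) S″) ℤ.* (barSign γ S″ ℤ.* wordWeight (slots (sizes γ)) w″)))
           (sym (Listₚ.drop-drop a (suc l) S)) (sym (Listₚ.drop-drop a (suc l) ws)) ⟩
    (c ℤ.* (d ℤ.* vee Bl.ws′)) ℤ.* (c′ ℤ.* (d′ ℤ.* w′))
      ≡⟨ shuffle c d (vee Bl.ws′) c′ d′ w′ ⟩
    (c ℤ.* c′) ℤ.* ((d ℤ.* d′) ℤ.* (vee Bl.ws′ ℤ.* w′))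
      ≡⟨ cong₂ (λ p q → p ℤ.* ((d ℤ.* d′) ℤ.* q)) (sym (𝟙-× Bl.constant? (const? (sizes γ) (drop (suc l) (drop a S)))))
           (sym (wordWeight-empty (suc l) ((pow , suc l) ∷ slots (sizes γ)) (drop a ws))) ⟩
    𝟙 (const? (suc l ∷ sizes γ) (drop a S)) ℤ.* ((d ℤ.* d′) ℤ.* wordWeight (slots (suc l ∷ sizes γ)) (drop a ws)) ∎
    where
    open ≡-Reasoning
    module Bl = Block a l (ℕₚ.≤-trans (ℕₚ.+-monoʳ-≤ a (ℕₚ.m≤m+n (suc l) (partsSum γ))) fits)
    ok  = blockOK σ a (suc l)
    oks = allBlocksOK σ (a + suc l) γ
    i   = trues (applyUpTo (bit a) l)
    is  = inner (a + suc l) γ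
    g   = if epsT σ (suc a) ∧ b then 1 else 0
    gs  = nGamma σ (a + suc l) γ
    c   = 𝟙 Bl.constant?
    d   = sign (nth false (drop a S) 0 ∧ b)
    c′  = 𝟙 (const? (sizes γ) (drop (suc l) (drop a S)))
    d′  = barSign γ (drop (suc l) (drop a S))
    w′  = wordWeight (slots (sizes γ)) (drop (suc l) (drop a ws))
    factor : ∀ p q i is g gs → (if p ∧ q then -1ℤ ℤ.^ (i + is + (g + gs)) else + 0) ≡
      (if p then -1ℤ ℤ.^ (i + g) else + 0) ℤ.* (if q then -1ℤ ℤ.^ (is + gs) else + 0)
    factor true  true  i is g gs = trans (cong (-1ℤ ℤ.^_) (interchange i is g gs)) (ℤₚ.^-distribˡ-+-* -1ℤ (i + g) (is + gs))
      where
      interchange : ∀ i is g gs → i + is + (g + gs) ≡ i + g + (is + gs)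
      interchange i is g gs = trans (ℕₚ.+-assoc i is (g + gs)) (trans (cong (i ℕ.+_) (trans (sym (ℕₚ.+-assoc is g gs))
        (trans (cong (ℕ._+ gs) (ℕₚ.+-comm is g)) (ℕₚ.+-assoc g is gs)))) (sym (ℕₚ.+-assoc i g (is + gs))))
    factor true  false i is g gs = sym (ℤₚ.*-zeroʳ (-1ℤ ℤ.^ (i + g)))
    factor false q     i is g gs = sym (ℤₚ.*-zeroˡ (if q then -1ℤ ℤ.^ (is + gs) else + 0))
    shuffle : ∀ c d v c′ d′ w′ → (c ℤ.* (d ℤ.* v)) ℤ.* (c′ ℤ.* (d′ ℤ.* w′)) ≡ (c ℤ.* c′) ℤ.* ((d ℤ.* d′) ℤ.* (v ℤ.* w′))
    shuffle = solve-∀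

  -- The weight separates into factors that see only the signs and a factor that sees only the
  -- permutation; this allows summation over the permutations for fixed signs.
  wt-formula : ∀ γ → IsSignedComposition n γ →
    wt γ σ ≡ 𝟙 (const? (sizes γ) S) ℤ.* (barSign γ S ℤ.* wordWeight (slots (sizes γ)) ws)
  wt-formula γ comp@(pos , total) = trans
    (cong (λ m → if allBlocksOK σ 0 γ then -1ℤ ℤ.^ (m + nGamma σ 0 γ) else + 0) (sMinus≡inner γ comp))
    (blocks-weight 0 γ pos (ℕₚ.≤-reflexive total))

-- The canonical element of a signed cycle type.

χL : List Bool → List Bool → ℤ
χL []      _        = + 1
χL (_ ∷ _) []       = + 1
χL (a ∷ S) (b ∷ bs) = sign (a ∧ b) ℤ.* χL S bs

χ-toList : (s b : Vec Bool n) → χ (s !_) (b !_) ≡ χL (toList s) (toList b)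
χ-toList []      []      = refl
χ-toList (x ∷ s) (y ∷ b) = cong (sign (x ∧ y) ℤ.*_) (χ-toList s b)

-- Only the last letter of a canonical block can be barred, so the pairing picks out a single sign
-- of the block.
χL-block : ∀ (f : ℕ → ℕ × Bool) (m : ℕ) y b rest S → (∀ j → proj₂ (f j) ≡ false) → m < length S →
  χL S (map proj₂ (applyUpTo f m ++ (y , b) ∷ rest)) ≡ sign (nth false S m ∧ b) ℤ.* χL (drop (suc m) S) (map proj₂ rest)
χL-block f zero    y b rest (a ∷ S) unbarred lt       = refl
χL-block f (suc m) y b rest (a ∷ S) unbarred (s≤s lt) = trans
  (cong₂ ℤ._*_ (trans (cong (λ c → sign (a ∧ c)) (unbarred 0)) (cong sign (Boolₚ.∧-zeroʳ a))) (χL-block (f ∘ suc) m y b rest S (unbarred ∘ suc) lt))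
  (ℤₚ.*-identityˡ _)

-- The pairing reads the last sign of each block and `barSign` the first; constancy on the block
-- identifies them.
χL-canon : ∀ a γ S → All (λ p → 1 ≤ proj₁ p) γ → length S ≡ partsSum γ → Const (sizes γ) S →
  χL S (map proj₂ (canonBlocks a γ)) ≡ barSign γ S
χL-canon a []                []      _         _   _ = refl
χL-canon a ((suc l , b) ∷ γ) S (_ ∷ pos) len (constant , rest) = trans
  (χL-block (λ j → (a + j + 2 , false)) l (a + 1) b (canonBlocks (a + suc l) γ) S (λ _ → refl) l<)
  (cong₂ (λ c d → sign (c ∧ b) ℤ.* d)
    (trans (sym (nth-take false (suc l) S (ℕₚ.n<1+n l))) (all⇒nth false (take (suc l) S) constant
      (subst (l <_) (sym (length-take-≤ (suc l) S l<)) (ℕₚ.n<1+n l))))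
    (χL-canon (a + suc l) γ (drop (suc l) S) pos
      (trans (Listₚ.length-drop (suc l) S) (trans (cong (_∸ suc l) len) (ℕₚ.m+n∸m≡n (suc l) (partsSum γ)))) rest))
  where
  l< : l < length S
  l< = subst (l <_) (sym len) (ℕₚ.m≤m+n (suc l) (partsSum γ))

nth-applyUpTo : (d : A) (f : ℕ → A) (m : ℕ) {o : ℕ} → o < m → nth d (applyUpTo f m) o ≡ f o
nth-applyUpTo d f (suc m) {zero}  _        = refl
nth-applyUpTo d f (suc m) {suc o} (s≤s lt) = nth-applyUpTo d (f ∘ suc) m lt

canon-skip : ∀ a l b γ j → nth (0 , false) (canonBlocks a ((suc l , b) ∷ γ)) (suc l + j) ≡ nth (0 , false) (canonBlocks (a + suc l) γ) j
canon-skip a l b γ j = trans (cong (λ m → nth (0 , false) (canonBlocks a ((suc l , b) ∷ γ)) m)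
    (trans (sym (ℕₚ.+-suc l j)) (cong (ℕ._+ suc j) (sym (Listₚ.length-applyUpTo (λ j → (a + j + 2 , false)) l)))))
  (nth-++ʳ (0 , false) (applyUpTo (λ j → (a + j + 2 , false)) l) _ (suc j))

-- Values are counted from 1 and positions from 0, so the image of position j, which is the next
-- position, appears as the value j + 2.
canon-inside : ∀ a γ → All (λ p → 1 ≤ proj₁ p) γ → ∀ i {o} → suc o < List.lookup (sizes γ) i →
  proj₁ (nth (0 , false) (canonBlocks a γ) (start (sizes γ) i + o)) ≡ suc (suc (a + (start (sizes γ) i + o)))
canon-inside a ((suc l , b) ∷ γ) _ zero {o} (s≤s lt) = trans
  (cong proj₁ (trans (nth-++ˡ (0 , false) (applyUpTo (λ j → (a + j + 2 , false)) l) _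
    (subst (o <_) (sym (Listₚ.length-applyUpTo (λ j → (a + j + 2 , false)) l)) lt)) (nth-applyUpTo (0 , false) (λ j → (a + j + 2 , false)) l lt)))
  (ℕₚ.+-comm (a + o) 2)
canon-inside a ((suc l , b) ∷ γ) (_ ∷ pos) (suc i) {o} lt = trans
  (cong proj₁ (trans (cong (nth (0 , false) (canonBlocks a ((suc l , b) ∷ γ))) (ℕₚ.+-assoc (suc l) (start (sizes γ) i) o))
    (canon-skip a l b γ (start (sizes γ) i + o))))
  (trans (canon-inside (a + suc l) γ pos i lt) (cong (λ m → suc (suc m))
    (trans (ℕₚ.+-assoc a (suc l) _) (cong (a ℕ.+_) (sym (ℕₚ.+-assoc (suc l) (start (sizes γ) i) o))))))

canon-last : ∀ a γ → All (λ p → 1 ≤ proj₁ p) γ → ∀ i {o} → suc o ≡ List.lookup (sizes γ) i →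
  proj₁ (nth (0 , false) (canonBlocks a γ) (start (sizes γ) i + o)) ≡ suc (a + (start (sizes γ) i + 0))
canon-last a ((suc l , b) ∷ γ) _ zero {.l} refl = trans
  (cong proj₁ (trans (cong (nth (0 , false) (canonBlocks a ((suc l , b) ∷ γ)))
      (trans (sym (ℕₚ.+-identityʳ l)) (cong (ℕ._+ 0) (sym (Listₚ.length-applyUpTo (λ j → (a + j + 2 , false)) l)))))
    (nth-++ʳ (0 , false) (applyUpTo (λ j → (a + j + 2 , false)) l) _ 0)))
  (trans (ℕₚ.+-comm a 1) (cong suc (sym (ℕₚ.+-identityʳ a))))
canon-last a ((suc l , b) ∷ γ) (_ ∷ pos) (suc i) {o} eq = trans
  (cong proj₁ (trans (cong (nth (0 , false) (canonBlocks a ((suc l , b) ∷ γ))) (ℕₚ.+-assoc (suc l) (start (sizes γ) i) o))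
    (canon-skip a l b γ (start (sizes γ) i + o))))
  (trans (canon-last (a + suc l) γ pos i eq) (cong suc
    (trans (ℕₚ.+-assoc a (suc l) _) (cong (a ℕ.+_) (sym (ℕₚ.+-assoc (suc l) (start (sizes γ) i) 0))))))

-- the signs of the labels of slots γ when the blocks of γ have the constant signs S
slotSigns : List ℕ → List Bool → List Bool
slotSigns []      S = []
slotSigns (l ∷ γ) S = replicate (suc l) (nth false S 0) ++ slotSigns γ (drop l S)

-- Labels are absolute indices into `E`. Carrying along the part `P` already read makes recursion on
-- the blocks possible.
module SlotSigns (E : List Bool) where

  at : ∀ (P : List Bool) l b Z → E ≡ P ++ replicate (suc l) b ++ Z → ∀ {i} → i ≤ l → nth false E (length P + i) ≡ b
  at P l b Z refl {i} i≤l = trans (nth-++ʳ false P _ i) (nth-before false b (suc l) Z (s≤s i≤l))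

  advance : ∀ (P : List Bool) l b Z → E ≡ P ++ replicate (suc l) b ++ Z → E ≡ (P ++ replicate (suc l) b) ++ Z
  advance P l b Z eq = trans eq (sym (Listₚ.++-assoc P (replicate (suc l) b) Z))

  advance-length : ∀ (P : List Bool) l (b : Bool) → length (P ++ replicate (suc l) b) ≡ suc (length P + l)
  advance-length P l b = trans (Listₚ.length-++ P) (trans (cong (length P ℕ.+_) (Listₚ.length-replicate (suc l))) (ℕₚ.+-suc (length P) l))

  labels-signs : ∀ P γ S → E ≡ P ++ slotSigns γ S → length S ≡ sum γ → Const γ S →
    map (nth false E) (labels (length P) (slots γ)) ≡ S
  labels-signs P []      []      eq len _ = refl
  labels-signs P (l ∷ γ) S eq len (constant , rest) = begin
    map ε (labels (length P) (slots (l ∷ γ)))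
      ≡⟨ cong (map ε) (labels-slots-∷ (length P) l γ) ⟩
    map ε (replicate l (length P + l) ++ labels (suc (length P + l)) (slots γ))
      ≡⟨ Listₚ.map-++ ε (replicate l (length P + l)) _ ⟩
    map ε (replicate l (length P + l)) ++ map ε (labels (suc (length P + l)) (slots γ))
      ≡⟨ cong₂ _++_ (trans (Listₚ.map-replicate ε l (length P + l)) (trans (cong (replicate l) (at P l b _ eq ℕₚ.≤-refl)) (replicated l S constant l≤)))
           (trans (cong (λ m → map ε (labels m (slots γ))) (sym (advance-length P l b)))
             (labels-signs (P ++ replicate (suc l) b) γ (drop l S) (advance P l b _ eq)
               (trans (Listₚ.length-drop l S) (trans (cong (_∸ l) len) (ℕₚ.m+n∸m≡n l (sum γ)))) rest)) ⟩
    take l S ++ drop l S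
      ≡⟨ Listₚ.take++drop≡id l S ⟩
    S ∎
    where
    open ≡-Reasoning
    ε = nth false E
    b = nth false S 0
    l≤ : l ≤ length S
    l≤ = subst (l ≤_) (sym len) (ℕₚ.m≤m+n l (sum γ))
    replicated : ∀ {b} l S → All (_≡ b) (take l S) → l ≤ length S → replicate l b ≡ take l S
    replicated zero    S       _           _        = refl
    replicated (suc l) (x ∷ S) (refl ∷ ps) (s≤s le) = cong (x ∷_) (replicated l S ps le)

  slotted : ∀ {n} κ M S₀ (S₀-length : length S₀ ≡ n) P γ S → E ≡ P ++ slotSigns γ S →
    Characters.Slotted κ M (nth false E) S₀ S₀-length (length P) γ
  slotted κ M S₀ len P []      S eq = tt
  slotted κ M S₀ len P (l ∷ γ) S eq = (λ i i<l → trans (at P l b _ eq (ℕₚ.<⇒≤ i<l)) (sym (at P l b _ eq ℕₚ.≤-refl))) ,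
    subst (λ m → Characters.Slotted κ M (nth false E) S₀ len m γ) (advance-length P l b)
      (slotted κ M S₀ len (P ++ replicate (suc l) b) γ (drop l S) (advance P l b _ eq))
    where
    b = nth false S 0

const-from-positions : ∀ γ S → length S ≡ sum γ → (∀ i {o} → o < List.lookup γ i → nth false S (start γ i + o) ≡ nth false S (start γ i + 0)) → Const γ S
const-from-positions []      S len h = tt
const-from-positions (l ∷ γ) S len h =
  nth⇒all false (take l S) (λ {i} lt → let lt′ = subst (i <_) (length-take-≤ l S l≤) lt in trans (nth-take false l S lt′) (h zero lt′)) ,
  const-from-positions γ (drop l S) (trans (Listₚ.length-drop l S) (trans (cong (_∸ l) len) (ℕₚ.m+n∸m≡n l (sum γ))))
    (λ i {o} lt → trans (shift i o) (trans (h (suc i) lt) (sym (shift i 0))))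
  where
  l≤ : l ≤ length S
  l≤ = subst (l ≤_) (sym len) (ℕₚ.m≤m+n l (sum γ))
  shift : ∀ i o → nth false (drop l S) (start γ i + o) ≡ nth false S (start (l ∷ γ) (suc i) + o)
  shift i o = trans (nth-drop false l S (start γ i + o)) (cong (nth false S) (sym (ℕₚ.+-assoc l (start γ i) o)))

-- Comparison of the two sides.

module Final (κ n : ℕ) (γ : List (ℕ × Bool)) (comp : IsSignedComposition n γ) (w : SVec n) (w-canon : vals w ≡ canon γ) where

  k : ℕ
  k = suc κ

  γₛ : List ℕ
  γₛ = sizes γ

  γₛ-pos : All (1 ≤_) γₛ
  γₛ-pos = Allₚ.map⁺ (proj₁ comp)

  γₛ-sum : sum γₛ ≡ n
  γₛ-sum = trans (sym (sum-sizes γ)) (proj₂ comp)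

  c : Fin n → Fin n
  c x = proj₁ (w ! x)

  β : Fin n → Bool
  β x = proj₂ (w ! x)

  c-canon : ∀ x → suc (toℕ (c x)) ≡ proj₁ (nth (0 , false) (canon γ) (toℕ x))
  c-canon x = trans (sym (cong (λ a → suc (toℕ (proj₁ a))) (nth-toList (w ! x) w x)))
    (cong proj₁ (trans (sym (nth-map (λ a → (suc (toℕ (proj₁ a)) , proj₂ a)) (w ! x) (0 , false) (toList w)
      (subst (toℕ x <_) (sym (Vecₚ.length-toList w)) (Finₚ.toℕ<n x)))) (cong (λ l → nth (0 , false) l (toℕ x)) w-canon)))

  c-step : ∀ x i o → toℕ x ≡ start γₛ i + o → suc o < List.lookup γₛ i → toℕ (c x) ≡ start γₛ i + suc o
  c-step x i o eq lt = ℕₚ.suc-injective (trans (c-canon x) (trans (cong (λ m → proj₁ (nth (0 , false) (canon γ) m)) eq)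
    (trans (canon-inside 0 γ (proj₁ comp) i lt) (cong suc (sym (ℕₚ.+-suc (start γₛ i) o))))))

  c-wrap : ∀ x i o → toℕ x ≡ start γₛ i + o → suc o ≡ List.lookup γₛ i → toℕ (c x) ≡ start γₛ i + 0
  c-wrap x i o eq eq′ = ℕₚ.suc-injective (trans (c-canon x) (trans (cong (λ m → proj₁ (nth (0 , false) (canon γ) m)) eq)
    (canon-last 0 γ (proj₁ comp) i eq′)))

  β-list : toList (Vec.map proj₂ w) ≡ map proj₂ (canon γ)
  β-list = trans (Vecₚ.toList-map proj₂ w) (trans (Listₚ.map-∘ (toList w)) (cong (map proj₂) w-canon))

  χ-barSign : ∀ s → Const γₛ (toList s) → χ (s !_) β ≡ barSign γ (toList s)
  χ-barSign s con = trans (χ-cong (λ _ → refl) (λ x → sym (Vecₚ.lookup-map x proj₂ w)))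
    (trans (χ-toList s (Vec.map proj₂ w)) (trans (cong (χL (toList s)) β-list)
      (χL-canon 0 γ (toList s) (proj₁ comp) (trans (Vecₚ.length-toList s) (sym (proj₂ comp))) con)))

  CRoot : Vec (Fin n) n → Set
  CRoot v = ∀ x → iter (v !_) k x ≡ c x

  cRoot? : ∀ v → Dec (CRoot v)
  cRoot? v = Finₚ.all? (λ x → iter (v !_) k x Finₚ.≟ c x)

  solves? : (v : Vec (Fin n) n) (s : Vec Bool n) (b : Fin n → Bool) → Dec (∀ x → parity (v !_) (s !_) k x ≡ b x)
  solves? v s b = Finₚ.all? (λ x → parity (v !_) (s !_) k x Boolₚ.≟ b x)

  0₂ : Fin n → Bool
  0₂ _ = false

  -- Since s is constant on the blocks, its signs can be attached to the labels: with ε read off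
  -- `slotSigns`, the sign of a position is the ε of its label, and `core` applies.
  core-const : ∀ s → Const γₛ (toList s) →
    ∑ (perms n) (λ v → 𝟙 (hasPower? k (e n) v s) ℤ.* wordWeight (slots γₛ) (entries v)) ≡
    ∑ (perms n) (λ v → 𝟙 (cRoot? v ×-dec solves? v s 0₂))
  core-const s con = trans
    (∑-cong (perms n) (λ v → cong (ℤ._* wordWeight (slots γₛ) (entries v)) (𝟙-cong (hasPower? k (e n) v s) (Ch.torsion? v)
      (λ (p , q) → (λ x → trans (p x) (id-at₁ x)) , λ x → trans (sym (sgn≡ v x)) (trans (q x) (id-at₂ x)))
      (λ (p , q) → (λ x → trans (p x) (sym (id-at₁ x))) , λ x → trans (sgn≡ v x) (trans (q x) (sym (id-at₂ x)))))))
    (trans (sym (Cy.core (slotted κ M S S-length [] γₛ S refl)))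
      (∑-cong (perms n) (λ v → 𝟙-cong (Cy.cycleRoot? v) (cRoot? v ×-dec solves? v s 0₂)
        (λ (p , q) → p , λ x → trans (sgn≡ v x) (q x)) (λ (p , q) → p , λ x → trans (sym (sgn≡ v x)) (q x)))))
    where
    S : List Bool
    S = toList s
    S-length : length S ≡ n
    S-length = Vecₚ.length-toList s
    M : ℕ
    M = length (slots γₛ)
    E : List Bool
    E = slotSigns γₛ S
    open SlotSigns E
    module Ch = Characters κ M (nth false E) S S-length
    module Cy = Cycles κ M (nth false E) S S-length γₛ γₛ-pos γₛ-sum c c-step c-wrap
      (refl , labels-signs [] γₛ S refl (trans S-length (sym γₛ-sum)) con)
    sgn≡ : ∀ v x → parity (v !_) (s !_) k x ≡ parity (v !_) Ch.sgn k x
    sgn≡ v x = parity-cong (v !_) (λ x → sym (nth-toList false s x)) k x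
    id-at₁ : ∀ x → proj₁ (e n ! x) ≡ x
    id-at₁ x = cong proj₁ (Vecₚ.lookup∘tabulate (λ i → (i , false)) x)
    id-at₂ : ∀ x → proj₂ (e n ! x) ≡ false
    id-at₂ x = cong proj₂ (Vecₚ.lookup∘tabulate (λ i → (i , false)) x)

  -- T_v s = 0 forces s to be invariant under v^k = c.
  root⇒const : ∀ v s → CRoot v → (∀ x → parity (v !_) (s !_) k x ≡ false) → Const γₛ (toList s)
  root⇒const v s root good = const-from-positions γₛ (toList s) (trans (Vecₚ.length-toList s) (sym γₛ-sum)) along
    where
    xor-false : ∀ {a b} → a xor b ≡ false → a ≡ b
    xor-false {false} {false} _ = refl
    xor-false {true}  {true}  _ = refl
    -- The sums T_v s at x and at v x share all terms except s x in the first and s (v^k x) in the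
    -- second. As both sums vanish, these two terms agree.
    invariant : ∀ x → s ! c x ≡ s ! x
    invariant x = sym (trans (xor-false {s ! x} (good x)) (trans (xor-false {parity (v !_) (s !_) κ (v ! x)} (trans (sym (parity-snoc (v !_) (s !_) κ (v ! x))) (good (v ! x))))
      (cong (s !_) (trans (iter-comm (v !_) κ x) (root x)))))
    value : ∀ {i} (lt : i < n) → nth false (toList s) i ≡ s ! fromℕ< lt
    value lt = trans (cong (nth false (toList s)) (sym (Finₚ.toℕ-fromℕ< lt))) (nth-toList false s (fromℕ< lt))
    along : ∀ i {o} → o < List.lookup γₛ i → nth false (toList s) (start γₛ i + o) ≡ nth false (toList s) (start γₛ i + 0)
    along i {zero}  lt = refl
    along i {suc o} lt = trans (trans (value hi) (trans (cong (s !_) (Finₚ.toℕ-injective (trans (Finₚ.toℕ-fromℕ< hi)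
        (sym (c-step (fromℕ< lo) i o (Finₚ.toℕ-fromℕ< lo) lt))))) (trans (invariant (fromℕ< lo)) (sym (value lo)))))
      (along i (ℕₚ.<-trans (ℕₚ.n<1+n o) lt))
      where
      hi : start γₛ i + suc o < n
      hi = subst (_ <_) γₛ-sum (start-bound γₛ i lt)
      lo : start γₛ i + o < n
      lo = subst (_ <_) γₛ-sum (start-bound γₛ i (ℕₚ.<-trans (ℕₚ.n<1+n o) lt))

  -- Fourier inversion, applied for each v, moves the bars of `w` from the condition on s into a
  -- character, so that the sum runs over kernels, as on the other side.
  lhs : + rB n k w ≡ ∑ (perms n) (λ v → ∑ (bits n) (λ s → 𝟙 (cRoot? v) ℤ.* (𝟙 (solves? v s 0₂) ℤ.* χ (s !_) β)))
  lhs = begin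
    + rB n k w
      ≡⟨ length-∑ (filter (λ u → Boolₚ.T? (sEqᵇ (u ^ˢ k) w)) (B n)) ⟩
    ∑ (filter (λ u → Boolₚ.T? (sEqᵇ (u ^ˢ k) w)) (B n)) (λ _ → + 1)
      ≡⟨ ∑-roots n k w (λ _ → + 1) ⟩
    ∑ (perms n) (λ v → ∑ (bits n) (λ s → 𝟙 (hasPower? k w v s) ℤ.* + 1))
      ≡⟨ ∑-cong∈ (perms n) (λ {v} v∈ → trans
           (∑-cong (bits n) (λ s → trans (ℤₚ.*-identityʳ (𝟙 (hasPower? k w v s))) (𝟙-× (cRoot? v) (solves? v s β))))
           (trans (∑-*ˡ (bits n) (𝟙 (cRoot? v)) (λ s → 𝟙 (solves? v s β)))
             (trans (cong (𝟙 (cRoot? v) ℤ.*_) (Fourier.fourier κ v (∈-perms⁻ v∈) β)) (sym (∑-*ˡ (bits n) (𝟙 (cRoot? v)) (λ s → 𝟙 (solves? v s 0₂) ℤ.* χ (s !_) β)))))) ⟩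
    ∑ (perms n) (λ v → ∑ (bits n) (λ s → 𝟙 (cRoot? v) ℤ.* (𝟙 (solves? v s 0₂) ℤ.* χ (s !_) β))) ∎
    where open ≡-Reasoning

  -- The sums are interchanged so that `core-const` acts for each fixed s. Afterwards v^k = c and
  -- T_v s = 0 already force s to be constant on the blocks, and the factor that demands it can be
  -- removed.
  rhs : ∑ (rootsOfUnity n k) (λ u → wt γ (sDes u)) ≡
    ∑ (perms n) (λ v → ∑ (bits n) (λ s → 𝟙 (cRoot? v) ℤ.* (𝟙 (solves? v s 0₂) ℤ.* χ (s !_) β)))
  rhs = begin
    ∑ (rootsOfUnity n k) (λ u → wt γ (sDes u))
      ≡⟨ ∑-roots n k (e n) (λ u → wt γ (sDes u)) ⟩
    ∑ (perms n) (λ v → ∑ (bits n) (λ s → 𝟙 (hasPower? k (e n) v s) ℤ.* wt γ (sDes (Vec.zip v s))))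
      ≡⟨ ∑-cong∈ (perms n) (λ {v} v∈ → ∑-cong (bits n) (λ s → trans
           (cong (𝟙 (hasPower? k (e n) v s) ℤ.*_) (Weights.wt-formula v (∈-perms⁻ v∈) s γ comp))
           (shuffle (𝟙 (hasPower? k (e n) v s)) (𝟙 (const? γₛ (toList s))) (barSign γ (toList s)) (ww v)))) ⟩
    ∑ (perms n) (λ v → ∑ (bits n) (λ s → (𝟙 (const? γₛ (toList s)) ℤ.* barSign γ (toList s)) ℤ.* (𝟙 (hasPower? k (e n) v s) ℤ.* ww v)))
      ≡⟨ ∑-swap (perms n) (bits n) _ ⟩
    ∑ (bits n) (λ s → ∑ (perms n) (λ v → (𝟙 (const? γₛ (toList s)) ℤ.* barSign γ (toList s)) ℤ.* (𝟙 (hasPower? k (e n) v s) ℤ.* ww v)))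
      ≡⟨ ∑-cong (bits n) per-sign ⟩
    ∑ (bits n) (λ s → ∑ (perms n) (λ v → 𝟙 (const? γₛ (toList s)) ℤ.* (χ (s !_) β ℤ.* 𝟙 (cRoot? v ×-dec solves? v s 0₂))))
      ≡⟨ ∑-swap (bits n) (perms n) _ ⟩
    ∑ (perms n) (λ v → ∑ (bits n) (λ s → 𝟙 (const? γₛ (toList s)) ℤ.* (χ (s !_) β ℤ.* 𝟙 (cRoot? v ×-dec solves? v s 0₂))))
      ≡⟨ ∑-cong (perms n) (λ v → ∑-cong (bits n) (drop-const v)) ⟩
    ∑ (perms n) (λ v → ∑ (bits n) (λ s → 𝟙 (cRoot? v) ℤ.* (𝟙 (solves? v s 0₂) ℤ.* χ (s !_) β))) ∎
    where
    open ≡-Reasoning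
    ww : Vec (Fin n) n → ℤ
    ww v = wordWeight (slots γₛ) (entries v)
    shuffle : ∀ a b c d → a ℤ.* (b ℤ.* (c ℤ.* d)) ≡ (b ℤ.* c) ℤ.* (a ℤ.* d)
    shuffle = solve-∀
    shuffle′ : ∀ a b c → a ℤ.* (b ℤ.* c) ≡ c ℤ.* (a ℤ.* b)
    shuffle′ = solve-∀
    shuffle″ : ∀ a b c → a ℤ.* b ℤ.* c ≡ a ℤ.* (b ℤ.* c)
    shuffle″ = solve-∀
    per-sign : ∀ s → ∑ (perms n) (λ v → (𝟙 (const? γₛ (toList s)) ℤ.* barSign γ (toList s)) ℤ.* (𝟙 (hasPower? k (e n) v s) ℤ.* ww v)) ≡
      ∑ (perms n) (λ v → 𝟙 (const? γₛ (toList s)) ℤ.* (χ (s !_) β ℤ.* 𝟙 (cRoot? v ×-dec solves? v s 0₂)))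
    per-sign s = begin
      ∑ (perms n) (λ v → (K ℤ.* barSign γ (toList s)) ℤ.* (𝟙 (hasPower? k (e n) v s) ℤ.* ww v))
        ≡⟨ ∑-*ˡ (perms n) (K ℤ.* barSign γ (toList s)) (λ v → 𝟙 (hasPower? k (e n) v s) ℤ.* ww v) ⟩
      (K ℤ.* barSign γ (toList s)) ℤ.* ∑ (perms n) (λ v → 𝟙 (hasPower? k (e n) v s) ℤ.* ww v)
        ≡⟨ ℤₚ.*-assoc K (barSign γ (toList s)) _ ⟩
      K ℤ.* (barSign γ (toList s) ℤ.* ∑ (perms n) (λ v → 𝟙 (hasPower? k (e n) v s) ℤ.* ww v))
        ≡⟨ 𝟙-guard (const? γₛ (toList s)) (λ con → cong₂ ℤ._*_ (sym (χ-barSign s con)) (core-const s con)) ⟩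
      K ℤ.* (χ (s !_) β ℤ.* ∑ (perms n) (λ v → 𝟙 (cRoot? v ×-dec solves? v s 0₂)))
        ≡⟨ ℤₚ.*-assoc K (χ (s !_) β) _ ⟨
      (K ℤ.* χ (s !_) β) ℤ.* ∑ (perms n) (λ v → 𝟙 (cRoot? v ×-dec solves? v s 0₂))
        ≡⟨ ∑-*ˡ (perms n) (K ℤ.* χ (s !_) β) (λ v → 𝟙 (cRoot? v ×-dec solves? v s 0₂)) ⟨
      ∑ (perms n) (λ v → (K ℤ.* χ (s !_) β) ℤ.* 𝟙 (cRoot? v ×-dec solves? v s 0₂))
        ≡⟨ ∑-cong (perms n) (λ v → shuffle″ K (χ (s !_) β) (𝟙 (cRoot? v ×-dec solves? v s 0₂))) ⟩
      ∑ (perms n) (λ v → K ℤ.* (χ (s !_) β ℤ.* 𝟙 (cRoot? v ×-dec solves? v s 0₂))) ∎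
      where
      K = 𝟙 (const? γₛ (toList s))
    drop-const : ∀ v s → 𝟙 (const? γₛ (toList s)) ℤ.* (χ (s !_) β ℤ.* 𝟙 (cRoot? v ×-dec solves? v s 0₂)) ≡
      𝟙 (cRoot? v) ℤ.* (𝟙 (solves? v s 0₂) ℤ.* χ (s !_) β)
    drop-const v s = begin
      K ℤ.* (χ (s !_) β ℤ.* both)
        ≡⟨ shuffle′ K (χ (s !_) β) both ⟩
      both ℤ.* (K ℤ.* χ (s !_) β)
        ≡⟨ 𝟙-guard (cRoot? v ×-dec solves? v s 0₂) (λ (root , good) → trans
             (cong (ℤ._* χ (s !_) β) (𝟙-yes (const? γₛ (toList s)) (root⇒const v s root good))) (ℤₚ.*-identityˡ (χ (s !_) β))) ⟩
      both ℤ.* χ (s !_) β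
        ≡⟨ cong (ℤ._* χ (s !_) β) (𝟙-× (cRoot? v) (solves? v s 0₂)) ⟩
      𝟙 (cRoot? v) ℤ.* 𝟙 (solves? v s 0₂) ℤ.* χ (s !_) β
        ≡⟨ shuffle″ (𝟙 (cRoot? v)) (𝟙 (solves? v s 0₂)) (χ (s !_) β) ⟩
      𝟙 (cRoot? v) ℤ.* (𝟙 (solves? v s 0₂) ℤ.* χ (s !_) β) ∎
      where
      K = 𝟙 (const? γₛ (toList s))
      both = 𝟙 (cRoot? v ×-dec solves? v s 0₂)

theorem7p8 : (k n : ℕ) → Σ ℕ (λ m → k ≡ 1 + 2 * m) → 1 ≤ n →
    (γ : List (ℕ × Bool)) → IsSignedComposition n γ →
    (w : SVec n) → vals w ≡ canon γ →
    + (rB n k w) ≡ sumℤ (map (λ u → wt γ (sDes u)) (rootsOfUnity n k))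
theorem7p8 k n (m , refl) _ γ comp w w-canon = trans lhs (sym rhs)
  where open Final (2 * m) n γ comp w w-canon using (lhs; rhs)
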